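{- Let $P,Q\in\mathbb{Z}\setminus\{0\}$ be such that $D=P^2-4Q\neq 0$ and the Lucas sequences $U=U(P,Q)$, $V=V(P,Q)$ are nondegenerate. Let $M^U$ be the Möbius dual of $U$, let $p$ be a prime, and let $n\ge 1$ be an integer. If $p\nmid \gcd(P,Q)$, we have the following cases. (a) If $p\mid Q$, then $v_p(M^U_n)=0$ for all $n\ge 1$. (b) If $p\mid D$, then $$v_p(M^U_n)=\begin{cases} v_p(U_p), & \text{if } n=p,\\ 1, & \text{if } n=p^k,\ k>1,\\ 0, & \text{otherwise}.\end{cases}$$ (c) If $p\nmid QD$, then $$v_p(M^U_n)=\begin{cases} v_p(U_{z_U(p)}), & \text{if } n=z_U(p),\\ v_p(U_{p z_U(p)})-v_p(U_{z_U(p)}), & \text{if } n=p\,z_U(p),\\ 1, & \text{if } n=p^k z_U(p),\ k>1,\\ 0, & \text{otherwise}.\end{cases}$$ If $p\mid \gcd(P,Q)$, then we have the following cases. (d) If $v_p(Q)\ge 2v_p(P)$, then $$v_p(M^U_n)=\begin{cases} 0, & \text{if } n=1,\\ \varphi(n)v_p(P)+v_p\bigl(M^{U^{(p)}}_n\bigr), & \text{if } n>1,\end{cases}$$ where $U^{(p)}=U\bigl(\partial_p(P),\partial_p(Q)\bigr)$. (e) If $2v_p(P)>v_p(Q)$, then $$v_p(M^U_n)=\begin{cases} v_p(P), & \text{if } n=2,\\ (\varphi(n)/2)\,v_p(Q)+1, & \text{if } n=2p^k,\ k\ge 1,\\ \lfloor \varphi(n)/2\rfloor\, v_p(Q), &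 \text{otherwise},\end{cases}$$ unless $2v_p(P)=v_p(Q)+1$, $p=2$ or $3$, and $n=2p$, in which case $$v_p(M^U_{2p})=v_p(Q)+1+v_p\bigl(\partial_p(P)^2-\partial_p(Q)\bigr).$$
   Context: For $P,Q\in\mathbb{Z}\setminus\{0\}$ with $D=P^2-4Q\ne 0$, let $\alpha=\frac{P+\sqrt D}{2}$, $\beta=\frac{P-\sqrt D}{2}$ be the roots of $X^2-PX+Q$. The Lucas sequences of the first and second kind are the integer sequences $U(P,Q)=(U_n)_{n\ge 0}$ and $V(P,Q)=(V_n)_{n\ge 0}$ given by $U_n=\frac{\alpha^n-\beta^n}{\alpha-\beta}$ and $V_n=\alpha^n+\beta^n$. They are called nondegenerate if $U_n\ne 0$ and $V_n\neq 0$ for all $n\ge 1$ (equivalently, $\alpha/\beta$ is not a root of unity). It is not assumed that $\gcd(P,Q)=1$. For a sequence $A=(A_n)_{n\ge 1}$ of nonzero integers, its Möbius dual $M^A=(M^A_n)_{n\ge 1}$ is the sequence of rational numbers $M^A_n=\prod_{d\mid n}A_d^{\mu(n/d)}$, where $\mu$ is the Möbius function. $v_p$ is the $p$-adic valuation on $\mathbb{Q}$, $\varphi$ is Euler's totient function, and $\partial_p(m)=m/p^{v_p(m)}$ is the $p$-free part of a nonzero integer $m$. The entry point (rank of apparition) of a prime $p$ in $U$ is $z_U(p)=\min\{n\ge 1: p\mid U_n\}$; it exists except when $p\nmid P$ and $p\mid Q$.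
   Formalization: In (d), U^{(p)} is taken as U(∂_p(P), Q/p^{2v_p(P)}) instead of U(∂_p(P), ∂_p(Q)); the two agree when v_p(Q)=2v_p(P). As printed, (d) fails for P=2, Q=-8, p=2, n=3: v_2(M^U_3)=2, but the formula gives 3. -}

module Defs where

open import Algebra.Bundles using (CommutativeMonoid; CommutativeRing)
open import Algebra.Morphism.Structures using (module RingMorphisms)
open import Data.Bool.Base using (if_then_else_)
open import Data.Integer.Base as ℤ using (ℤ; +_; +[1+_]; -[1+_]; 0ℤ; 1ℤ; -1ℤ; ∣_∣)
import Data.Integer.Divisibility as ℤ
import Data.Integer.Properties as ℤ
open import Data.List.Base using (length; filter; map; foldr; upTo)
import Data.List.Relation.Unary.Unique.DecPropositional as Unique
open import Data.Nat.Base as ℕ using (ℕ; zero; suc)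
open import Data.Nat.Coprimality using (coprime?)
open import Data.Nat.DivMod using () renaming (_/_ to _/ⁿ_)
open import Data.Nat.Divisibility using (_∣?_)
import Data.Nat.Properties as ℕ
open import Data.Nat.Primality using (Prime; prime⇒nonZero)
open import Data.Nat.Primality.Factorisation using (factors; factorise)
open import Data.Product.Base using (_×_; _,_)
open import Data.Rational.Base as ℚ using (ℚ; mkℚ; 0ℚ; 1ℚ; ↥_; ↧ₙ_)
open import Relation.Binary.PropositionalEquality.Core using (_≢_)
open import Relation.Nullary.Decidable using (does)

import Algebra.Definitions.RawSemiring ℚ.+-*-rawSemiring as ℚ^
import Algebra.Properties.CommutativeSemigroup as CommutativeSemigroupProperties
import Algebra.Properties.Ring as RingProperties
import Algebra.Properties.Semiring.Exp as Exp
import Relation.Binary.Reasoning.Setoid as ≈-Reasoning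

discriminant : ℤ → ℤ → ℤ
discriminant P Q = P ℤ.^ 2 ℤ.- + 4 ℤ.* Q

-- The Lucas sequences are computed by their recurrence. `binet` derives
-- (α - β) Uₙ = αⁿ - βⁿ and Vₙ = αⁿ + βⁿ from α + β = P and α β = Q in any
-- commutative ring; in ℂ, (α - β)² = D ≠ 0, so α - β can be divided out.

U : ℤ → ℤ → ℕ → ℤ
U P Q zero          = 0ℤ
U P Q (suc zero)    = 1ℤ
U P Q (suc (suc n)) = P ℤ.* U P Q (suc n) ℤ.- Q ℤ.* U P Q n

V : ℤ → ℤ → ℕ → ℤ
V P Q zero          = + 2
V P Q (suc zero)    = P
V P Q (suc (suc n)) = P ℤ.* V P Q (suc n) ℤ.- Q ℤ.* V P Q n

module _ {c ℓ} (R : CommutativeRing c ℓ) where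

  open CommutativeRing R hiding (zero)
  open RingMorphisms ℤ.+-*-rawRing rawRing using (IsRingHomomorphism)
  open Exp semiring using (_^_)

  private

    open ≈-Reasoning setoid
    open CommutativeSemigroupProperties (CommutativeMonoid.commutativeSemigroup +-commutativeMonoid) using (interchange)
    open RingProperties ring using (-‿+-comm; -1*x≈-x; x[y-z]≈xy-xz)

    module _ (α β : Carrier) where

      lucas : Carrier → Carrier → Carrier
      lucas x y = (α + β) * x - (α * β) * y

      lucas-cong : ∀ {x x′ y y′} → x ≈ x′ → y ≈ y′ → lucas x y ≈ lucas x′ y′
      lucas-cong p q = +-cong (*-congˡ p) (-‿cong (*-congˡ q))

      lucas-+ : ∀ x y x′ y′ → lucas (x + x′) (y + y′) ≈ lucas x y + lucas x′ y′
      lucas-+ x y x′ y′ = begin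
        (α + β) * (x + x′) - (α * β) * (y + y′)
          ≈⟨ +-cong (distribˡ _ x x′) (-‿cong (distribˡ _ y y′)) ⟩
        ((α + β) * x + (α + β) * x′) - ((α * β) * y + (α * β) * y′)
          ≈⟨ +-congˡ (-‿+-comm _ _) ⟨
        ((α + β) * x + (α + β) * x′) + (- ((α * β) * y) - (α * β) * y′)
          ≈⟨ interchange _ _ _ _ ⟩
        lucas x y + lucas x′ y′ ∎

      lucas-* : ∀ d x y → d * lucas x y ≈ lucas (d * x) (d * y)
      lucas-* d x y = trans (x[y-z]≈xy-xz d _ _) (+-cong (swap _ x) (-‿cong (swap _ y)))
        where
        swap : ∀ e z → d * (e * z) ≈ e * (d * z)
        swap e z = trans (sym (*-assoc d e z)) (trans (*-congʳ (*-comm d e)) (*-assoc e d z))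

      lucas-neg : ∀ x y → lucas (- x) (- y) ≈ - lucas x y
      lucas-neg x y = begin
        lucas (- x) (- y)          ≈⟨ lucas-cong (-1*x≈-x x) (-1*x≈-x y) ⟨
        lucas (- 1# * x) (- 1# * y) ≈⟨ lucas-* (- 1#) x y ⟨
        - 1# * lucas x y           ≈⟨ -1*x≈-x _ ⟩
        - lucas x y ∎

      cancel : ∀ x y → x + y - y ≈ x
      cancel x y = trans (+-assoc x y (- y)) (trans (+-congˡ (-‿inverseʳ y)) (+-identityʳ x))

      lucas-α : ∀ a → lucas (α * a) a ≈ α * (α * a)
      lucas-α a = begin
        (α + β) * (α * a) - (α * β) * a
          ≈⟨ +-cong (distribʳ _ α β) (-‿cong (trans (*-congʳ (*-comm α β)) (*-assoc β α a))) ⟩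
        α * (α * a) + β * (α * a) - β * (α * a)
          ≈⟨ cancel _ _ ⟩
        α * (α * a) ∎

      lucas-β : ∀ b → lucas (β * b) b ≈ β * (β * b)
      lucas-β b = begin
        (α + β) * (β * b) - (α * β) * b
          ≈⟨ +-cong (trans (distribʳ _ α β) (+-comm _ _)) (-‿cong (*-assoc α β b)) ⟩
        β * (β * b) + α * (β * b) - α * (β * b)
          ≈⟨ cancel _ _ ⟩
        β * (β * b) ∎

  module _ {ι : ℤ → Carrier} (ι-hom : IsRingHomomorphism ι) {P Q : ℤ} {α β : Carrier}
    (α+β≈P : α + β ≈ ι P) (αβ≈Q : α * β ≈ ι Q) where

    private

      module ι = IsRingHomomorphism ι-hom

      ι-step : ∀ x y → ι (P ℤ.* x ℤ.- Q ℤ.* y) ≈ lucas α β (ι x) (ι y)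
      ι-step x y = trans (ι.+-homo (P ℤ.* x) (ℤ.- (Q ℤ.* y)))
        (+-cong
          (trans (ι.*-homo P x) (*-congʳ (sym α+β≈P)))
          (trans (ι.-‿homo (Q ℤ.* y)) (-‿cong (trans (ι.*-homo Q y) (*-congʳ (sym αβ≈Q))))))

    binet : ∀ n → ((α - β) * ι (U P Q n) ≈ α ^ n - β ^ n) × (ι (V P Q n) ≈ α ^ n + β ^ n)
    binet zero =
        trans (*-congˡ ι.0#-homo) (trans (zeroʳ _) (sym (-‿inverseʳ 1#)))
      , trans (ι.+-homo 1ℤ 1ℤ) (+-cong ι.1#-homo ι.1#-homo)
    binet (suc zero) =
        trans (*-congˡ ι.1#-homo)
          (trans (*-identityʳ _) (sym (+-cong (*-identityʳ α) (-‿cong (*-identityʳ β)))))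
      , trans (sym α+β≈P) (sym (+-cong (*-identityʳ α) (*-identityʳ β)))
    binet (suc (suc n)) with binet (suc n) | binet n
    ... | u₁ , v₁ | u₀ , v₀ = (begin
        (α - β) * ι (U P Q (suc (suc n)))
          ≈⟨ *-congˡ (ι-step (U P Q (suc n)) (U P Q n)) ⟩
        (α - β) * lucas α β (ι (U P Q (suc n))) (ι (U P Q n))
          ≈⟨ lucas-* α β _ _ _ ⟩
        lucas α β ((α - β) * ι (U P Q (suc n))) ((α - β) * ι (U P Q n))
          ≈⟨ lucas-cong α β u₁ u₀ ⟩
        lucas α β (α ^ suc n - β ^ suc n) (α ^ n - β ^ n)
          ≈⟨ lucas-+ α β _ _ _ _ ⟩
        lucas α β (α ^ suc n) (α ^ n) + lucas α β (- (β ^ suc n)) (- (β ^ n))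
          ≈⟨ +-cong (lucas-α α β _) (trans (lucas-neg α β _ _) (-‿cong (lucas-β α β _))) ⟩
        α ^ suc (suc n) - β ^ suc (suc n) ∎)
      , (begin
        ι (V P Q (suc (suc n)))
          ≈⟨ ι-step (V P Q (suc n)) (V P Q n) ⟩
        lucas α β (ι (V P Q (suc n))) (ι (V P Q n))
          ≈⟨ lucas-cong α β v₁ v₀ ⟩
        lucas α β (α ^ suc n + β ^ suc n) (α ^ n + β ^ n)
          ≈⟨ lucas-+ α β _ _ _ _ ⟩
        lucas α β (α ^ suc n) (α ^ n) + lucas α β (β ^ suc n) (β ^ n)
          ≈⟨ +-cong (lucas-α α β _) (lucas-β α β _) ⟩
        α ^ suc (suc n) + β ^ suc (suc n) ∎)

Nondegenerate : ℤ → ℤ → Set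
Nondegenerate P Q = ∀ n → 1 ℕ.≤ n → U P Q n ≢ 0ℤ × V P Q n ≢ 0ℤ

IsEntryPoint : ℤ → ℤ → ℕ → ℕ → Set
IsEntryPoint P Q p z =
  1 ℕ.≤ z × + p ℤ.∣ U P Q z × (∀ m → 1 ℕ.≤ m → + p ℤ.∣ U P Q m → z ℕ.≤ m)

φ : ℕ → ℕ
φ n = length (filter (coprime? n) (map suc (upTo n)))

μ : ℕ → ℤ
μ zero      = 0ℤ
μ n@(suc _) = if does (unique? ps) then -1ℤ ℤ.^ length ps else 0ℤ
  where
  open Unique ℕ._≟_ using (unique?)
  ps = factors (factorise n)

-- The largest k ≤ b with p ^ k ∣ n.

maxExponent : ℕ → ℕ → ℕ → ℕ
maxExponent p n zero      = zero
maxExponent p n b@(suc c) = if does (p ℕ.^ b ∣? n) then b else maxExponent p n c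

-- For p ≥ 2 and n ≥ 1, p ^ k ∣ n forces k < n. By convention v p 0 = 0.

v : ℕ → ℕ → ℕ
v p n = maxExponent p n n

vℤ : ℕ → ℤ → ℕ
vℤ p i = v p ∣ i ∣

vℚ : ℕ → ℚ → ℤ
vℚ p q = + vℤ p (↥ q) ℤ.- + v p (↧ₙ q)

-- With inv 0 = 0, as in a field with totalised division.

inv : ℚ → ℚ
inv (mkℚ (+ 0)    _ _)   = 0ℚ
inv q@(mkℚ +[1+ _ ] _ _) = ℚ.1/ q
inv q@(mkℚ -[1+ _ ] _ _) = ℚ.1/ q

infixr 8 _^ℤ_

_^ℤ_ : ℚ → ℤ → ℚ
q ^ℤ (+ n)    = q ℚ^.^ n
q ^ℤ -[1+ n ] = inv (q ℚ^.^ suc n)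

-- A is read at indices n ≥ 1 only, and is meant to be nonzero there. The list
-- runs over the i < n with suc i ∣ n, that is, over the divisors d = suc i.

möbiusFactor : (ℕ → ℤ) → ℕ → ℕ → ℚ
möbiusFactor A n i = (A (suc i) ℚ./ 1) ^ℤ μ (n /ⁿ suc i)

möbiusDual : (ℕ → ℤ) → ℕ → ℚ
möbiusDual A n = foldr ℚ._*_ 1ℚ (map (möbiusFactor A n) (filter (λ i → suc i ∣? n) (upTo n)))

module _ {p : ℕ} (p-prime : Prime p) where

  -- m / p ^ k, used only when p ^ k ∣ m
  infixl 7 _/^_

  _/^_ : ℤ → ℕ → ℤ
  m /^ k = (m ℤ./ℕ (p ℕ.^ k)) {{ℕ.m^n≢0 p k {{prime⇒nonZero p-prime}}}}

  ∂ : ℤ → ℤ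
  ∂ m = m /^ vℤ p m

  -- Used for v_p(Q) ≥ 2 v_p(P), where U P Q n = p ^ ((n - 1) v_p(P)) * U⁽ᵖ⁾ P Q n
  -- for n ≥ 1. The second parameter is ∂ Q exactly when v_p(Q) = 2 v_p(P). For
  -- v_p(Q) > 2 v_p(P) it must keep the excess power of p: with P = 2, Q = -8,
  -- p = 2, U₃(2, -8) = 12 = 2² U₃(1, -2), whereas U₃(1, -1) = 2 is even, and with
  -- P = 2, Q = 8 the sequence U(1, 1) has zero terms, so no Möbius dual.
  U⁽ᵖ⁾ : ℤ → ℤ → ℕ → ℤ
  U⁽ᵖ⁾ P Q = U (∂ P) (Q /^ (2 ℕ.* vℤ p P))

{-# OPTIONS --safe #-}
module Submission where

-- The valuation of M^U_n is the Möbius transform Σ_{d ∣ n} μ(n/d) v_p(U_d). The transform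
-- of d ↦ [m ∣ d] is the indicator of n = m and that of d ↦ d is φ, so everything comes
-- down to writing v_p(U_d) as a combination of such functions.
--
-- If p ∤ Q and z is the rank of apparition of p, then p ∣ U_d exactly when z ∣ d, and
-- U_{mz} = U_z U_m(V_z, Q^z), where the second factor has discriminant D U_z². For a
-- sequence with p ∣ D and p ∤ Q, v_p(U_m) is 0 for p ∤ m and v_p(U_p) + v_p(m/p) for
-- p ∣ m, so v_p(U_d) is a combination of the functions [p^k z ∣ d].
--
-- If p ∣ gcd(P, Q), a power of p is split off first: directly when 2 v_p(P) ≤ v_p(Q), and
-- otherwise after passing to U_{2m} = P U_m(V_2, Q²), which leaves a
-- sequence with p ∣ D, p ∤ Q.

-- For `p ∣ D` and `p ∤ Q` one has `v_p(U_p) = 1` as soon as `p ≥ 5`; for `p = 2` and `p = 3` this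
-- can fail, and `8 ∣ D` or `9 ∣ D` respectively is what restores it. These two primes shape the
-- proof. A single passage from `U_m` to `U_{pm} / U_p` multiplies `D` by `U_p²`, so `p³ ∣ D` holds
-- from then on and every further factor `p` of the index adds exactly 1. That is why irregular
-- values occur only at the first two levels `z` and `pz` of a tower and every later level
-- contributes 1.
--
-- The exceptional case has the same origin. If `2 v_p(P) > v_p(Q)`, the sequence that remains after
-- powers of `p` are split off has a discriminant divisible by 8 (for `p = 2`) or 9 (for `p = 3`)
-- unless `2 v_p(P) = v_p(Q) + 1`. There its `p`-th term is factored by hand, and `∂(P)² - ∂(Q)` is
-- one of the factors.

open import Defs
open import Algebra.Bundles using (CommutativeMonoid)
import Algebra.Definitions.RawSemiring
import Algebra.Properties.CommutativeSemigroup
open import Data.Bool.Base using (if_then_else_)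
open import Data.Fin.Base using (Fin; toℕ; fromℕ<; combine)
import Data.Fin.Properties as Fin
open import Data.Integer.Base using (ℤ; +_; +[1+_]; -[1+_]; 0ℤ; 1ℤ; -1ℤ; ∣_∣; _%ℕ_; _/ℕ_) renaming (_+_ to _+ᶻ_; _-_ to _-ᶻ_; _*_ to _*ᶻ_; _^_ to _^ᶻ_; -_ to -ᶻ_)
open import Data.Integer.Divisibility using () renaming (_∣_ to _∣ᶻ_)
open import Data.Integer.Divisibility.Signed using (∣ᵤ⇒∣; ∣⇒∣ᵤ; ∣-refl; ∣-trans; ∣m∣n⇒∣m+n; ∣m∣n⇒∣m-n; ∣m+n∣m⇒∣n; ∣m⇒∣m*n; ∣n⇒∣m*n) renaming (_∣_ to _∣ˢ_; _∣?_ to _∣?ˢ_; divides to dividesˢ)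
open import Data.Integer.DivMod using (n%ℕd<d; a≡a%ℕn+[a/ℕn]*n)
open import Data.Integer.GCD using () renaming (gcd to gcdᶻ)
import Data.Integer.GCD as ℤ
import Data.Integer.Properties as ℤ
open import Data.Integer.Tactic.RingSolver using (solve-∀)
open import Data.List.Base using (List; []; _∷_; length; filter; map; foldr; applyUpTo)
open import Data.List.Membership.Propositional using (_∈_)
open import Data.List.Properties using (map-upTo)
open import Data.List.Relation.Binary.Permutation.Propositional using (_↭_; ↭⇒↭ₛ; ↭-sym)
open import Data.List.Relation.Binary.Permutation.Propositional.Properties using (↭-length)
import Data.List.Relation.Binary.Permutation.Setoid.Properties as Permutation
open import Data.List.Relation.Unary.All as All using (All; []; _∷_)
open import Data.List.Relation.Unary.AllPairs using (uncons; _∷_)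
import Data.List.Relation.Unary.Unique.DecPropositional
open import Data.Nat.Base using (ℕ; zero; suc; NonZero; nonZero; >-nonZero; >-nonZero⁻¹; ≢-nonZero; ≢-nonZero⁻¹; nonTrivial⇒n>1; _+_; _*_; _^_; _/_; _%_; _∸_; _≤_; _<_; z≤n; s≤s)
open import Data.Nat.Coprimality using (coprime?; coprime⇒gcd≡1; gcd≡1⇒coprime; 1-coprimeTo) renaming (sym to coprime-sym)
open import Data.Nat.Divisibility using (_∣_; _∣?_; divides)
import Data.Nat.Divisibility as ℕ
open import Data.Nat.DivMod using (m*n/n≡m; m≡m%n+[m/n]*n; m%n<n; +-distrib-/-∣ʳ; m<n⇒m/n≡0)
open import Data.Nat.GCD using (gcd; gcd[m,n]∣m; gcd[m,n]∣n; gcd-greatest; gcd[m,n]≢0)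
open import Data.Nat.Induction using (<-rec)
open import Data.Nat.ListAction.Properties using (∈⇒∣product)
open import Data.Nat.Primality using (Prime; prime?; prime[2]; prime⇒nonZero; prime⇒nonTrivial; prime⇒irreducible; euclidsLemma)
open import Data.Nat.Primality.Factorisation using (PrimeFactorisation; factors; factorise; factorisationUnique; factorisationHasAllPrimeFactors)
import Data.Nat.Properties as ℕ
open import Data.Product.Base using (∃-syntax; _×_; _,_; proj₁; proj₂)
open import Data.Rational.Base as ℚ using (ℚ; mkℚ; 1ℚ; ↥_; ↧_)
import Data.Rational.Properties as ℚ
open import Data.Sum.Base using (_⊎_; inj₁; inj₂; [_,_]′)
open import Function.Base using (_∘_; case_of_)
open import Relation.Binary.PropositionalEquality using (_≡_; _≢_; refl; sym; trans; cong; cong₂; subst; setoid; module ≡-Reasoning)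
open import Relation.Nullary.Decidable using (Dec; yes; no; does; dec-true; dec-false; from-yes; _×-dec_)
open import Relation.Nullary.Negation using (¬_; contradiction)

open PrimeFactorisation using (isFactorisation; factorsPrime)
open Algebra.Properties.CommutativeSemigroup (CommutativeMonoid.commutativeSemigroup ℤ.+-0-commutativeMonoid) using (interchange)
open Data.List.Relation.Unary.Unique.DecPropositional ℕ._≟_ using (Unique; unique?)
module ℚ^ = Algebra.Definitions.RawSemiring ℚ.+-*-rawSemiring

-- Finite sums and indicators

∑ : ℕ → (ℕ → ℤ) → ℤ
∑ zero    f = 0ℤ
∑ (suc n) f = f 0 +ᶻ ∑ n (f ∘ suc)

∑-cong : ∀ n {f g : ℕ → ℤ} → (∀ i → i < n → f i ≡ g i) → ∑ n f ≡ ∑ n g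
∑-cong zero    f≗g = refl
∑-cong (suc n) f≗g = cong₂ _+ᶻ_ (f≗g 0 (s≤s z≤n)) (∑-cong n (λ i i<n → f≗g (suc i) (s≤s i<n)))

∑-zero : ∀ n {f : ℕ → ℤ} → (∀ i → i < n → f i ≡ 0ℤ) → ∑ n f ≡ 0ℤ
∑-zero zero    f≗0 = refl
∑-zero (suc n) f≗0 = cong₂ _+ᶻ_ (f≗0 0 (s≤s z≤n)) (∑-zero n (λ i i<n → f≗0 (suc i) (s≤s i<n)))

∑-+ : ∀ n (f g : ℕ → ℤ) → ∑ n (λ i → f i +ᶻ g i) ≡ ∑ n f +ᶻ ∑ n g
∑-+ zero    f g = refl
∑-+ (suc n) f g = trans (cong (f 0 +ᶻ g 0 +ᶻ_) (∑-+ n (f ∘ suc) (g ∘ suc)))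
  (interchange (f 0) (g 0) (∑ n (f ∘ suc)) (∑ n (g ∘ suc)))

∑-*ˡ : ∀ n c (f : ℕ → ℤ) → ∑ n (λ i → c *ᶻ f i) ≡ c *ᶻ ∑ n f
∑-*ˡ zero    c f = sym (ℤ.*-zeroʳ c)
∑-*ˡ (suc n) c f = trans (cong (c *ᶻ f 0 +ᶻ_) (∑-*ˡ n c (f ∘ suc))) (sym (ℤ.*-distribˡ-+ c (f 0) _))

∑-swap : ∀ m n (f : ℕ → ℕ → ℤ) → ∑ m (λ i → ∑ n (f i)) ≡ ∑ n (λ j → ∑ m (λ i → f i j))
∑-swap zero    n f = sym (∑-zero n (λ _ _ → refl))
∑-swap (suc m) n f = trans (cong (∑ n (f 0) +ᶻ_) (∑-swap m n (f ∘ suc)))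
  (sym (∑-+ n (f 0) (λ j → ∑ m (λ i → f (suc i) j))))

∑-single : ∀ n {f : ℕ → ℤ} k → k < n → (∀ i → i < n → i ≢ k → f i ≡ 0ℤ) → ∑ n f ≡ f k
∑-single (suc n) {f} zero _ f≗0 =
  trans (cong (f 0 +ᶻ_) (∑-zero n (λ i i<n → f≗0 (suc i) (s≤s i<n) λ ()))) (ℤ.+-identityʳ (f 0))
∑-single (suc n) {f} (suc k) (s≤s k<n) f≗0 =
  trans (cong₂ _+ᶻ_ (f≗0 0 (s≤s z≤n) λ ())
      (∑-single n k k<n (λ i i<n i≢k → f≗0 (suc i) (s≤s i<n) (i≢k ∘ ℕ.suc-injective))))
    (ℤ.+-identityˡ (f (suc k)))

⟦_⟧ : ∀ {A : Set} → Dec A → ℤ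
⟦ a? ⟧ = if does a? then 1ℤ else 0ℤ

⟦⟧-yes : ∀ {A : Set} (a? : Dec A) → A → ⟦ a? ⟧ ≡ 1ℤ
⟦⟧-yes a? a = cong (if_then 1ℤ else 0ℤ) (dec-true a? a)

⟦⟧-no : ∀ {A : Set} (a? : Dec A) → ¬ A → ⟦ a? ⟧ ≡ 0ℤ
⟦⟧-no a? ¬a = cong (if_then 1ℤ else 0ℤ) (dec-false a? ¬a)

⟦⟧-⇔ : ∀ {A B : Set} (a? : Dec A) (b? : Dec B) → (A → B) → (B → A) → ⟦ a? ⟧ ≡ ⟦ b? ⟧
⟦⟧-⇔ (yes a) b? f g = sym (⟦⟧-yes b? (f a))
⟦⟧-⇔ (no ¬a) b? f g = sym (⟦⟧-no b? (¬a ∘ g))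

⟦⟧-yes-* : ∀ {A : Set} (a? : Dec A) x → A → ⟦ a? ⟧ *ᶻ x ≡ x
⟦⟧-yes-* a? x a = trans (cong (_*ᶻ x) (⟦⟧-yes a? a)) (ℤ.*-identityˡ x)

⟦⟧-no-* : ∀ {A : Set} (a? : Dec A) x → ¬ A → ⟦ a? ⟧ *ᶻ x ≡ 0ℤ
⟦⟧-no-* a? x ¬a = trans (cong (_*ᶻ x) (⟦⟧-no a? ¬a)) (ℤ.*-zeroˡ x)

-- The substitution `d = m * e`, obtained by summing `⟦ d ≟ m * e ⟧ *ᶻ h d` in both orders. Both
-- ranges stop at the same `N`, so `m * e` may overshoot it; the vanishing of `h` from `N` on
-- absorbs those terms.
∑-multiples : ∀ N m .{{_ : NonZero m}} (h : ℕ → ℤ) → (∀ d → N ≤ d → h d ≡ 0ℤ) →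
  ∑ N (λ d → ⟦ m ∣? d ⟧ *ᶻ h d) ≡ ∑ N (λ e → h (m * e))
∑-multiples N m h h≗0 = begin
  ∑ N (λ d → ⟦ m ∣? d ⟧ *ᶻ h d)                  ≡⟨ ∑-cong N expand ⟩
  ∑ N (λ d → ∑ N (λ e → ⟦ d ℕ.≟ m * e ⟧ *ᶻ h d)) ≡⟨ ∑-swap N N (λ d e → ⟦ d ℕ.≟ m * e ⟧ *ᶻ h d) ⟩
  ∑ N (λ e → ∑ N (λ d → ⟦ d ℕ.≟ m * e ⟧ *ᶻ h d)) ≡⟨ ∑-cong N (λ e _ → collapse e) ⟩
  ∑ N (λ e → h (m * e))                          ∎
  where
  open ≡-Reasoning

  expand : ∀ d → d < N → ⟦ m ∣? d ⟧ *ᶻ h d ≡ ∑ N (λ e → ⟦ d ℕ.≟ m * e ⟧ *ᶻ h d)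
  expand d d<N with m ∣? d
  ... | no m∤d = sym (∑-zero N (λ e _ → ⟦⟧-no-* (d ℕ.≟ m * e) (h d) (λ eq → m∤d (divides e (trans eq (ℕ.*-comm m e))))))
  ... | yes (divides e d≡e*m) = trans (ℤ.*-identityˡ (h d))
    (sym (trans (∑-single N e e<N others) (⟦⟧-yes-* (d ℕ.≟ m * e) (h d) d≡m*e)))
    where
    d≡m*e : d ≡ m * e
    d≡m*e = trans d≡e*m (ℕ.*-comm e m)
    e<N : e < N
    e<N = ℕ.≤-<-trans (ℕ.≤-trans (ℕ.m≤n*m e m) (ℕ.≤-reflexive (sym d≡m*e))) d<N
    others : ∀ i → i < N → i ≢ e → ⟦ d ℕ.≟ m * i ⟧ *ᶻ h d ≡ 0ℤ
    others i _ i≢e = ⟦⟧-no-* (d ℕ.≟ m * i) (h d) (λ eq → i≢e (ℕ.*-cancelˡ-≡ i e m (trans (sym eq) d≡m*e)))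

  collapse : ∀ e → ∑ N (λ d → ⟦ d ℕ.≟ m * e ⟧ *ᶻ h d) ≡ h (m * e)
  collapse e with m * e ℕ.<? N
  ... | yes me<N = trans (∑-single N (m * e) me<N (λ i _ i≢ → ⟦⟧-no-* (i ℕ.≟ m * e) (h i) i≢))
                         (⟦⟧-yes-* (m * e ℕ.≟ m * e) (h (m * e)) refl)
  ... | no me≮N = trans (∑-zero N (λ i i<N → ⟦⟧-no-* (i ℕ.≟ m * e) (h i) (λ { refl → me≮N i<N })))
                        (sym (h≗0 (m * e) (ℕ.≮⇒≥ me≮N)))

-- The Möbius function

μ-list : List ℕ → ℤ
μ-list ps = if does (unique? ps) then -1ℤ ^ᶻ length ps else 0ℤ

μ-list-unique : ∀ {ps} → Unique ps → μ-list ps ≡ -1ℤ ^ᶻ length ps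
μ-list-unique {ps} u = cong (if_then -1ℤ ^ᶻ length ps else 0ℤ) (dec-true (unique? ps) u)

μ-list-¬unique : ∀ {ps} → ¬ Unique ps → μ-list ps ≡ 0ℤ
μ-list-¬unique {ps} ¬u = cong (if_then -1ℤ ^ᶻ length ps else 0ℤ) (dec-false (unique? ps) ¬u)

μ-list-↭ : ∀ {ps qs} → ps ↭ qs → μ-list ps ≡ μ-list qs
μ-list-↭ {ps} {qs} ps↭qs with unique? ps
... | yes u = trans (cong (-1ℤ ^ᶻ_) (↭-length ps↭qs))
  (sym (μ-list-unique (Permutation.Unique-resp-↭ (setoid ℕ) (↭⇒↭ₛ ps↭qs) u)))
... | no ¬u = sym (μ-list-¬unique (¬u ∘ Permutation.Unique-resp-↭ (setoid ℕ) (↭⇒↭ₛ (↭-sym ps↭qs))))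

-- Prime factorisations are unique up to order and `μ-list` ignores the order. Hence `μ` may be read
-- off any factorisation, in particular one with a chosen prime at its head.
μ-factors : ∀ n .{{_ : NonZero n}} (f : PrimeFactorisation n) → μ n ≡ μ-list (factors f)
μ-factors (suc n) f = μ-list-↭ (factorisationUnique (factorise (suc n)) f)

prime*-factorisation : ∀ {p n} → Prime p → PrimeFactorisation n → PrimeFactorisation (p * n)
prime*-factorisation {p} p-prime f = record
  { factors         = p ∷ factors f
  ; isFactorisation = cong (p *_) (isFactorisation f)
  ; factorsPrime    = p-prime ∷ factorsPrime f
  }

μ-list-∷ : ∀ {p ps} → All (p ≢_) ps → μ-list (p ∷ ps) ≡ -ᶻ μ-list ps
μ-list-∷ {p} {ps} p∉ps = case unique? ps of λ where
  (yes u) → trans (μ-list-unique (p∉ps ∷ u))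
    (trans (ℤ.-1*i≡-i (-1ℤ ^ᶻ length ps)) (cong -ᶻ_ (sym (μ-list-unique u))))
  (no ¬u) → trans (μ-list-¬unique (¬u ∘ proj₂ ∘ uncons)) (cong -ᶻ_ (sym (μ-list-¬unique ¬u)))

μ-prime-∤ : ∀ {p n} .{{_ : NonZero n}} → Prime p → ¬ p ∣ n → μ (p * n) ≡ -ᶻ μ n
μ-prime-∤ {p} {n} p-prime p∤n = begin
  μ (p * n)        ≡⟨ μ-factors (p * n) (prime*-factorisation p-prime f) ⟩
  μ-list (p ∷ ps)  ≡⟨ μ-list-∷ (All.tabulate (λ q∈ps p≡q → p∤n (subst (_∣ n) (sym p≡q) (q∣n q∈ps)))) ⟩
  -ᶻ μ-list ps     ≡⟨ cong -ᶻ_ (μ-factors n f) ⟨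
  -ᶻ μ n           ∎
  where
  open ≡-Reasoning
  instance
    _ = prime⇒nonZero p-prime
    _ = ℕ.m*n≢0 p n
  f = factorise n
  ps = factors f
  q∣n : ∀ {q} → q ∈ ps → q ∣ n
  q∣n q∈ps = subst (_ ∣_) (sym (isFactorisation f)) (∈⇒∣product q∈ps)

μ-prime-∣ : ∀ {p n} .{{_ : NonZero n}} → Prime p → p ∣ n → μ (p * n) ≡ 0ℤ
μ-prime-∣ {p} {n} p-prime p∣n =
  trans (μ-factors (p * n) (prime*-factorisation p-prime f))
    (μ-list-¬unique (λ u → All.lookup (proj₁ (uncons u)) p∈ps refl))
  where
  instance
    _ = prime⇒nonZero p-prime
    _ = ℕ.m*n≢0 p n
  f = factorise n
  p∈ps : p ∈ factors f
  p∈ps = factorisationHasAllPrimeFactors p-prime (subst (p ∣_) (isFactorisation f) p∣n) (factorsPrime f)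

prime-divisor : ∀ n → 1 < n → ∃[ p ] (Prime p × p ∣ n)
prime-divisor n@(suc _) 1<n with factorise n
... | record { factors = []     ; isFactorisation = n≡1 } = contradiction (sym n≡1) (ℕ.<⇒≢ 1<n)
... | record { factors = p ∷ ps ; isFactorisation = n≡p*_ ; factorsPrime = p-prime ∷ _ } =
  p , p-prime , subst (p ∣_) (sym n≡p*_) (ℕ.m∣m*n _)

-- For `n = n′ * p` the divisors that are multiples of `p` are the `p * c` with `c ∣ n′`, and the
-- others are the `c ∣ n′` prime to `p`. The terms of `c` and `p * c` cancel if `p ∤ c`, and
-- `μ (p * c) = 0` if `p ∣ c`. The bound `N` is left free because the sum is later taken for
-- divisors of a larger number.
∑-μ : ∀ N n .{{_ : NonZero n}} → n < N → ∑ N (λ c → ⟦ c ∣? n ⟧ *ᶻ μ c) ≡ ⟦ n ℕ.≟ 1 ⟧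
∑-μ N n n<N with n ℕ.≟ 1
... | yes refl = ∑-single N 1 n<N (λ c _ c≢1 → ⟦⟧-no-* (c ∣? 1) (μ c) (c≢1 ∘ ℕ.∣1⇒≡1))
... | no n≢1 with prime-divisor n (ℕ.≤∧≢⇒< (>-nonZero⁻¹ n) (n≢1 ∘ sym))
... | p , p-prime , divides n′ refl = begin
  ∑ N (λ c → ⟦ c ∣? n′ * p ⟧ *ᶻ μ c)
    ≡⟨ ∑-cong N (λ c _ → split c) ⟩
  ∑ N (λ c → coprimePart c +ᶻ ⟦ p ∣? c ⟧ *ᶻ (⟦ c ∣? n′ * p ⟧ *ᶻ μ c))
    ≡⟨ ∑-+ N _ _ ⟩
  ∑ N coprimePart +ᶻ ∑ N (λ c → ⟦ p ∣? c ⟧ *ᶻ (⟦ c ∣? n′ * p ⟧ *ᶻ μ c))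
    ≡⟨ cong (∑ N coprimePart +ᶻ_) (∑-multiples N p (λ c → ⟦ c ∣? n′ * p ⟧ *ᶻ μ c)
         (λ c N≤c → ⟦⟧-no-* (c ∣? n′ * p) (μ c) (ℕ.>⇒∤ (ℕ.<-≤-trans n<N N≤c)))) ⟩
  ∑ N coprimePart +ᶻ ∑ N (λ c → ⟦ p * c ∣? n′ * p ⟧ *ᶻ μ (p * c))
    ≡⟨ ∑-+ N _ _ ⟨
  ∑ N (λ c → coprimePart c +ᶻ ⟦ p * c ∣? n′ * p ⟧ *ᶻ μ (p * c))
    ≡⟨ ∑-zero N (λ c _ → cancel c) ⟩
  0ℤ
    ≡⟨ ⟦⟧-no (n′ * p ℕ.≟ 1) n≢1 ⟨
  ⟦ n′ * p ℕ.≟ 1 ⟧ ∎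
  where
  open ≡-Reasoning
  instance
    p≢0 = prime⇒nonZero p-prime
    n′≢0 : NonZero n′
    n′≢0 = ℕ.m*n≢0⇒m≢0 n′ {p}

  coprimePart : ℕ → ℤ
  coprimePart c with p ∣? c
  ... | yes _ = 0ℤ
  ... | no  _ = ⟦ c ∣? n′ ⟧ *ᶻ μ c

  split : ∀ c → ⟦ c ∣? n′ * p ⟧ *ᶻ μ c ≡ coprimePart c +ᶻ ⟦ p ∣? c ⟧ *ᶻ (⟦ c ∣? n′ * p ⟧ *ᶻ μ c)
  split c with p ∣? c
  ... | yes p∣c = sym (trans (ℤ.+-identityˡ _) (ℤ.*-identityˡ _))
  ... | no p∤c = trans (cong (_*ᶻ μ c) (⟦⟧-⇔ (c ∣? n′ * p) (c ∣? n′) coprime-divisor (ℕ.∣m⇒∣m*n p)))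
    (sym (trans (cong (⟦ c ∣? n′ ⟧ *ᶻ μ c +ᶻ_) (ℤ.*-zeroˡ (⟦ c ∣? n′ * p ⟧ *ᶻ μ c))) (ℤ.+-identityʳ _)))
    where
    coprime-divisor : c ∣ n′ * p → c ∣ n′
    coprime-divisor (divides k eq) with euclidsLemma k c p-prime (subst (p ∣_) eq (ℕ.n∣m*n n′))
    ... | inj₁ (divides j refl) = divides j (ℕ.*-cancelʳ-≡ n′ (j * c) p (begin
      n′ * p    ≡⟨ eq ⟩
      j * p * c ≡⟨ ℕ.*-assoc j p c ⟩
      j * (p * c) ≡⟨ cong (j *_) (ℕ.*-comm p c) ⟩
      j * (c * p) ≡⟨ ℕ.*-assoc j c p ⟨
      j * c * p ∎))
    ... | inj₂ p∣c = contradiction p∣c p∤c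

  cancel : ∀ c → coprimePart c +ᶻ ⟦ p * c ∣? n′ * p ⟧ *ᶻ μ (p * c) ≡ 0ℤ
  -- The range includes 0, which counts as a multiple of `p`; its term is killed by `μ 0 = 0`.
  cancel zero with p ∣? 0
  ... | yes _ = trans (ℤ.+-identityˡ _) (trans (cong (λ x → ⟦ p * 0 ∣? n′ * p ⟧ *ᶻ μ x) (ℕ.*-zeroʳ p)) (ℤ.*-zeroʳ ⟦ p * 0 ∣? n′ * p ⟧))
  ... | no p∤0 = contradiction (p ℕ.∣0) p∤0
  cancel c@(suc _) with p ∣? c
  ... | yes p∣c = trans (ℤ.+-identityˡ _)
    (trans (cong (⟦ p * c ∣? n′ * p ⟧ *ᶻ_) (μ-prime-∣ p-prime p∣c)) (ℤ.*-zeroʳ ⟦ p * c ∣? n′ * p ⟧))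
  ... | no p∤c = trans (cong (⟦ c ∣? n′ ⟧ *ᶻ μ c +ᶻ_)
      (cong₂ _*ᶻ_ (⟦⟧-⇔ (p * c ∣? n′ * p) (c ∣? n′)
                     (λ d → ℕ.*-cancelˡ-∣ p (subst (p * c ∣_) (ℕ.*-comm n′ p) d))
                     (λ d → subst (p * c ∣_) (ℕ.*-comm p n′) (ℕ.*-monoʳ-∣ p d)))
                  (μ-prime-∤ p-prime p∤c)))
      (cancels ⟦ c ∣? n′ ⟧ (μ c))
    where
    cancels : ∀ x y → x *ᶻ y +ᶻ x *ᶻ -ᶻ y ≡ 0ℤ
    cancels x y = trans (cong (x *ᶻ y +ᶻ_) (sym (ℤ.neg-distribʳ-* x y))) (ℤ.+-inverseʳ (x *ᶻ y))

-- The Möbius transform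

-- The index is `d - 1`, as in `möbiusDual`: the two then match term by term, and `n / suc i` is
-- defined without further proof.
möbiusSum : (ℕ → ℤ) → ℕ → ℤ
möbiusSum f n = ∑ n (λ i → ⟦ suc i ∣? n ⟧ *ᶻ (μ (n / suc i) *ᶻ f (suc i)))

möbiusSum-cong : ∀ n {f g : ℕ → ℤ} → (∀ d → 1 ≤ d → d ≤ n → f d ≡ g d) → möbiusSum f n ≡ möbiusSum g n
möbiusSum-cong n f≗g =
  ∑-cong n (λ i i<n → cong (λ x → ⟦ suc i ∣? n ⟧ *ᶻ (μ (n / suc i) *ᶻ x)) (f≗g (suc i) (s≤s z≤n) i<n))

möbiusSum-+ : ∀ n (f g : ℕ → ℤ) → möbiusSum (λ d → f d +ᶻ g d) n ≡ möbiusSum f n +ᶻ möbiusSum g n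
möbiusSum-+ n f g = trans
  (∑-cong n (λ i _ → distrib ⟦ suc i ∣? n ⟧ (μ (n / suc i)) (f (suc i)) (g (suc i))))
  (∑-+ n _ _)
  where
  distrib : ∀ a b x y → a *ᶻ (b *ᶻ (x +ᶻ y)) ≡ a *ᶻ (b *ᶻ x) +ᶻ a *ᶻ (b *ᶻ y)
  distrib = solve-∀

möbiusSum-*ˡ : ∀ n c (f : ℕ → ℤ) → möbiusSum (λ d → c *ᶻ f d) n ≡ c *ᶻ möbiusSum f n
möbiusSum-*ˡ n c f = trans
  (∑-cong n (λ i _ → commute ⟦ suc i ∣? n ⟧ (μ (n / suc i)) c (f (suc i))))
  (∑-*ˡ n c _)
  where
  commute : ∀ a b c x → a *ᶻ (b *ᶻ (c *ᶻ x)) ≡ c *ᶻ (a *ᶻ (b *ᶻ x))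
  commute = solve-∀

möbiusSum-zero : ∀ n → möbiusSum (λ _ → 0ℤ) n ≡ 0ℤ
möbiusSum-zero n = ∑-zero n (λ i _ →
  trans (cong (⟦ suc i ∣? n ⟧ *ᶻ_) (ℤ.*-zeroʳ (μ (n / suc i)))) (ℤ.*-zeroʳ ⟦ suc i ∣? n ⟧))

möbiusSum-∑ : ∀ K n (h : ℕ → ℕ → ℤ) → möbiusSum (λ d → ∑ K (λ k → h k d)) n ≡ ∑ K (λ k → möbiusSum (h k) n)
möbiusSum-∑ zero    n h = möbiusSum-zero n
möbiusSum-∑ (suc K) n h = trans (möbiusSum-+ n (h 0) (λ d → ∑ K (λ k → h (suc k) d)))
  (cong (möbiusSum (h 0) n +ᶻ_) (möbiusSum-∑ K n (h ∘ suc)))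

-- Over pairs with `c * d = n` no division is left and both variables range freely, so the order of
-- summation can be exchanged.
möbiusSum-convolution : ∀ n .{{_ : NonZero n}} (f : ℕ → ℤ) →
  möbiusSum f n ≡ ∑ (suc n) (λ d → ∑ (suc n) (λ c → ⟦ c * d ℕ.≟ n ⟧ *ᶻ (μ c *ᶻ f d)))
möbiusSum-convolution n f = sym (trans
  (cong₂ _+ᶻ_ (∑-zero (suc n) (λ c _ → ⟦⟧-no-* (c * 0 ℕ.≟ n) (μ c *ᶻ f 0) (c*0≢n c))) (∑-cong n (λ i _ → inner i)))
  (ℤ.+-identityˡ _))
  where
  c*0≢n : ∀ c → c * 0 ≢ n
  c*0≢n c eq = ≢-nonZero⁻¹ n (trans (sym eq) (ℕ.*-zeroʳ c))

  inner : ∀ i → ∑ (suc n) (λ c → ⟦ c * suc i ℕ.≟ n ⟧ *ᶻ (μ c *ᶻ f (suc i)))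
              ≡ ⟦ suc i ∣? n ⟧ *ᶻ (μ (n / suc i) *ᶻ f (suc i))
  inner i = case suc i ∣? n of λ where
    (no d∤n) → trans
      (∑-zero (suc n) (λ c _ → ⟦⟧-no-* (c * suc i ℕ.≟ n) (μ c *ᶻ f (suc i)) (λ eq → d∤n (divides c (sym eq)))))
      (sym (⟦⟧-no-* (suc i ∣? n) (μ (n / suc i) *ᶻ f (suc i)) d∤n))
    (yes d∣n@(divides q n≡q*d)) → trans
      (∑-single (suc n) q (s≤s (ℕ.≤-trans (ℕ.m≤m*n q (suc i)) (ℕ.≤-reflexive (sym n≡q*d))))
        (λ c _ c≢q → ⟦⟧-no-* (c * suc i ℕ.≟ n) (μ c *ᶻ f (suc i))
          (λ eq → c≢q (ℕ.*-cancelʳ-≡ c q (suc i) (trans eq n≡q*d)))))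
      (trans (⟦⟧-yes-* (q * suc i ℕ.≟ n) (μ q *ᶻ f (suc i)) (sym n≡q*d))
        (trans (cong (λ x → μ x *ᶻ f (suc i)) (sym (trans (cong (_/ suc i) n≡q*d) (m*n/n≡m q (suc i)))))
          (sym (⟦⟧-yes-* (suc i ∣? n) (μ (n / suc i) *ᶻ f (suc i)) d∣n))))

-- Möbius inversion: `⟦ m ∣? d ⟧` is the divisor sum of the indicator of `m`. If `m ∤ n`, no divisor
-- of `n` is a multiple of `m`. If `n = k * m`, the substitution `d = m * e` turns the condition
-- `c * d = n` into `c * e = k`, and what remains is the sum of `μ` over the divisors of `k`.
möbiusSum-∣ : ∀ m n .{{_ : NonZero m}} .{{_ : NonZero n}} → möbiusSum (λ d → ⟦ m ∣? d ⟧) n ≡ ⟦ n ℕ.≟ m ⟧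
möbiusSum-∣ m n with m ∣? n
... | no m∤n = trans (∑-zero n vanish) (sym (⟦⟧-no (n ℕ.≟ m) (λ { refl → m∤n ℕ.∣-refl })))
  where
  vanish : ∀ i → i < n → ⟦ suc i ∣? n ⟧ *ᶻ (μ (n / suc i) *ᶻ ⟦ m ∣? suc i ⟧) ≡ 0ℤ
  vanish i _ with m ∣? suc i
  ... | yes m∣d = ⟦⟧-no-* (suc i ∣? n) _ (m∤n ∘ ℕ.∣-trans m∣d)
  ... | no _ = trans (cong (⟦ suc i ∣? n ⟧ *ᶻ_) (ℤ.*-zeroʳ (μ (n / suc i)))) (ℤ.*-zeroʳ ⟦ suc i ∣? n ⟧)
... | yes (divides k refl) = begin
  möbiusSum (λ d → ⟦ m ∣? d ⟧) n
    ≡⟨ möbiusSum-convolution n (λ d → ⟦ m ∣? d ⟧) ⟩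
  ∑ N (λ d → ∑ N (λ c → ⟦ c * d ℕ.≟ n ⟧ *ᶻ (μ c *ᶻ ⟦ m ∣? d ⟧)))
    ≡⟨ ∑-cong N (λ d _ → trans (∑-cong N (λ c _ → commute ⟦ c * d ℕ.≟ n ⟧ (μ c) ⟦ m ∣? d ⟧)) (∑-*ˡ N ⟦ m ∣? d ⟧ (λ c → ⟦ c * d ℕ.≟ n ⟧ *ᶻ μ c))) ⟩
  ∑ N (λ d → ⟦ m ∣? d ⟧ *ᶻ h d)
    ≡⟨ ∑-multiples N m h (λ d n<d → ∑-zero N (λ c _ → ⟦⟧-no-* (c * d ℕ.≟ n) (μ c)
         (λ eq → ℕ.>⇒∤ n<d (divides c (sym eq))))) ⟩
  ∑ N (λ e → ∑ N (λ c → ⟦ c * (m * e) ℕ.≟ n ⟧ *ᶻ μ c))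
    ≡⟨ ∑-swap N N (λ e c → ⟦ c * (m * e) ℕ.≟ n ⟧ *ᶻ μ c) ⟩
  ∑ N (λ c → ∑ N (λ e → ⟦ c * (m * e) ℕ.≟ n ⟧ *ᶻ μ c))
    ≡⟨ ∑-cong N (λ c _ → inner c) ⟩
  ∑ N (λ c → ⟦ c ∣? k ⟧ *ᶻ μ c)
    ≡⟨ ∑-μ N k (s≤s (ℕ.m≤m*n k m)) ⟩
  ⟦ k ℕ.≟ 1 ⟧
    ≡⟨ ⟦⟧-⇔ (k ℕ.≟ 1) (n ℕ.≟ m) (λ { refl → ℕ.*-identityˡ m })
         (λ eq → ℕ.*-cancelʳ-≡ k 1 m (trans eq (sym (ℕ.*-identityˡ m)))) ⟩
  ⟦ n ℕ.≟ m ⟧ ∎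
  where
  open ≡-Reasoning
  N = suc n
  instance
    k≢0 : NonZero k
    k≢0 = ℕ.m*n≢0⇒m≢0 k {m}
  h : ℕ → ℤ
  h d = ∑ N (λ c → ⟦ c * d ℕ.≟ n ⟧ *ᶻ μ c)

  commute : ∀ a b c → a *ᶻ (b *ᶻ c) ≡ c *ᶻ (a *ᶻ b)
  commute = solve-∀

  rearrange : ∀ c e → c * (m * e) ≡ e * c * m
  rearrange c e = trans (cong (c *_) (ℕ.*-comm m e)) (trans (sym (ℕ.*-assoc c e m)) (cong (_* m) (ℕ.*-comm c e)))

  inner : ∀ c → ∑ N (λ e → ⟦ c * (m * e) ℕ.≟ n ⟧ *ᶻ μ c) ≡ ⟦ c ∣? k ⟧ *ᶻ μ c
  inner c with c ∣? k
  ... | no c∤k = ∑-zero N (λ e _ → ⟦⟧-no-* (c * (m * e) ℕ.≟ n) (μ c)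
    (λ eq → c∤k (divides e (ℕ.*-cancelʳ-≡ k (e * c) m (trans (sym eq) (rearrange c e))))))
  ... | yes (divides e k≡e*c) = trans
    (∑-single N e e<N (λ e′ _ e′≢e → ⟦⟧-no-* (c * (m * e′) ℕ.≟ n) (μ c)
      (λ eq → e′≢e (ℕ.*-cancelʳ-≡ e′ e c {{c≢0}} (trans (ℕ.*-cancelʳ-≡ (e′ * c) k m (trans (sym (rearrange c e′)) eq)) k≡e*c)))))
    (trans (⟦⟧-yes-* (c * (m * e) ℕ.≟ n) (μ c) (trans (rearrange c e) (cong (_* m) (sym k≡e*c)))) (sym (ℤ.*-identityˡ _)))
    where
    c≢0 : NonZero c
    c≢0 = ℕ.m*n≢0⇒n≢0 e {{subst NonZero k≡e*c k≢0}}
    e<N : e < N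
    e<N = s≤s (ℕ.≤-trans (ℕ.m≤m*n e c {{c≢0}}) (ℕ.≤-trans (ℕ.≤-reflexive (sym k≡e*c)) (ℕ.m≤m*n k m)))

-- Transforms of `d` and of `⌊(d - 1) / 2⌋`

∑-split : ∀ m n (f : ℕ → ℤ) → ∑ (m + n) f ≡ ∑ m f +ᶻ ∑ n (λ i → f (m + i))
∑-split zero    n f = sym (ℤ.+-identityˡ _)
∑-split (suc m) n f = trans (cong (f 0 +ᶻ_) (∑-split m n (f ∘ suc))) (sym (ℤ.+-assoc (f 0) _ _))

-- Cut into blocks of `c` consecutive integers, the range has one multiple of `c` per block, namely
-- the last member.
∑-∣-suc : ∀ c d .{{_ : NonZero c}} → ∑ (d * c) (λ j → ⟦ c ∣? suc j ⟧) ≡ + d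
∑-∣-suc c zero = refl
∑-∣-suc c@(suc c-1) (suc d) = trans (∑-split c (d * c) (λ j → ⟦ c ∣? suc j ⟧)) (cong₂ _+ᶻ_
  (trans (∑-single c c-1 ℕ.≤-refl (λ j j<c j≢c-1 → ⟦⟧-no (c ∣? suc j)
      (ℕ.>⇒∤ (ℕ.≤∧≢⇒< j<c (j≢c-1 ∘ ℕ.suc-injective)))))
    (⟦⟧-yes (c ∣? c) ℕ.∣-refl))
  (trans (∑-cong (d * c) (λ j _ → ⟦⟧-⇔ (c ∣? suc (c + j)) (c ∣? suc j)
      (λ c∣ → ℕ.∣m+n∣m⇒∣n (subst (c ∣_) (sym (ℕ.+-suc c j)) c∣) ℕ.∣-refl)
      (λ c∣ → subst (c ∣_) (ℕ.+-suc c j) (ℕ.∣m∣n⇒∣m+n ℕ.∣-refl c∣))))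
    (∑-∣-suc c d)))

length-filter-applyUpTo : ∀ {P : ℕ → Set} (P? : ∀ x → Dec (P x)) (g : ℕ → ℕ) n →
  + length (filter P? (applyUpTo g n)) ≡ ∑ n (λ i → ⟦ P? (g i) ⟧)
length-filter-applyUpTo P? g zero = refl
length-filter-applyUpTo P? g (suc n) with P? (g 0)
... | yes _ = cong (1ℤ +ᶻ_) (length-filter-applyUpTo P? (g ∘ suc) n)
... | no  _ = trans (length-filter-applyUpTo P? (g ∘ suc) n) (sym (ℤ.+-identityˡ _))

-- The cofactor `n / c` counts the multiples of `c` in `1, …, n`. After an exchange of summation
-- each `j` in that range receives the sum of `μ` over the common divisors of `n` and `j`, which is
-- 1 or 0 according to coprimality; this is the count that defines `φ`.
möbiusSum-id : ∀ n .{{_ : NonZero n}} → möbiusSum (λ d → + d) n ≡ + φ n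
möbiusSum-id n = begin
  möbiusSum (λ d → + d) n
    ≡⟨ möbiusSum-convolution n (λ d → + d) ⟩
  ∑ N (λ d → ∑ N (λ c → ⟦ c * d ℕ.≟ n ⟧ *ᶻ (μ c *ᶻ + d)))
    ≡⟨ ∑-swap N N (λ d c → ⟦ c * d ℕ.≟ n ⟧ *ᶻ (μ c *ᶻ + d)) ⟩
  ∑ N (λ c → ∑ N (λ d → ⟦ c * d ℕ.≟ n ⟧ *ᶻ (μ c *ᶻ + d)))
    ≡⟨ ∑-cong N (λ c _ → inner c) ⟩
  ∑ N (λ c → ∑ n (λ j → ⟦ c ∣? n ⟧ *ᶻ μ c *ᶻ ⟦ c ∣? suc j ⟧))
    ≡⟨ ∑-swap N n (λ c j → ⟦ c ∣? n ⟧ *ᶻ μ c *ᶻ ⟦ c ∣? suc j ⟧) ⟩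
  ∑ n (λ j → ∑ N (λ c → ⟦ c ∣? n ⟧ *ᶻ μ c *ᶻ ⟦ c ∣? suc j ⟧))
    ≡⟨ ∑-cong n (λ j _ → coprimality j) ⟩
  ∑ n (λ j → ⟦ coprime? n (suc j) ⟧)
    ≡⟨ length-filter-applyUpTo (coprime? n) suc n ⟨
  + length (filter (coprime? n) (applyUpTo suc n))
    ≡⟨ cong (λ js → + length (filter (coprime? n) js)) (map-upTo suc n) ⟨
  + φ n ∎
  where
  open ≡-Reasoning
  N = suc n

  inner : ∀ c → ∑ N (λ d → ⟦ c * d ℕ.≟ n ⟧ *ᶻ (μ c *ᶻ + d)) ≡ ∑ n (λ j → ⟦ c ∣? n ⟧ *ᶻ μ c *ᶻ ⟦ c ∣? suc j ⟧)
  inner c with c ∣? n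
  ... | no c∤n = trans
    (∑-zero N (λ d _ → ⟦⟧-no-* (c * d ℕ.≟ n) (μ c *ᶻ + d) (λ eq → c∤n (divides d (trans (sym eq) (ℕ.*-comm c d))))))
    (sym (∑-zero n (λ j _ → trans (cong (_*ᶻ ⟦ c ∣? suc j ⟧) (ℤ.*-zeroˡ (μ c))) (ℤ.*-zeroˡ ⟦ c ∣? suc j ⟧))))
  ... | yes (divides q n≡q*c) = begin
    ∑ N (λ d → ⟦ c * d ℕ.≟ n ⟧ *ᶻ (μ c *ᶻ + d))
      ≡⟨ ∑-single N q q<N (λ d _ d≢q → ⟦⟧-no-* (c * d ℕ.≟ n) (μ c *ᶻ + d)
           (λ eq → d≢q (ℕ.*-cancelˡ-≡ d q c (trans eq n≡c*q)))) ⟩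
    ⟦ c * q ℕ.≟ n ⟧ *ᶻ (μ c *ᶻ + q)
      ≡⟨ ⟦⟧-yes-* (c * q ℕ.≟ n) (μ c *ᶻ + q) (sym n≡c*q) ⟩
    μ c *ᶻ + q
      ≡⟨ cong (μ c *ᶻ_) (trans (cong (λ x → ∑ x (λ j → ⟦ c ∣? suc j ⟧)) n≡q*c) (∑-∣-suc c q)) ⟨
    μ c *ᶻ ∑ n (λ j → ⟦ c ∣? suc j ⟧)
      ≡⟨ ∑-*ˡ n (μ c) (λ j → ⟦ c ∣? suc j ⟧) ⟨
    ∑ n (λ j → μ c *ᶻ ⟦ c ∣? suc j ⟧)
      ≡⟨ ∑-cong n (λ j _ → cong (_*ᶻ ⟦ c ∣? suc j ⟧) (sym (ℤ.*-identityˡ (μ c)))) ⟩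
    ∑ n (λ j → 1ℤ *ᶻ μ c *ᶻ ⟦ c ∣? suc j ⟧) ∎
    where
    instance
      c≢0 : NonZero c
      c≢0 = ℕ.m*n≢0⇒n≢0 q {{≢-nonZero (λ eq → ≢-nonZero⁻¹ n (trans n≡q*c eq))}}
    n≡c*q : n ≡ c * q
    n≡c*q = trans n≡q*c (ℕ.*-comm q c)
    q<N : q < N
    q<N = s≤s (ℕ.≤-trans (ℕ.m≤m*n q c) (ℕ.≤-reflexive (sym n≡q*c)))

  coprimality : ∀ j → ∑ N (λ c → ⟦ c ∣? n ⟧ *ᶻ μ c *ᶻ ⟦ c ∣? suc j ⟧) ≡ ⟦ coprime? n (suc j) ⟧
  coprimality j = begin
    ∑ N (λ c → ⟦ c ∣? n ⟧ *ᶻ μ c *ᶻ ⟦ c ∣? suc j ⟧)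
      ≡⟨ ∑-cong N (λ c _ → ∣-gcd c) ⟩
    ∑ N (λ c → ⟦ c ∣? gcd n (suc j) ⟧ *ᶻ μ c)
      ≡⟨ ∑-μ N (gcd n (suc j)) (s≤s (ℕ.∣⇒≤ (gcd[m,n]∣m n (suc j)))) ⟩
    ⟦ gcd n (suc j) ℕ.≟ 1 ⟧
      ≡⟨ ⟦⟧-⇔ (gcd n (suc j) ℕ.≟ 1) (coprime? n (suc j)) gcd≡1⇒coprime coprime⇒gcd≡1 ⟩
    ⟦ coprime? n (suc j) ⟧ ∎
    where
    instance
      g≢0 : NonZero (gcd n (suc j))
      g≢0 = ≢-nonZero (gcd[m,n]≢0 n (suc j) (inj₂ (λ ())))
    ∣-gcd : ∀ c → ⟦ c ∣? n ⟧ *ᶻ μ c *ᶻ ⟦ c ∣? suc j ⟧ ≡ ⟦ c ∣? gcd n (suc j) ⟧ *ᶻ μ c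
    ∣-gcd c with c ∣? n | c ∣? suc j
    ... | yes c∣n | yes c∣j = trans (ℤ.*-identityʳ _)
      (cong (_*ᶻ μ c) (sym (⟦⟧-yes (c ∣? gcd n (suc j)) (gcd-greatest c∣n c∣j))))
    ... | yes _ | no c∤j = trans (ℤ.*-zeroʳ (1ℤ *ᶻ μ c))
      (sym (⟦⟧-no-* (c ∣? gcd n (suc j)) (μ c) (λ d → c∤j (ℕ.∣-trans d (gcd[m,n]∣n n (suc j))))))
    ... | no c∤n | c∣?j = trans (cong (_*ᶻ ⟦ c∣?j ⟧) (ℤ.*-zeroˡ (μ c))) (trans (ℤ.*-zeroˡ ⟦ c∣?j ⟧)
      (sym (⟦⟧-no-* (c ∣? gcd n (suc j)) (μ c) (λ d → c∤n (ℕ.∣-trans d (gcd[m,n]∣m n (suc j)))))))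

möbiusSum-one : ∀ n .{{_ : NonZero n}} → möbiusSum (λ _ → 1ℤ) n ≡ ⟦ n ℕ.≟ 1 ⟧
möbiusSum-one n = trans (möbiusSum-cong n (λ d _ _ → sym (⟦⟧-yes (1 ∣? d) (ℕ.1∣ d)))) (möbiusSum-∣ 1 n)

[2x+r]/2≡x : ∀ x r → r ≤ 1 → (2 * x + r) / 2 ≡ x
[2x+r]/2≡x x r r≤1 = begin
  (2 * x + r) / 2     ≡⟨ cong (_/ 2) (trans (ℕ.+-comm (2 * x) r) (cong (λ y → r + y) (ℕ.*-comm 2 x))) ⟩
  (r + x * 2) / 2     ≡⟨ +-distrib-/-∣ʳ r (divides x refl) ⟩
  r / 2 + (x * 2) / 2 ≡⟨ cong₂ _+_ (m<n⇒m/n≡0 (s≤s r≤1)) (m*n/n≡m x 2) ⟩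
  x                   ∎
  where open ≡-Reasoning

-- The `s` in question is a Möbius sum, an integer not known beforehand to be nonnegative. For
-- negative `s` the left side is at most `-1`.
/2-unique : ∀ s r m → r ≤ 1 → + 2 *ᶻ s +ᶻ + r ≡ + m → s ≡ + (m / 2)
/2-unique (+ x) r m r≤1 eq = cong +_ (trans (sym ([2x+r]/2≡x x r r≤1)) (cong (_/ 2) (ℤ.+-injective
  (trans (cong (_+ᶻ + r) (ℤ.pos-* 2 x)) eq))))
/2-unique -[1+ x ] zero m r≤1 ()
/2-unique -[1+ x ] (suc zero) m r≤1 eq rewrite ℕ.+-suc x (x + 0) = case eq of λ ()
/2-unique -[1+ x ] (suc (suc r)) m (s≤s ()) eq

⌊[d∸1]/2⌋ : ∀ d → 1 ≤ d → + 2 *ᶻ + ((d ∸ 1) / 2) +ᶻ (1ℤ +ᶻ ⟦ 2 ∣? d ⟧) ≡ + d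
⌊[d∸1]/2⌋ d@(suc e) 1≤d = parity (e % 2) (m%n<n e 2) (m≡m%n+[m/n]*n e 2)
  where
  open ≡-Reasoning
  parity : ∀ r → r < 2 → e ≡ r + e / 2 * 2 → + 2 *ᶻ + (e / 2) +ᶻ (1ℤ +ᶻ ⟦ 2 ∣? d ⟧) ≡ + d
  parity 0 _ eq = begin
    + 2 *ᶻ + (e / 2) +ᶻ (1ℤ +ᶻ ⟦ 2 ∣? d ⟧) ≡⟨ cong (λ x → + 2 *ᶻ + (e / 2) +ᶻ (1ℤ +ᶻ x)) (⟦⟧-no (2 ∣? d)
      (λ 2∣d → case ℕ.∣1⇒≡1 (ℕ.∣m+n∣m⇒∣n (subst (2 ∣_) (trans (cong suc eq) (ℕ.+-comm 1 (e / 2 * 2))) 2∣d) (divides (e / 2) refl)) of λ ())) ⟩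
    + 2 *ᶻ + (e / 2) +ᶻ 1ℤ ≡⟨ cong (_+ᶻ 1ℤ) (trans (ℤ.*-comm (+ 2) (+ (e / 2))) (sym (ℤ.pos-* (e / 2) 2))) ⟩
    + (e / 2 * 2 + 1) ≡⟨ cong +_ (trans (ℕ.+-comm (e / 2 * 2) 1) (cong suc (sym eq))) ⟩
    + d ∎
  parity 1 _ eq = begin
    + 2 *ᶻ + (e / 2) +ᶻ (1ℤ +ᶻ ⟦ 2 ∣? d ⟧) ≡⟨ cong (λ x → + 2 *ᶻ + (e / 2) +ᶻ (1ℤ +ᶻ x)) (⟦⟧-yes (2 ∣? d)
      (divides (suc (e / 2)) (cong suc eq))) ⟩
    + 2 *ᶻ + (e / 2) +ᶻ + 2 ≡⟨ cong (_+ᶻ + 2) (trans (ℤ.*-comm (+ 2) (+ (e / 2))) (sym (ℤ.pos-* (e / 2) 2))) ⟩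
    + (e / 2 * 2 + 2) ≡⟨ cong +_ (trans (ℕ.+-comm (e / 2 * 2) 2) (cong suc (sym eq))) ⟩
    + d ∎
  parity (suc (suc _)) (s≤s (s≤s ()))

⟦⟧-exclusive : ∀ {A B : Set} (a? : Dec A) (b? : Dec B) → (A → ¬ B) → ∃[ r ] (r ≤ 1 × ⟦ a? ⟧ +ᶻ ⟦ b? ⟧ ≡ + r)
⟦⟧-exclusive (yes a) (yes b) ¬ab = contradiction b (¬ab a)
⟦⟧-exclusive (yes a) (no _)  ¬ab = 1 , s≤s z≤n , refl
⟦⟧-exclusive (no _)  (yes b) ¬ab = 1 , s≤s z≤n , refl
⟦⟧-exclusive (no _)  (no _)  ¬ab = 0 , z≤n , refl

-- As 2⌊(d-1)/2⌋ = d - 1 - [2 ∣ d], twice the sum is φ(n) - [n = 1] - [n = 2], so that no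
-- separate argument is needed for the parity of φ(n).
möbiusSum-⌊[d∸1]/2⌋ : ∀ n .{{_ : NonZero n}} → möbiusSum (λ d → + ((d ∸ 1) / 2)) n ≡ + (φ n / 2)
möbiusSum-⌊[d∸1]/2⌋ n = /2-unique s (proj₁ r) (φ n) (proj₁ (proj₂ r)) (begin
  + 2 *ᶻ s +ᶻ + proj₁ r
    ≡⟨ cong (+ 2 *ᶻ s +ᶻ_) (proj₂ (proj₂ r)) ⟨
  + 2 *ᶻ s +ᶻ (⟦ n ℕ.≟ 1 ⟧ +ᶻ ⟦ n ℕ.≟ 2 ⟧)
    ≡⟨ cong₂ _+ᶻ_ (möbiusSum-*ˡ n (+ 2) h) (trans (möbiusSum-+ n (λ _ → 1ℤ) (λ d → ⟦ 2 ∣? d ⟧))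
         (cong₂ _+ᶻ_ (möbiusSum-one n) (möbiusSum-∣ 2 n))) ⟨
  möbiusSum (λ d → + 2 *ᶻ h d) n +ᶻ möbiusSum (λ d → 1ℤ +ᶻ ⟦ 2 ∣? d ⟧) n
    ≡⟨ möbiusSum-+ n (λ d → + 2 *ᶻ h d) (λ d → 1ℤ +ᶻ ⟦ 2 ∣? d ⟧) ⟨
  möbiusSum (λ d → + 2 *ᶻ h d +ᶻ (1ℤ +ᶻ ⟦ 2 ∣? d ⟧)) n
    ≡⟨ möbiusSum-cong n (λ d 1≤d _ → ⌊[d∸1]/2⌋ d 1≤d) ⟩
  möbiusSum (λ d → + d) n
    ≡⟨ möbiusSum-id n ⟩
  + φ n ∎)
  where
  open ≡-Reasoning
  h : ℕ → ℤ
  h d = + ((d ∸ 1) / 2)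
  s = möbiusSum h n
  r : ∃[ r ] (r ≤ 1 × ⟦ n ℕ.≟ 1 ⟧ +ᶻ ⟦ n ℕ.≟ 2 ⟧ ≡ + r)
  r = ⟦⟧-exclusive (n ℕ.≟ 1) (n ℕ.≟ 2) (λ { refl () })

-- Valuations

maxExponent-suc-∣ : ∀ p n c → p ^ suc c ∣ n → maxExponent p n (suc c) ≡ suc c
maxExponent-suc-∣ p n c d = cong (if_then suc c else maxExponent p n c) (dec-true (p ^ suc c ∣? n) d)

maxExponent-suc-∤ : ∀ p n c → ¬ p ^ suc c ∣ n → maxExponent p n (suc c) ≡ maxExponent p n c
maxExponent-suc-∤ p n c d = cong (if_then suc c else maxExponent p n c) (dec-false (p ^ suc c ∣? n) d)

module _ {p : ℕ} (p-prime : Prime p) where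

  private
    instance
      p≢0 : NonZero p
      p≢0 = prime⇒nonZero p-prime

  1<p : 1 < p
  1<p = nonTrivial⇒n>1 p {{prime⇒nonTrivial p-prime}}

  p∤1 : ¬ p ∣ 1
  p∤1 p∣1 = ℕ.<⇒≢ 1<p (sym (ℕ.∣1⇒≡1 p∣1))

  n<p^n : ∀ n → n < p ^ n
  n<p^n zero    = s≤s z≤n
  n<p^n (suc n) = begin-strict
    suc n           ≤⟨ n<p^n n ⟩
    p ^ n           <⟨ ℕ.^-monoʳ-< p 1<p (ℕ.n<1+n n) ⟩
    p * p ^ n       ∎
    where open ℕ.≤-Reasoning

  ∤⇒nonZero : ∀ {m} → ¬ p ∣ m → NonZero m
  ∤⇒nonZero {zero}  p∤0 = contradiction (p ℕ.∣0) p∤0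
  ∤⇒nonZero {suc m} _   = nonZero

  p^∣⇒≤ : ∀ b k m → ¬ p ∣ m → p ^ b ∣ p ^ k * m → b ≤ k
  p^∣⇒≤ zero    k       m p∤m _ = z≤n
  p^∣⇒≤ (suc b) zero    m p∤m d =
    contradiction (ℕ.∣-trans (ℕ.m∣m*n (p ^ b)) (subst (p ^ suc b ∣_) (ℕ.*-identityˡ m) d)) p∤m
  p^∣⇒≤ (suc b) (suc k) m p∤m d =
    s≤s (p^∣⇒≤ b k m p∤m (ℕ.*-cancelˡ-∣ p (subst (p ^ suc b ∣_) (ℕ.*-assoc p (p ^ k) m) d)))

  p^∣⇐≤ : ∀ {b k} m → b ≤ k → p ^ b ∣ p ^ k * m
  p^∣⇐≤ {b} {k} m b≤k = ℕ.∣m⇒∣m*n m (divides (p ^ (k ∸ b))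
    (trans (cong (p ^_) (sym (ℕ.m∸n+n≡m b≤k))) (ℕ.^-distribˡ-+-* p (k ∸ b) b)))

  -- The search stops at the largest exponent that divides, so every starting bound `b ≥ k` gives
  -- `k`. The bound built into `v` is the number itself, and `k < p ^ k` makes it large enough.
  v-p^k*m : ∀ k m → ¬ p ∣ m → v p (p ^ k * m) ≡ k
  v-p^k*m k m p∤m = bounded (p ^ k * m) (ℕ.<⇒≤ (ℕ.<-≤-trans (n<p^n k) (ℕ.m≤m*n (p ^ k) m {{∤⇒nonZero p∤m}})))
    where
    bounded : ∀ b → k ≤ b → maxExponent p (p ^ k * m) b ≡ k
    bounded zero    k≤0 = sym (ℕ.n≤0⇒n≡0 k≤0)
    bounded (suc c) k≤b = case p ^ suc c ∣? p ^ k * m of λ where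
      (yes d) → trans (maxExponent-suc-∣ p _ c d) (ℕ.≤-antisym (p^∣⇒≤ (suc c) k m p∤m d) k≤b)
      (no ∤)  → trans (maxExponent-suc-∤ p _ c ∤) (bounded c (ℕ.≤-pred (ℕ.≤∧≢⇒< k≤b
        (λ k≡b → ∤ (p^∣⇐≤ m (ℕ.≤-reflexive (sym k≡b)))))))

  p^k*m-exists : ∀ n → .{{_ : NonZero n}} → ∃[ k ] ∃[ m ] (n ≡ p ^ k * m × ¬ p ∣ m)
  p^k*m-exists n = <-rec (λ n → .{{NonZero n}} → ∃[ k ] ∃[ m ] (n ≡ p ^ k * m × ¬ p ∣ m)) step n
    where
    step : ∀ n → (∀ {n′} → n′ < n → .{{NonZero n′}} → ∃[ k ] ∃[ m ] (n′ ≡ p ^ k * m × ¬ p ∣ m)) →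
      .{{NonZero n}} → ∃[ k ] ∃[ m ] (n ≡ p ^ k * m × ¬ p ∣ m)
    step n rec with p ∣? n
    ... | no p∤n = 0 , n , sym (ℕ.*-identityˡ n) , p∤n
    ... | yes (divides q refl) with rec {q} (ℕ.m<m*n q p {{q≢0}} 1<p) {{q≢0}}
      where
      q≢0 : NonZero q
      q≢0 = ℕ.m*n≢0⇒m≢0 q {p}
    ... | k , m , q≡ , p∤m = suc k , m
      , trans (ℕ.*-comm q p) (trans (cong (p *_) q≡) (sym (ℕ.*-assoc p (p ^ k) m))) , p∤m

  v-spec : ∀ n → .{{_ : NonZero n}} → ∃[ m ] (n ≡ p ^ v p n * m × ¬ p ∣ m)
  v-spec n with p^k*m-exists n
  ... | k , m , refl , p∤m = m , cong (λ e → p ^ e * m) (sym (v-p^k*m k m p∤m)) , p∤m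

  v-∤ : ∀ {m} → ¬ p ∣ m → v p m ≡ 0
  v-∤ {m} p∤m = trans (cong (v p) (sym (ℕ.*-identityˡ m))) (v-p^k*m 0 m p∤m)

  v-* : ∀ m n → .{{_ : NonZero m}} → .{{_ : NonZero n}} → v p (m * n) ≡ v p m + v p n
  v-* m n with p^k*m-exists m | p^k*m-exists n
  ... | j , m′ , refl , p∤m′ | k , n′ , refl , p∤n′ = begin
    v p (p ^ j * m′ * (p ^ k * n′))   ≡⟨ cong (v p) (ℕ.[m*n]*[o*p]≡[m*o]*[n*p] (p ^ j) m′ (p ^ k) n′) ⟩
    v p (p ^ j * p ^ k * (m′ * n′))   ≡⟨ cong (λ x → v p (x * (m′ * n′))) (ℕ.^-distribˡ-+-* p j k) ⟨
    v p (p ^ (j + k) * (m′ * n′))     ≡⟨ v-p^k*m (j + k) (m′ * n′) ([ p∤m′ , p∤n′ ]′ ∘ euclidsLemma m′ n′ p-prime) ⟩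
    j + k                             ≡⟨ cong₂ _+_ (v-p^k*m j m′ p∤m′) (v-p^k*m k n′ p∤n′) ⟨
    v p (p ^ j * m′) + v p (p ^ k * n′) ∎
    where open ≡-Reasoning

  v-p : v p p ≡ 1
  v-p = trans (cong (v p) (sym (trans (ℕ.*-identityʳ _) (ℕ.*-identityʳ p)))) (v-p^k*m 1 1 p∤1)

  -- Turns a valuation into divisibility indicators, whose Möbius transforms are known. Truncation
  -- at `K ≥ m` loses nothing, as `p ^ k ∣ m` forces `k < p ^ k ≤ m`.
  ∑-p^∣ : ∀ K m → .{{_ : NonZero m}} → m ≤ K → ∑ K (λ k → ⟦ p ^ suc k ∣? m ⟧) ≡ + v p m
  ∑-p^∣ K m m≤K with p^k*m-exists m
  ... | k , m′ , refl , p∤m′ = begin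
    ∑ K (λ j → ⟦ p ^ suc j ∣? p ^ k * m′ ⟧)
      ≡⟨ ∑-cong K (λ j _ → ⟦⟧-⇔ (p ^ suc j ∣? p ^ k * m′) (suc j ℕ.≤? k) (p^∣⇒≤ (suc j) k m′ p∤m′) (p^∣⇐≤ m′)) ⟩
    ∑ K (λ j → ⟦ suc j ℕ.≤? k ⟧)
      ≡⟨ count K k (ℕ.≤-trans (ℕ.<⇒≤ (ℕ.<-≤-trans (n<p^n k) (ℕ.m≤m*n (p ^ k) m′ {{∤⇒nonZero p∤m′}}))) m≤K) ⟩
    + k
      ≡⟨ cong +_ (v-p^k*m k m′ p∤m′) ⟨
    + v p (p ^ k * m′) ∎
    where
    open ≡-Reasoning
    count : ∀ K k → k ≤ K → ∑ K (λ j → ⟦ suc j ℕ.≤? k ⟧) ≡ + k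
    count K       zero    _ = ∑-zero K (λ j _ → ⟦⟧-no (suc j ℕ.≤? 0) (λ ()))
    count (suc K) (suc k) (s≤s k≤K) = cong₂ _+ᶻ_ (⟦⟧-yes (1 ℕ.≤? suc k) (s≤s z≤n))
      (trans (∑-cong K (λ j _ → ⟦⟧-⇔ (suc (suc j) ℕ.≤? suc k) (suc j ℕ.≤? k) ℕ.≤-pred s≤s)) (count K k k≤K))

  -- Valuations on ℤ and ℚ, and of the Möbius dual

  ∣∣-nonZero : ∀ {i} → i ≢ 0ℤ → NonZero ∣ i ∣
  ∣∣-nonZero i≢0 = ≢-nonZero (i≢0 ∘ ℤ.∣i∣≡0⇒i≡0)

  vℤ-* : ∀ {i j} → i ≢ 0ℤ → j ≢ 0ℤ → vℤ p (i *ᶻ j) ≡ vℤ p i + vℤ p j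
  vℤ-* {i} {j} i≢0 j≢0 = trans (cong (v p) (ℤ.abs-* i j))
    (v-* ∣ i ∣ ∣ j ∣ {{∣∣-nonZero i≢0}} {{∣∣-nonZero j≢0}})

  *-≢0 : ∀ {i j} → i ≢ 0ℤ → j ≢ 0ℤ → i *ᶻ j ≢ 0ℤ
  *-≢0 {i} {j} i≢0 j≢0 ij≡0 = [ i≢0 , j≢0 ]′ (ℤ.i*j≡0⇒i≡0∨j≡0 i ij≡0)

  -- A product in ℚ is reduced to lowest terms and is specified through the cancelled factor `g`.
  -- That factor contributes equally to numerator and denominator, so the valuation can be computed
  -- from the unreduced fraction.
  vℚ-/ : ∀ (q : ℚ) i j g → ↥ q *ᶻ g ≡ i → ↧ q *ᶻ g ≡ j → i ≢ 0ℤ → j ≢ 0ℤ → vℚ p q ≡ + vℤ p i -ᶻ + vℤ p j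
  vℚ-/ q@record{} i j g refl refl i≢0 j≢0 = begin
    + vℤ p (↥ q) -ᶻ + vℤ p (↧ q)
      ≡⟨ shift (+ vℤ p (↥ q)) (+ vℤ p (↧ q)) (+ vℤ p g) ⟩
    + (vℤ p (↥ q) + vℤ p g) -ᶻ + (vℤ p (↧ q) + vℤ p g)
      ≡⟨ cong₂ (λ x y → + x -ᶻ + y) (vℤ-* {↥ q} {g} ↥≢0 g≢0) (vℤ-* {↧ q} {g} (λ ()) g≢0) ⟨
    + vℤ p (↥ q *ᶻ g) -ᶻ + vℤ p (↧ q *ᶻ g) ∎
    where
    open ≡-Reasoning
    ↥≢0 : ↥ q ≢ 0ℤ
    ↥≢0 eq = i≢0 (cong (_*ᶻ g) eq)
    g≢0 : g ≢ 0ℤ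
    g≢0 eq = j≢0 (trans (cong (↧ q *ᶻ_) eq) (ℤ.*-zeroʳ (↧ q)))
    shift : ∀ a b c → a -ᶻ b ≡ (a +ᶻ c) -ᶻ (b +ᶻ c)
    shift = solve-∀

  *-≢0⁻¹ : ∀ i j {k} → i *ᶻ j ≡ k → k ≢ 0ℤ → i ≢ 0ℤ
  *-≢0⁻¹ i j eq k≢0 refl = k≢0 (trans (sym eq) (ℤ.*-zeroˡ j))

  ↥-*-≢0 : ∀ q r → ↥ q ≢ 0ℤ → ↥ r ≢ 0ℤ → ↥ (q ℚ.* r) ≢ 0ℤ
  ↥-*-≢0 q r q≢0 r≢0 = *-≢0⁻¹ _ _ (ℚ.↥-* q r) (*-≢0 q≢0 r≢0)

  vℚ-* : ∀ q r → ↥ q ≢ 0ℤ → ↥ r ≢ 0ℤ → vℚ p (q ℚ.* r) ≡ vℚ p q +ᶻ vℚ p r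
  vℚ-* q@record{} r@record{} q≢0 r≢0 = begin
    vℚ p (q ℚ.* r)
      ≡⟨ vℚ-/ (q ℚ.* r) _ _ _ (ℚ.↥-* q r) (ℚ.↧-* q r) (*-≢0 q≢0 r≢0) (*-≢0 {↧ q} {↧ r} (λ ()) (λ ())) ⟩
    + vℤ p (↥ q *ᶻ ↥ r) -ᶻ + vℤ p (↧ q *ᶻ ↧ r)
      ≡⟨ cong₂ (λ x y → + x -ᶻ + y) (vℤ-* q≢0 r≢0) (vℤ-* {↧ q} {↧ r} (λ ()) (λ ())) ⟩
    + (vℤ p (↥ q) + vℤ p (↥ r)) -ᶻ + (vℤ p (↧ q) + vℤ p (↧ r))
      ≡⟨ rearrange (+ vℤ p (↥ q)) (+ vℤ p (↥ r)) (+ vℤ p (↧ q)) (+ vℤ p (↧ r)) ⟩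
    vℚ p q +ᶻ vℚ p r ∎
    where
    open ≡-Reasoning
    rearrange : ∀ a b c d → (a +ᶻ b) -ᶻ (c +ᶻ d) ≡ (a -ᶻ c) +ᶻ (b -ᶻ d)
    rearrange = solve-∀

  /1≡mkℚ : ∀ i → i ℚ./ 1 ≡ mkℚ i 0 (coprime-sym (1-coprimeTo ∣ i ∣))
  /1≡mkℚ i = ℚ.↥p/↧p≡p (mkℚ i 0 (coprime-sym (1-coprimeTo ∣ i ∣)))

  ↥-/1-≢0 : ∀ {i} → i ≢ 0ℤ → ↥ (i ℚ./ 1) ≢ 0ℤ
  ↥-/1-≢0 {i} i≢0 eq = i≢0 (trans (cong ↥_ (sym (/1≡mkℚ i))) eq)

  vℚ-/1 : ∀ i → vℚ p (i ℚ./ 1) ≡ + vℤ p i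
  vℚ-/1 i = begin
    vℚ p (i ℚ./ 1)            ≡⟨ cong (vℚ p) (/1≡mkℚ i) ⟩
    + vℤ p i -ᶻ + v p 1       ≡⟨ cong (λ x → + vℤ p i -ᶻ + x) (v-∤ p∤1) ⟩
    + vℤ p i -ᶻ 0ℤ            ≡⟨ ℤ.+-identityʳ _ ⟩
    + vℤ p i                  ∎
    where open ≡-Reasoning

  vℚ-1 : vℚ p 1ℚ ≡ 0ℤ
  vℚ-1 = ℤ.+-inverseʳ (+ v p 1)

  vℚ-inv : ∀ q → ↥ q ≢ 0ℤ → vℚ p (inv q) ≡ -ᶻ vℚ p q × ↥ (inv q) ≢ 0ℤ
  vℚ-inv (mkℚ (+ 0)    d _)   q≢0 = contradiction refl q≢0
  vℚ-inv (mkℚ +[1+ n ] d _) q≢0 = flip (+ v p (suc n)) (+ v p (suc d)) , λ ()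
    where
    flip : ∀ a b → b -ᶻ a ≡ -ᶻ (a -ᶻ b)
    flip = solve-∀
  vℚ-inv (mkℚ -[1+ n ] d _) q≢0 = flip (+ v p (suc n)) (+ v p (suc d)) , λ ()
    where
    flip : ∀ a b → b -ᶻ a ≡ -ᶻ (a -ᶻ b)
    flip = solve-∀

  vℚ-^ : ∀ q n → ↥ q ≢ 0ℤ → vℚ p (q ℚ^.^ n) ≡ + n *ᶻ vℚ p q × ↥ (q ℚ^.^ n) ≢ 0ℤ
  vℚ-^ q zero    q≢0 = trans vℚ-1 (sym (ℤ.*-zeroˡ (vℚ p q))) , λ ()
  vℚ-^ q (suc n) q≢0 with vℚ-^ q n q≢0
  ... | eq , ≢0 = trans (vℚ-* q (q ℚ^.^ n) q≢0 ≢0) (trans (cong (vℚ p q +ᶻ_) eq) (sym (ℤ.suc-* (+ n) (vℚ p q))))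
    , ↥-*-≢0 q (q ℚ^.^ n) q≢0 ≢0

  vℚ-^ℤ : ∀ q e → ↥ q ≢ 0ℤ → vℚ p (q ^ℤ e) ≡ e *ᶻ vℚ p q × ↥ (q ^ℤ e) ≢ 0ℤ
  vℚ-^ℤ q (+ n)    q≢0 = vℚ-^ q n q≢0
  vℚ-^ℤ q -[1+ n ] q≢0 with vℚ-^ q (suc n) q≢0
  ... | eq , ≢0 with vℚ-inv (q ℚ^.^ suc n) ≢0
  ... | eq′ , ≢0′ = trans eq′ (trans (cong -ᶻ_ eq) (ℤ.neg-distribˡ-* (+ suc n) (vℚ p q))) , ≢0′

  -- Nonvanishing of the partial product is carried along because the valuation is additive on
  -- nonzero factors only. The function `g` is general since peeling off the first index composes it
  -- with `suc`.
  vℚ-foldr : ∀ {P : ℕ → Set} (P? : ∀ x → Dec (P x)) (f : ℕ → ℚ) (g : ℕ → ℕ) n → (∀ i → ↥ f i ≢ 0ℤ) →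
    vℚ p (foldr ℚ._*_ 1ℚ (map f (filter P? (applyUpTo g n)))) ≡ ∑ n (λ i → ⟦ P? (g i) ⟧ *ᶻ vℚ p (f (g i)))
    × ↥ (foldr ℚ._*_ 1ℚ (map f (filter P? (applyUpTo g n)))) ≢ 0ℤ
  vℚ-foldr P? f g zero    f≢0 = vℚ-1 , λ ()
  vℚ-foldr P? f g (suc n) f≢0 with P? (g 0) | vℚ-foldr P? f (g ∘ suc) n f≢0
  ... | yes _ | eq , ≢0 =
      trans (vℚ-* (f (g 0)) _ (f≢0 (g 0)) ≢0) (cong₂ _+ᶻ_ (sym (ℤ.*-identityˡ (vℚ p (f (g 0))))) eq)
    , ↥-*-≢0 (f (g 0)) _ (f≢0 (g 0)) ≢0
  ... | no _  | eq , ≢0 = trans eq (sym (ℤ.+-identityˡ _)) , ≢0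

  vℚ-möbiusDual : ∀ (A : ℕ → ℤ) n → (∀ m → 1 ≤ m → A m ≢ 0ℤ) →
    vℚ p (möbiusDual A n) ≡ möbiusSum (λ d → + vℤ p (A d)) n
  vℚ-möbiusDual A n A≢0 = trans
    (proj₁ (vℚ-foldr (λ i → suc i ∣? n) (möbiusFactor A n) (λ i → i) n (λ i → proj₂ (factor i))))
    (∑-cong n (λ i _ → cong (⟦ suc i ∣? n ⟧ *ᶻ_) (trans (proj₁ (factor i))
      (cong (μ (n / suc i) *ᶻ_) (vℚ-/1 (A (suc i)))))))
    where
    factor : ∀ i → vℚ p (möbiusFactor A n i) ≡ μ (n / suc i) *ᶻ vℚ p (A (suc i) ℚ./ 1) × ↥ (möbiusFactor A n i) ≢ 0ℤ
    factor i = vℚ-^ℤ (A (suc i) ℚ./ 1) (μ (n / suc i)) (↥-/1-≢0 (A≢0 (suc i) (s≤s z≤n)))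

-- Functions that depend only on divisibility by `z`, `pz`, `p²z`, ...

module Tower {p : ℕ} (p-prime : Prime p) (z : ℕ) .{{z≢0 : NonZero z}} (f : ℕ → ℤ) (g₀ g₁ : ℤ)
  (f-∤ : ∀ d → 1 ≤ d → ¬ z ∣ d → f d ≡ 0ℤ)
  (f-∤p : ∀ m → ¬ p ∣ m → f (m * z) ≡ g₀)
  (f-∣p : ∀ m → 1 ≤ m → f (m * p * z) ≡ g₁ +ᶻ + v p m)
  where

  private
    instance
      p≢0 : NonZero p
      p≢0 = prime⇒nonZero p-prime

    p^≢0 : ∀ k → NonZero (p ^ k)
    p^≢0 k = ℕ.m^n≢0 p k

    p^*z≢0 : ∀ k → NonZero (p ^ k * z)
    p^*z≢0 k = ℕ.m*n≢0 (p ^ k) z {{p^≢0 k}}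

    p^-injective : ∀ {j k} → p ^ j * z ≡ p ^ k * z → j ≡ k
    p^-injective {j} {k} eq = begin
      j               ≡⟨ v-p^k*m p-prime j 1 (p∤1 p-prime) ⟨
      v p (p ^ j * 1) ≡⟨ cong (λ x → v p (x * 1)) (ℕ.*-cancelʳ-≡ (p ^ j) (p ^ k) z eq) ⟩
      v p (p ^ k * 1) ≡⟨ v-p^k*m p-prime k 1 (p∤1 p-prime) ⟩
      k               ∎
      where open ≡-Reasoning

  -- The coefficient of `⟦ p ^ k * z ∣? d ⟧` in `f d`, that is, the jump of `f` when the index gains
  -- its `k`-th factor `p`. By `möbiusSum-∣` it is also the value of the transform at `p ^ k * z`.
  increment : ℕ → ℤ
  increment 0             = g₀
  increment 1             = g₁ -ᶻ g₀
  increment (suc (suc k)) = 1ℤ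

  private
    -- With the bound `2 + n` the two irregular increments split off by computation, and the
    -- remaining `n` indicators add up to `v p m′`, since `m′ ≤ n`.
    expand : ∀ n d → 1 ≤ d → d ≤ n → f d ≡ ∑ (2 + n) (λ k → increment k *ᶻ ⟦ p ^ k * z ∣? d ⟧)
    expand n d 1≤d d≤n with z ∣? d
    ... | no z∤d = trans (f-∤ d 1≤d z∤d) (sym (∑-zero (2 + n) (λ k _ → trans
      (cong (increment k *ᶻ_) (⟦⟧-no (p ^ k * z ∣? d) (z∤d ∘ ℕ.∣-trans (ℕ.n∣m*n (p ^ k)))))
      (ℤ.*-zeroʳ (increment k)))))
    ... | yes (divides m refl) = trans (at m (ℕ.m*n≢0⇒m≢0 m {{>-nonZero 1≤d}}) (ℕ.≤-trans (ℕ.m≤m*n m z) d≤n))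
      (∑-cong (2 + n) (λ k _ → cong (increment k *ᶻ_) (⟦⟧-⇔ (p ^ k ∣? m) (p ^ k * z ∣? m * z)
        (ℕ.*-monoˡ-∣ z) (ℕ.*-cancelʳ-∣ z))))
      where
      open ≡-Reasoning
      at : ∀ m → NonZero m → m ≤ n → f (m * z) ≡ ∑ (2 + n) (λ k → increment k *ᶻ ⟦ p ^ k ∣? m ⟧)
      at m m≢0 m≤n with p ∣? m
      ... | no p∤m = begin
        f (m * z)  ≡⟨ f-∤p m p∤m ⟩
        g₀         ≡⟨ ℤ.*-identityʳ g₀ ⟨
        g₀ *ᶻ 1ℤ   ≡⟨ cong (g₀ *ᶻ_) (⟦⟧-yes (1 ∣? m) (ℕ.1∣ m)) ⟨
        g₀ *ᶻ ⟦ 1 ∣? m ⟧ ≡⟨ ∑-single (2 + n) {λ k → increment k *ᶻ ⟦ p ^ k ∣? m ⟧} 0 (s≤s z≤n) others ⟨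
        ∑ (2 + n) (λ k → increment k *ᶻ ⟦ p ^ k ∣? m ⟧) ∎
        where
        others : ∀ k → k < 2 + n → k ≢ 0 → increment k *ᶻ ⟦ p ^ k ∣? m ⟧ ≡ 0ℤ
        others zero    _ 0≢0 = contradiction refl 0≢0
        others (suc k) _ _   = trans
          (cong (increment (suc k) *ᶻ_) (⟦⟧-no (p ^ suc k ∣? m) (p∤m ∘ ℕ.∣-trans (ℕ.m∣m*n (p ^ k)))))
          (ℤ.*-zeroʳ (increment (suc k)))
      ... | yes (divides m′ refl) = begin
        f (m′ * p * z)                 ≡⟨ f-∣p m′ (>-nonZero⁻¹ m′) ⟩
        g₁ +ᶻ + v p m′                 ≡⟨ telescope g₀ g₁ (+ v p m′) ⟩
        g₀ *ᶻ 1ℤ +ᶻ ((g₁ -ᶻ g₀) *ᶻ 1ℤ +ᶻ + v p m′)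
          ≡⟨ cong₂ _+ᶻ_ (cong (g₀ *ᶻ_) (⟦⟧-yes (p ^ 0 ∣? m′ * p) (ℕ.1∣ _)))
               (cong₂ _+ᶻ_ (cong ((g₁ -ᶻ g₀) *ᶻ_) (⟦⟧-yes (p ^ 1 ∣? m′ * p) (subst (_∣ m′ * p) (sym (ℕ.*-identityʳ p)) (ℕ.n∣m*n m′)))) rest) ⟨
        ∑ (2 + n) (λ k → increment k *ᶻ ⟦ p ^ k ∣? m′ * p ⟧) ∎
        where
        instance
          m′≢0 : NonZero m′
          m′≢0 = ℕ.m*n≢0⇒m≢0 m′ {{m≢0}}
        telescope : ∀ a b c → b +ᶻ c ≡ a *ᶻ 1ℤ +ᶻ ((b -ᶻ a) *ᶻ 1ℤ +ᶻ c)
        telescope = solve-∀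
        rest : ∑ n (λ k → 1ℤ *ᶻ ⟦ p ^ suc (suc k) ∣? m′ * p ⟧) ≡ + v p m′
        rest = begin
          ∑ n (λ k → 1ℤ *ᶻ ⟦ p ^ suc (suc k) ∣? m′ * p ⟧)
            ≡⟨ ∑-cong n (λ k _ → trans (ℤ.*-identityˡ ⟦ p ^ suc (suc k) ∣? m′ * p ⟧)
                 (⟦⟧-⇔ (p ^ suc (suc k) ∣? m′ * p) (p ^ suc k ∣? m′)
                   (λ d → ℕ.*-cancelˡ-∣ p (subst (p ^ suc (suc k) ∣_) (ℕ.*-comm m′ p) d))
                   (λ d → subst (p ^ suc (suc k) ∣_) (ℕ.*-comm p m′) (ℕ.*-monoʳ-∣ p d)))) ⟩
          ∑ n (λ k → ⟦ p ^ suc k ∣? m′ ⟧)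
            ≡⟨ ∑-p^∣ p-prime n m′ (ℕ.≤-trans (ℕ.m≤m*n m′ p) m≤n) ⟩
          + v p m′ ∎

    möbiusSum-expand : ∀ n .{{_ : NonZero n}} →
      möbiusSum f n ≡ ∑ (2 + n) (λ k → increment k *ᶻ ⟦ n ℕ.≟ p ^ k * z ⟧)
    möbiusSum-expand n = begin
      möbiusSum f n
        ≡⟨ möbiusSum-cong n (expand n) ⟩
      möbiusSum (λ d → ∑ (2 + n) (λ k → increment k *ᶻ ⟦ p ^ k * z ∣? d ⟧)) n
        ≡⟨ möbiusSum-∑ (2 + n) n (λ k d → increment k *ᶻ ⟦ p ^ k * z ∣? d ⟧) ⟩
      ∑ (2 + n) (λ k → möbiusSum (λ d → increment k *ᶻ ⟦ p ^ k * z ∣? d ⟧) n)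
        ≡⟨ ∑-cong (2 + n) (λ k _ → trans (möbiusSum-*ˡ n (increment k) (λ d → ⟦ p ^ k * z ∣? d ⟧))
             (cong (increment k *ᶻ_) (möbiusSum-∣ (p ^ k * z) n {{p^*z≢0 k}}))) ⟩
      ∑ (2 + n) (λ k → increment k *ᶻ ⟦ n ℕ.≟ p ^ k * z ⟧) ∎
      where open ≡-Reasoning

  -- The numbers `p ^ k * z` are pairwise distinct, so a single term survives; it lies in the range
  -- because `k < p ^ k ≤ n`.
  möbiusSum-at : ∀ n .{{_ : NonZero n}} k → n ≡ p ^ k * z → möbiusSum f n ≡ increment k
  möbiusSum-at n k n≡p^k*z = trans (möbiusSum-expand n) (trans
    (∑-single (2 + n) k (ℕ.<-≤-trans (n<p^n p-prime k) (ℕ.≤-trans (ℕ.m≤m*n (p ^ k) z) (ℕ.≤-trans (ℕ.≤-reflexive (sym n≡p^k*z)) (ℕ.m≤n+m n 2))))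
      (λ j _ j≢k → trans (cong (increment j *ᶻ_) (⟦⟧-no (n ℕ.≟ p ^ j * z) (λ eq → j≢k (p^-injective (trans (sym eq) n≡p^k*z)))))
        (ℤ.*-zeroʳ (increment j))))
    (trans (cong (increment k *ᶻ_) (⟦⟧-yes (n ℕ.≟ p ^ k * z) n≡p^k*z)) (ℤ.*-identityʳ (increment k))))

  möbiusSum-off : ∀ n .{{_ : NonZero n}} → (∀ k → n ≢ p ^ k * z) → möbiusSum f n ≡ 0ℤ
  möbiusSum-off n n≢ = trans (möbiusSum-expand n) (∑-zero (2 + n) (λ k _ →
    trans (cong (increment k *ᶻ_) (⟦⟧-no (n ℕ.≟ p ^ k * z) (n≢ k))) (ℤ.*-zeroʳ (increment k))))

-- Identities between Lucas sequences

-- The quadratic form is `(y - α x)(y - β x)`. As `U_{n+1} - β U_n = αⁿ` and `U_{n+1} - α U_n = βⁿ`,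
-- its value is `(αβ)ⁿ`.
U-norm : ∀ P Q n → let x = U P Q n ; y = U P Q (suc n) in y *ᶻ y -ᶻ P *ᶻ (x *ᶻ y) +ᶻ Q *ᶻ (x *ᶻ x) ≡ Q ^ᶻ n
U-norm P Q zero    = base P Q
  where
  base : ∀ P Q → 1ℤ *ᶻ 1ℤ -ᶻ P *ᶻ (0ℤ *ᶻ 1ℤ) +ᶻ Q *ᶻ (0ℤ *ᶻ 0ℤ) ≡ 1ℤ
  base = solve-∀
U-norm P Q (suc n) = trans (step P Q (U P Q n) (U P Q (suc n))) (cong (Q *ᶻ_) (U-norm P Q n))
  where
  step : ∀ P Q x y → (P *ᶻ y -ᶻ Q *ᶻ x) *ᶻ (P *ᶻ y -ᶻ Q *ᶻ x) -ᶻ P *ᶻ (y *ᶻ (P *ᶻ y -ᶻ Q *ᶻ x)) +ᶻ Q *ᶻ (y *ᶻ y)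
    ≡ Q *ᶻ (y *ᶻ y -ᶻ P *ᶻ (x *ᶻ y) +ᶻ Q *ᶻ (x *ᶻ x))
  step = solve-∀

-- Eliminates `V`, so that later identities become polynomial ones in two consecutive terms of `U`.
V-U : ∀ P Q n → V P Q n ≡ + 2 *ᶻ U P Q (suc n) -ᶻ P *ᶻ U P Q n
V-U P Q zero = base P
  where
  base : ∀ P → + 2 ≡ + 2 *ᶻ 1ℤ -ᶻ P *ᶻ 0ℤ
  base = solve-∀
V-U P Q (suc zero) = base P Q
  where
  base : ∀ P Q → P ≡ + 2 *ᶻ (P *ᶻ 1ℤ -ᶻ Q *ᶻ 0ℤ) -ᶻ P *ᶻ 1ℤ
  base = solve-∀
V-U P Q (suc (suc n)) = trans (cong₂ (λ a b → P *ᶻ a -ᶻ Q *ᶻ b) (V-U P Q (suc n)) (V-U P Q n))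
  (step P Q (U P Q n) (U P Q (suc n)))
  where
  step : ∀ P Q x y → P *ᶻ (+ 2 *ᶻ (P *ᶻ y -ᶻ Q *ᶻ x) -ᶻ P *ᶻ y) -ᶻ Q *ᶻ (+ 2 *ᶻ y -ᶻ P *ᶻ x)
    ≡ + 2 *ᶻ (P *ᶻ (P *ᶻ y -ᶻ Q *ᶻ x) -ᶻ Q *ᶻ y) -ᶻ P *ᶻ (P *ᶻ y -ᶻ Q *ᶻ x)
  step = solve-∀

-- Both sides satisfy the same recurrence in `m`. The last factor is `-Q U_{n-1}`, written so that
-- it makes sense for `n = 0`.
U-+ : ∀ P Q m n → U P Q (m + n) ≡ U P Q (suc m) *ᶻ U P Q n +ᶻ U P Q m *ᶻ (U P Q (suc n) -ᶻ P *ᶻ U P Q n)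
U-+ P Q zero n = base P (U P Q n) (U P Q (suc n))
  where
  base : ∀ P x y → x ≡ 1ℤ *ᶻ x +ᶻ 0ℤ *ᶻ (y -ᶻ P *ᶻ x)
  base = solve-∀
U-+ P Q (suc zero) n = base P Q (U P Q n) (U P Q (suc n))
  where
  base : ∀ P Q x y → y ≡ (P *ᶻ 1ℤ -ᶻ Q *ᶻ 0ℤ) *ᶻ x +ᶻ 1ℤ *ᶻ (y -ᶻ P *ᶻ x)
  base = solve-∀
U-+ P Q (suc (suc m)) n = trans (cong₂ (λ a b → P *ᶻ a -ᶻ Q *ᶻ b) (U-+ P Q (suc m) n) (U-+ P Q m n))
  (step P Q (U P Q m) (U P Q (suc m)) (U P Q n) (U P Q (suc n) -ᶻ P *ᶻ U P Q n))
  where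
  step : ∀ P Q a b x y → P *ᶻ ((P *ᶻ b -ᶻ Q *ᶻ a) *ᶻ x +ᶻ b *ᶻ y) -ᶻ Q *ᶻ (b *ᶻ x +ᶻ a *ᶻ y)
    ≡ (P *ᶻ (P *ᶻ b -ᶻ Q *ᶻ a) -ᶻ Q *ᶻ b) *ᶻ x +ᶻ (P *ᶻ b -ᶻ Q *ᶻ a) *ᶻ y
  step = solve-∀

-- The numbers `α^z` and `β^z` are the roots of `X² - V_z X + Q^z`, which therefore governs every
-- `z`-th term. Without roots, both sides are expanded in the terms at `z`, `z + 1`, `m`, `m + 1`,
-- and `Q^z` enters as the form of `U-norm`.
U-stride : ∀ P Q z m → U P Q (z + (z + m)) ≡ V P Q z *ᶻ U P Q (z + m) -ᶻ Q ^ᶻ z *ᶻ U P Q m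
U-stride P Q z m = begin
  U P Q (z + (z + m))
    ≡⟨ cong (U P Q) (ℕ.+-comm z (z + m)) ⟩
  U P Q (z + m + z)
    ≡⟨ U-+ P Q (z + m) z ⟩
  U P Q (suc (z + m)) *ᶻ x +ᶻ U P Q (z + m) *ᶻ (y -ᶻ P *ᶻ x)
    ≡⟨ cong₂ (λ s t → s *ᶻ x +ᶻ t *ᶻ (y -ᶻ P *ᶻ x)) eq₁ eq₀ ⟩
  ((P *ᶻ b -ᶻ Q *ᶻ a) *ᶻ x +ᶻ b *ᶻ (y -ᶻ P *ᶻ x)) *ᶻ x +ᶻ (b *ᶻ x +ᶻ a *ᶻ (y -ᶻ P *ᶻ x)) *ᶻ (y -ᶻ P *ᶻ x)
    ≡⟨ identity P Q a b x y ⟩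
  (+ 2 *ᶻ y -ᶻ P *ᶻ x) *ᶻ (b *ᶻ x +ᶻ a *ᶻ (y -ᶻ P *ᶻ x)) -ᶻ (y *ᶻ y -ᶻ P *ᶻ (x *ᶻ y) +ᶻ Q *ᶻ (x *ᶻ x)) *ᶻ a
    ≡⟨ cong₂ (λ s t → s *ᶻ t -ᶻ (y *ᶻ y -ᶻ P *ᶻ (x *ᶻ y) +ᶻ Q *ᶻ (x *ᶻ x)) *ᶻ a) (V-U P Q z) eq₀ ⟨
  V P Q z *ᶻ U P Q (z + m) -ᶻ (y *ᶻ y -ᶻ P *ᶻ (x *ᶻ y) +ᶻ Q *ᶻ (x *ᶻ x)) *ᶻ a
    ≡⟨ cong (λ s → V P Q z *ᶻ U P Q (z + m) -ᶻ s *ᶻ a) (U-norm P Q z) ⟩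
  V P Q z *ᶻ U P Q (z + m) -ᶻ Q ^ᶻ z *ᶻ a ∎
  where
  open ≡-Reasoning
  x = U P Q z
  y = U P Q (suc z)
  a = U P Q m
  b = U P Q (suc m)
  eq₀ : U P Q (z + m) ≡ b *ᶻ x +ᶻ a *ᶻ (y -ᶻ P *ᶻ x)
  eq₀ = trans (cong (U P Q) (ℕ.+-comm z m)) (U-+ P Q m z)
  eq₁ : U P Q (suc (z + m)) ≡ (P *ᶻ b -ᶻ Q *ᶻ a) *ᶻ x +ᶻ b *ᶻ (y -ᶻ P *ᶻ x)
  eq₁ = trans (cong (λ k → U P Q (suc k)) (ℕ.+-comm z m)) (U-+ P Q (suc m) z)
  identity : ∀ P Q a b x y →
    ((P *ᶻ b -ᶻ Q *ᶻ a) *ᶻ x +ᶻ b *ᶻ (y -ᶻ P *ᶻ x)) *ᶻ x +ᶻ (b *ᶻ x +ᶻ a *ᶻ (y -ᶻ P *ᶻ x)) *ᶻ (y -ᶻ P *ᶻ x)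
    ≡ (+ 2 *ᶻ y -ᶻ P *ᶻ x) *ᶻ (b *ᶻ x +ᶻ a *ᶻ (y -ᶻ P *ᶻ x)) -ᶻ (y *ᶻ y -ᶻ P *ᶻ (x *ᶻ y) +ᶻ Q *ᶻ (x *ᶻ x)) *ᶻ a
  identity = solve-∀

U-* : ∀ P Q m z → U P Q (m * z) ≡ U P Q z *ᶻ U (V P Q z) (Q ^ᶻ z) m
U-* P Q zero z = sym (ℤ.*-zeroʳ (U P Q z))
U-* P Q (suc zero) z = trans (cong (U P Q) (ℕ.+-identityʳ z)) (sym (ℤ.*-identityʳ (U P Q z)))
U-* P Q (suc (suc m)) z = begin
  U P Q (z + (z + m * z))
    ≡⟨ U-stride P Q z (m * z) ⟩
  V P Q z *ᶻ U P Q (suc m * z) -ᶻ Q ^ᶻ z *ᶻ U P Q (m * z)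
    ≡⟨ cong₂ (λ s t → V P Q z *ᶻ s -ᶻ Q ^ᶻ z *ᶻ t) (U-* P Q (suc m) z) (U-* P Q m z) ⟩
  V P Q z *ᶻ (U P Q z *ᶻ U′ (suc m)) -ᶻ Q ^ᶻ z *ᶻ (U P Q z *ᶻ U′ m)
    ≡⟨ factor (V P Q z) (Q ^ᶻ z) (U P Q z) (U′ (suc m)) (U′ m) ⟩
  U P Q z *ᶻ U′ (suc (suc m)) ∎
  where
  open ≡-Reasoning
  U′ = U (V P Q z) (Q ^ᶻ z)
  factor : ∀ a b u s t → a *ᶻ (u *ᶻ s) -ᶻ b *ᶻ (u *ᶻ t) ≡ u *ᶻ (a *ᶻ s -ᶻ b *ᶻ t)
  factor = solve-∀

-- In terms of the roots this is `(αⁿ + βⁿ)² - 4(αβ)ⁿ = (αⁿ - βⁿ)²`.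
discriminant-V : ∀ P Q n → discriminant (V P Q n) (Q ^ᶻ n) ≡ discriminant P Q *ᶻ (U P Q n *ᶻ U P Q n)
discriminant-V P Q n = trans (cong₂ discriminant (V-U P Q n) (sym (U-norm P Q n)))
  (identity P Q (U P Q n) (U P Q (suc n)))
  where
  identity : ∀ P Q x y →
    (+ 2 *ᶻ y -ᶻ P *ᶻ x) *ᶻ ((+ 2 *ᶻ y -ᶻ P *ᶻ x) *ᶻ 1ℤ) -ᶻ + 4 *ᶻ (y *ᶻ y -ᶻ P *ᶻ (x *ᶻ y) +ᶻ Q *ᶻ (x *ᶻ x))
    ≡ (P *ᶻ (P *ᶻ 1ℤ) -ᶻ + 4 *ᶻ Q) *ᶻ (x *ᶻ x)
  identity = solve-∀

-- Multiplying both roots by `c` multiplies `(αⁿ⁺¹ - βⁿ⁺¹) / (α - β)` by `cⁿ`.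
U-scale : ∀ c P Q n → U (c *ᶻ P) (c *ᶻ c *ᶻ Q) (suc n) ≡ c ^ᶻ n *ᶻ U P Q (suc n)
U-scale c P Q zero = refl
U-scale c P Q (suc zero) = base c P Q
  where
  base : ∀ c P Q → c *ᶻ P *ᶻ 1ℤ -ᶻ c *ᶻ c *ᶻ Q *ᶻ 0ℤ ≡ c *ᶻ 1ℤ *ᶻ (P *ᶻ 1ℤ -ᶻ Q *ᶻ 0ℤ)
  base = solve-∀
U-scale c P Q (suc (suc n)) = trans
  (cong₂ (λ s t → c *ᶻ P *ᶻ s -ᶻ c *ᶻ c *ᶻ Q *ᶻ t) (U-scale c P Q (suc n)) (U-scale c P Q n))
  (step c P Q (c ^ᶻ n) (U P Q (suc n)) (U P Q (suc (suc n))))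
  where
  step : ∀ c P Q e x y → c *ᶻ P *ᶻ (c *ᶻ e *ᶻ y) -ᶻ c *ᶻ c *ᶻ Q *ᶻ (e *ᶻ x) ≡ c *ᶻ (c *ᶻ e) *ᶻ (P *ᶻ y -ᶻ Q *ᶻ x)
  step = solve-∀

-- Modulo D the roots coincide: 2α ≡ P, so 2ⁿ⁻¹ Uₙ ≡ n Pⁿ⁻¹.
U-mod-D : ∀ P Q n → ∃[ k ] P *ᶻ ((+ 2) ^ᶻ n *ᶻ U P Q n) ≡ + 2 *ᶻ + n *ᶻ P ^ᶻ n +ᶻ discriminant P Q *ᶻ k
U-mod-D P Q zero = 0ℤ , base P Q
  where
  base : ∀ P Q → P *ᶻ (1ℤ *ᶻ 0ℤ) ≡ + 2 *ᶻ 0ℤ *ᶻ 1ℤ +ᶻ (P *ᶻ (P *ᶻ 1ℤ) -ᶻ + 4 *ᶻ Q) *ᶻ 0ℤ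
  base = solve-∀
U-mod-D P Q (suc zero) = 0ℤ , base P Q
  where
  base : ∀ P Q → P *ᶻ (+ 2 *ᶻ 1ℤ *ᶻ 1ℤ) ≡ + 2 *ᶻ 1ℤ *ᶻ (P *ᶻ 1ℤ) +ᶻ (P *ᶻ (P *ᶻ 1ℤ) -ᶻ + 4 *ᶻ Q) *ᶻ 0ℤ
  base = solve-∀
U-mod-D P Q (suc (suc n)) with U-mod-D P Q (suc n) | U-mod-D P Q n
... | k₁ , eq₁ | k₀ , eq₀ =
    + 2 *ᶻ P *ᶻ k₁ -ᶻ P *ᶻ P *ᶻ k₀ +ᶻ P *ᶻ (w *ᶻ x)
  , (begin
    P *ᶻ (+ 2 *ᶻ (+ 2 *ᶻ w) *ᶻ (P *ᶻ y -ᶻ Q *ᶻ x))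
      -- Since `4Q = P² - D`, the recurrence of `2ⁿ Uₙ` has the double root `P` up to a multiple of
      -- `D`; that multiple goes into the witness.
      ≡⟨ split P Q w x y ⟩
    + 2 *ᶻ P *ᶻ (P *ᶻ (+ 2 *ᶻ w *ᶻ y)) -ᶻ P *ᶻ P *ᶻ (P *ᶻ (w *ᶻ x)) +ᶻ D *ᶻ (P *ᶻ (w *ᶻ x))
      ≡⟨ cong₂ (λ s t → + 2 *ᶻ P *ᶻ s -ᶻ P *ᶻ P *ᶻ t +ᶻ D *ᶻ (P *ᶻ (w *ᶻ x))) eq₁ eq₀ ⟩
    + 2 *ᶻ P *ᶻ (+ 2 *ᶻ (1ℤ +ᶻ + n) *ᶻ (P *ᶻ e) +ᶻ D *ᶻ k₁) -ᶻ P *ᶻ P *ᶻ (+ 2 *ᶻ + n *ᶻ e +ᶻ D *ᶻ k₀) +ᶻ D *ᶻ (P *ᶻ (w *ᶻ x))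
      ≡⟨ collect P D (+ n) e k₁ k₀ (P *ᶻ (w *ᶻ x)) ⟩
    + 2 *ᶻ (+ 2 +ᶻ + n) *ᶻ (P *ᶻ (P *ᶻ e)) +ᶻ D *ᶻ (+ 2 *ᶻ P *ᶻ k₁ -ᶻ P *ᶻ P *ᶻ k₀ +ᶻ P *ᶻ (w *ᶻ x)) ∎)
  where
  open ≡-Reasoning
  D = discriminant P Q
  w = (+ 2) ^ᶻ n
  x = U P Q n
  y = U P Q (suc n)
  e = P ^ᶻ n
  split : ∀ P Q w x y → P *ᶻ (+ 2 *ᶻ (+ 2 *ᶻ w) *ᶻ (P *ᶻ y -ᶻ Q *ᶻ x))
    ≡ + 2 *ᶻ P *ᶻ (P *ᶻ (+ 2 *ᶻ w *ᶻ y)) -ᶻ P *ᶻ P *ᶻ (P *ᶻ (w *ᶻ x)) +ᶻ (P *ᶻ (P *ᶻ 1ℤ) -ᶻ + 4 *ᶻ Q) *ᶻ (P *ᶻ (w *ᶻ x))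
  split = solve-∀
  collect : ∀ P D n e k₁ k₀ r →
    + 2 *ᶻ P *ᶻ (+ 2 *ᶻ (1ℤ +ᶻ n) *ᶻ (P *ᶻ e) +ᶻ D *ᶻ k₁) -ᶻ P *ᶻ P *ᶻ (+ 2 *ᶻ n *ᶻ e +ᶻ D *ᶻ k₀) +ᶻ D *ᶻ r
    ≡ + 2 *ᶻ (+ 2 +ᶻ n) *ᶻ (P *ᶻ (P *ᶻ e)) +ᶻ D *ᶻ (+ 2 *ᶻ P *ᶻ k₁ -ᶻ P *ᶻ P *ᶻ k₀ +ᶻ r)
  collect = solve-∀

-- The expansion 2ⁿ⁻¹ Uₙ = n Pⁿ⁻¹ + C(n,3) Pⁿ⁻³ D + ⋯ of Binet's formula, truncated
-- modulo D² and multiplied by 12 P³ so that it also makes sense for small n.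
U-mod-D² : ∀ P Q n → ∃[ k ] + 6 *ᶻ (P *ᶻ P *ᶻ P) *ᶻ ((+ 2) ^ᶻ n *ᶻ U P Q n)
  ≡ + 12 *ᶻ + n *ᶻ (P *ᶻ P *ᶻ P ^ᶻ n)
    +ᶻ + 2 *ᶻ (+ n *ᶻ (+ n -ᶻ 1ℤ) *ᶻ (+ n -ᶻ + 2)) *ᶻ (discriminant P Q *ᶻ P ^ᶻ n)
    +ᶻ discriminant P Q *ᶻ discriminant P Q *ᶻ k
U-mod-D² P Q zero = 0ℤ , base P (discriminant P Q)
  where
  base : ∀ P D → + 6 *ᶻ (P *ᶻ P *ᶻ P) *ᶻ (1ℤ *ᶻ 0ℤ) ≡ + 12 *ᶻ 0ℤ *ᶻ (P *ᶻ P *ᶻ 1ℤ)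
    +ᶻ + 2 *ᶻ (0ℤ *ᶻ (0ℤ -ᶻ 1ℤ) *ᶻ (0ℤ -ᶻ + 2)) *ᶻ (D *ᶻ 1ℤ) +ᶻ D *ᶻ D *ᶻ 0ℤ
  base = solve-∀
U-mod-D² P Q (suc zero) = 0ℤ , base P (discriminant P Q)
  where
  base : ∀ P D → + 6 *ᶻ (P *ᶻ P *ᶻ P) *ᶻ (+ 2 *ᶻ 1ℤ *ᶻ 1ℤ) ≡ + 12 *ᶻ 1ℤ *ᶻ (P *ᶻ P *ᶻ (P *ᶻ 1ℤ))
    +ᶻ + 2 *ᶻ (1ℤ *ᶻ (1ℤ -ᶻ 1ℤ) *ᶻ (1ℤ -ᶻ + 2)) *ᶻ (D *ᶻ (P *ᶻ 1ℤ)) +ᶻ D *ᶻ D *ᶻ 0ℤ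
  base = solve-∀
U-mod-D² P Q (suc (suc n)) with U-mod-D² P Q (suc n) | U-mod-D² P Q n
... | k₁ , eq₁ | k₀ , eq₀ =
    + 2 *ᶻ P *ᶻ k₁ -ᶻ P *ᶻ P *ᶻ k₀ +ᶻ D *ᶻ k₀ +ᶻ + 2 *ᶻ T (+ n) *ᶻ e
  , (begin
    + 6 *ᶻ (P *ᶻ P *ᶻ P) *ᶻ (+ 2 *ᶻ (+ 2 *ᶻ w) *ᶻ (P *ᶻ y -ᶻ Q *ᶻ x))
      ≡⟨ split P Q w x y ⟩
    + 2 *ᶻ P *ᶻ (+ 6 *ᶻ (P *ᶻ P *ᶻ P) *ᶻ (+ 2 *ᶻ w *ᶻ y)) +ᶻ (D -ᶻ P *ᶻ P) *ᶻ (+ 6 *ᶻ (P *ᶻ P *ᶻ P) *ᶻ (w *ᶻ x))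
      ≡⟨ cong₂ (λ s t → + 2 *ᶻ P *ᶻ s +ᶻ (D -ᶻ P *ᶻ P) *ᶻ t) eq₁ eq₀ ⟩
    _
      ≡⟨ collect P D (+ n) e k₁ k₀ ⟩
    + 12 *ᶻ (+ 2 +ᶻ + n) *ᶻ (P *ᶻ P *ᶻ (P *ᶻ (P *ᶻ e))) +ᶻ + 2 *ᶻ T (+ 2 +ᶻ + n) *ᶻ (D *ᶻ (P *ᶻ (P *ᶻ e)))
      +ᶻ D *ᶻ D *ᶻ (+ 2 *ᶻ P *ᶻ k₁ -ᶻ P *ᶻ P *ᶻ k₀ +ᶻ D *ᶻ k₀ +ᶻ + 2 *ᶻ T (+ n) *ᶻ e) ∎)
  where
  open ≡-Reasoning
  D = discriminant P Q
  w = (+ 2) ^ᶻ n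
  x = U P Q n
  y = U P Q (suc n)
  e = P ^ᶻ n
  T : ℤ → ℤ
  T n = n *ᶻ (n -ᶻ 1ℤ) *ᶻ (n -ᶻ + 2)
  split : ∀ P Q w x y → + 6 *ᶻ (P *ᶻ P *ᶻ P) *ᶻ (+ 2 *ᶻ (+ 2 *ᶻ w) *ᶻ (P *ᶻ y -ᶻ Q *ᶻ x))
    ≡ + 2 *ᶻ P *ᶻ (+ 6 *ᶻ (P *ᶻ P *ᶻ P) *ᶻ (+ 2 *ᶻ w *ᶻ y)) +ᶻ ((P *ᶻ (P *ᶻ 1ℤ) -ᶻ + 4 *ᶻ Q) -ᶻ P *ᶻ P) *ᶻ (+ 6 *ᶻ (P *ᶻ P *ᶻ P) *ᶻ (w *ᶻ x))
  split = solve-∀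
  collect : ∀ P D n e k₁ k₀ →
    + 2 *ᶻ P *ᶻ (+ 12 *ᶻ (1ℤ +ᶻ n) *ᶻ (P *ᶻ P *ᶻ (P *ᶻ e)) +ᶻ + 2 *ᶻ ((1ℤ +ᶻ n) *ᶻ ((1ℤ +ᶻ n) -ᶻ 1ℤ) *ᶻ ((1ℤ +ᶻ n) -ᶻ + 2)) *ᶻ (D *ᶻ (P *ᶻ e)) +ᶻ D *ᶻ D *ᶻ k₁)
    +ᶻ (D -ᶻ P *ᶻ P) *ᶻ (+ 12 *ᶻ n *ᶻ (P *ᶻ P *ᶻ e) +ᶻ + 2 *ᶻ (n *ᶻ (n -ᶻ 1ℤ) *ᶻ (n -ᶻ + 2)) *ᶻ (D *ᶻ e) +ᶻ D *ᶻ D *ᶻ k₀)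
    ≡ + 12 *ᶻ (+ 2 +ᶻ n) *ᶻ (P *ᶻ P *ᶻ (P *ᶻ (P *ᶻ e))) +ᶻ + 2 *ᶻ ((+ 2 +ᶻ n) *ᶻ ((+ 2 +ᶻ n) -ᶻ 1ℤ) *ᶻ ((+ 2 +ᶻ n) -ᶻ + 2)) *ᶻ (D *ᶻ (P *ᶻ (P *ᶻ e)))
      +ᶻ D *ᶻ D *ᶻ (+ 2 *ᶻ P *ᶻ k₁ -ᶻ P *ᶻ P *ᶻ k₀ +ᶻ D *ᶻ k₀ +ᶻ + 2 *ᶻ (n *ᶻ (n -ᶻ 1ℤ) *ᶻ (n -ᶻ + 2)) *ᶻ e)
  collect = solve-∀

-- Lucas sequences modulo p

NonVanishing : (ℕ → ℤ) → Set
NonVanishing A = ∀ m → 1 ≤ m → A m ≢ 0ℤ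

U-stride-nonVanishing : ∀ P Q z → 1 ≤ z → NonVanishing (U P Q) → NonVanishing (U (V P Q z) (Q ^ᶻ z))
U-stride-nonVanishing P Q z 1≤z U≢0 m 1≤m eq = U≢0 (m * z) (ℕ.*-mono-≤ 1≤m 1≤z)
  (trans (U-* P Q m z) (trans (cong (U P Q z *ᶻ_) eq) (ℤ.*-zeroʳ (U P Q z))))

least : ∀ {A : ℕ → Set} (A? : ∀ n → Dec (A n)) n → A n → ∃[ m ] (A m × (∀ k → A k → m ≤ k))
least {A} A? = <-rec (λ n → A n → ∃[ m ] (A m × (∀ k → A k → m ≤ k))) step
  where
  step : ∀ n → (∀ {m} → m < n → A m → ∃[ m ] (A m × (∀ k → A k → m ≤ k))) → A n → ∃[ m ] (A m × (∀ k → A k → m ≤ k))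
  step n rec An with ℕ.anyUpTo? A? n
  ... | yes (m , m<n , Am) = rec m<n Am
  ... | no ∄ = n , An , λ k Ak → ℕ.≮⇒≥ (λ k<n → ∄ (k , k<n , Ak))

module _ {p : ℕ} (p-prime : Prime p) where

  private
    instance
      p≢0 : NonZero p
      p≢0 = prime⇒nonZero p-prime

  prime-∣-* : ∀ i j → + p ∣ˢ i *ᶻ j → + p ∣ˢ i ⊎ + p ∣ˢ j
  prime-∣-* i j d = [ inj₁ ∘ ∣ᵤ⇒∣ , inj₂ ∘ ∣ᵤ⇒∣ ]′
    (euclidsLemma ∣ i ∣ ∣ j ∣ p-prime (subst (p ∣_) (ℤ.abs-* i j) (∣⇒∣ᵤ d)))

  prime-∤-* : ∀ {i j} → ¬ + p ∣ˢ i → ¬ + p ∣ˢ j → ¬ + p ∣ˢ i *ᶻ j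
  prime-∤-* {i} {j} p∤i p∤j = [ p∤i , p∤j ]′ ∘ prime-∣-* i j

  prime-∤1 : ¬ + p ∣ˢ 1ℤ
  prime-∤1 = p∤1 p-prime ∘ ∣⇒∣ᵤ

  prime-∤-^ : ∀ {i} n → ¬ + p ∣ˢ i → ¬ + p ∣ˢ i ^ᶻ n
  prime-∤-^ zero    p∤i = prime-∤1
  prime-∤-^ (suc n) p∤i = prime-∤-* p∤i (prime-∤-^ n p∤i)

  prime-∤-prime : ∀ {q} → Prime q → p ≢ q → ¬ + p ∣ˢ + q
  prime-∤-prime q-prime p≢q p∣q =
    [ (λ { refl → p∤1 p-prime ℕ.∣-refl }) , p≢q ]′ (prime⇒irreducible q-prime (∣⇒∣ᵤ p∣q))

  vℤ-∤ : ∀ {i} → ¬ + p ∣ˢ i → vℤ p i ≡ 0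
  vℤ-∤ p∤i = v-∤ p-prime (p∤i ∘ ∣ᵤ⇒∣)

  vℤ-exact : ∀ {i} → + p ∣ˢ i → ¬ + p *ᶻ + p ∣ˢ i → vℤ p i ≡ 1
  vℤ-exact {i} (dividesˢ q refl) p²∤i = trans (cong (v p) (begin
      ∣ q *ᶻ + p ∣   ≡⟨ ℤ.abs-* q (+ p) ⟩
      ∣ q ∣ * p      ≡⟨ ℕ.*-comm ∣ q ∣ p ⟩
      p * ∣ q ∣      ≡⟨ cong (_* ∣ q ∣) (ℕ.*-identityʳ p) ⟨
      p ^ 1 * ∣ q ∣  ∎))
    (v-p^k*m p-prime 1 ∣ q ∣ (λ p∣q → p²∤i (lift (∣ᵤ⇒∣ p∣q))))
    where
    open ≡-Reasoning
    lift : + p ∣ˢ q → + p *ᶻ + p ∣ˢ q *ᶻ + p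
    lift (dividesˢ r refl) = dividesˢ r (ℤ.*-assoc r (+ p) (+ p))

  -- A prime that divides the discriminant but not `Q`

  module _ (P Q : ℤ) (p∣D : + p ∣ˢ discriminant P Q) (p∤Q : ¬ + p ∣ˢ Q) where

    private
      D = discriminant P Q

      P²≡D+4Q : P *ᶻ P ≡ D +ᶻ + 4 *ᶻ Q
      P²≡D+4Q = identity P Q
        where
        identity : ∀ P Q → P *ᶻ P ≡ (P *ᶻ (P *ᶻ 1ℤ) -ᶻ + 4 *ᶻ Q) +ᶻ + 4 *ᶻ Q
        identity = solve-∀

    odd⇒∤2 : p ≢ 2 → ¬ + p ∣ˢ + 2
    odd⇒∤2 = prime-∤-prime prime[2]

    odd⇒∤P : p ≢ 2 → ¬ + p ∣ˢ P
    odd⇒∤P p≢2 p∣P = prime-∤-* {+ 4} (prime-∤-* {+ 2} {+ 2} (odd⇒∤2 p≢2) (odd⇒∤2 p≢2)) p∤Q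
      (∣m+n∣m⇒∣n (subst (+ p ∣ˢ_) P²≡D+4Q (∣m⇒∣m*n P p∣P)) p∣D)

    even⇒∣P : p ≡ 2 → + p ∣ˢ P
    even⇒∣P refl = [ (λ d → d) , (λ d → d) ]′ (prime-∣-* P P (subst (+ 2 ∣ˢ_) (sym P²≡D+4Q)
      (∣m∣n⇒∣m+n p∣D (∣m⇒∣m*n Q (dividesˢ (+ 2) refl)))))

    -- For `p = 2`, `P` is even and `Q` odd, so `U_{m+2}` and `U_m` have the same parity. For odd
    -- `p`, `U-mod-D` gives `P 2^m U_m ≡ 2 m P^m` modulo `p`, where `2`, `P` and `m` are all prime
    -- to `p`.
    U-∤ : ∀ m → ¬ p ∣ m → ¬ + p ∣ˢ U P Q m
    U-∤ m p∤m with p ℕ.≟ 2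
    ... | yes refl = parity m p∤m
      where
      parity : ∀ m → ¬ 2 ∣ m → ¬ + 2 ∣ˢ U P Q m
      parity zero          2∤0 = contradiction (2 ℕ.∣0) 2∤0
      parity (suc zero)    _   = prime-∤1
      parity (suc (suc m)) 2∤m+2 2∣U = [ p∤Q , parity m (2∤m+2 ∘ ℕ.∣m∣n⇒∣m+n (ℕ.∣-refl {2})) ]′ (prime-∣-* Q (U P Q m)
        (subst (+ 2 ∣ˢ_) (identity (P *ᶻ U P Q (suc m)) (Q *ᶻ U P Q m))
          (∣m∣n⇒∣m-n (∣m⇒∣m*n (U P Q (suc m)) (even⇒∣P refl)) 2∣U)))
        where
        identity : ∀ x y → x -ᶻ (x -ᶻ y) ≡ y
        identity = solve-∀
    ... | no p≢2 with U-mod-D P Q m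
    ... | k , eq = λ p∣U → prime-∤-* {+ 2 *ᶻ + m} (prime-∤-* (odd⇒∤2 p≢2) (p∤m ∘ ∣⇒∣ᵤ)) (prime-∤-^ m (odd⇒∤P p≢2))
      (subst (+ p ∣ˢ_) (trans (cong (_-ᶻ D *ᶻ k) eq) (identity (+ 2 *ᶻ + m *ᶻ P ^ᶻ m) (D *ᶻ k)))
        (∣m∣n⇒∣m-n (∣n⇒∣m*n P (∣n⇒∣m*n ((+ 2) ^ᶻ m) p∣U)) (∣m⇒∣m*n k p∣D)))
      where
      identity : ∀ x y → x +ᶻ y -ᶻ y ≡ x
      identity = solve-∀

    p∣U[p] : + p ∣ˢ U P Q p
    p∣U[p] with p ℕ.≟ 2
    ... | yes p≡2 = subst (λ x → + p ∣ˢ U P Q x) (sym p≡2) (subst (+ p ∣ˢ_) (identity P Q) (even⇒∣P p≡2))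
      where
      identity : ∀ P Q → P ≡ P *ᶻ 1ℤ -ᶻ Q *ᶻ 0ℤ
      identity = solve-∀
    ... | no p≢2 with U-mod-D P Q p
    ... | k , eq = case prime-∣-* P ((+ 2) ^ᶻ p *ᶻ U P Q p) p∣P2ᵖU of λ where
      (inj₁ p∣P)   → contradiction p∣P (odd⇒∤P p≢2)
      (inj₂ p∣2ᵖU) → case prime-∣-* ((+ 2) ^ᶻ p) (U P Q p) p∣2ᵖU of λ where
        (inj₁ p∣2ᵖ) → contradiction p∣2ᵖ (prime-∤-^ p (odd⇒∤2 p≢2))
        (inj₂ p∣U)  → p∣U
     where
        p∣P2ᵖU : + p ∣ˢ P *ᶻ ((+ 2) ^ᶻ p *ᶻ U P Q p)
        p∣P2ᵖU = subst (+ p ∣ˢ_) (sym eq)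
          (∣m∣n⇒∣m+n (∣m⇒∣m*n (P ^ᶻ p) (∣n⇒∣m*n (+ 2) ∣-refl)) (∣m⇒∣m*n k p∣D))

    -- For p ≥ 5, 12 is a unit modulo p and p² divides the D-term of `U-mod-D²`.
    p²∤U[p] : (p ≡ 2 → + 8 ∣ˢ D) → (p ≡ 3 → + 9 ∣ˢ D) → ¬ + p *ᶻ + p ∣ˢ U P Q p
    p²∤U[p] 8∣D 9∣D p²∣U with p ℕ.≟ 2
    -- Here `U₂ = P`: from `4 ∣ P` and `8 ∣ D` the number `4Q = P² - D` is divisible by 8, so `Q` is
    -- even.
    ... | yes refl = p∤Q (two (8∣D refl) (subst (+ 4 ∣ˢ_) (identity P Q) p²∣U))
      where
      identity : ∀ P Q → P *ᶻ 1ℤ -ᶻ Q *ᶻ 0ℤ ≡ P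
      identity = solve-∀
      two : + 8 ∣ˢ D → + 4 ∣ˢ P → + 2 ∣ˢ Q
      two (dividesˢ r D≡r8) (dividesˢ q P≡q4) = dividesˢ (+ 2 *ᶻ (q *ᶻ q) -ᶻ r) (ℤ.*-cancelˡ-≡ (+ 4) Q _ (begin
        + 4 *ᶻ Q                                        ≡⟨ isolate P Q ⟩
        P *ᶻ P -ᶻ D                                     ≡⟨ cong₂ (λ x y → x *ᶻ x -ᶻ y) P≡q4 D≡r8 ⟩
        q *ᶻ + 4 *ᶻ (q *ᶻ + 4) -ᶻ r *ᶻ + 8              ≡⟨ collect q r ⟩
        + 4 *ᶻ ((+ 2 *ᶻ (q *ᶻ q) -ᶻ r) *ᶻ + 2) ∎))
        where
        open ≡-Reasoning
        isolate : ∀ P Q → + 4 *ᶻ Q ≡ P *ᶻ P -ᶻ (P *ᶻ (P *ᶻ 1ℤ) -ᶻ + 4 *ᶻ Q)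
        isolate = solve-∀
        collect : ∀ q r → q *ᶻ + 4 *ᶻ (q *ᶻ + 4) -ᶻ r *ᶻ + 8 ≡ + 4 *ᶻ ((+ 2 *ᶻ (q *ᶻ q) -ᶻ r) *ᶻ + 2)
        collect = solve-∀
    ... | no p≢2 with p ℕ.≟ 3
    -- Here `U₃ = P² - Q = D + 3Q`: if 9 divides `U₃` and `D`, then 3 divides `Q`.
    ... | yes refl = p∤Q (three (9∣D refl) p²∣U)
      where
      three : + 9 ∣ˢ D → + 9 ∣ˢ U P Q 3 → + 3 ∣ˢ Q
      three (dividesˢ r D≡r9) (dividesˢ q U≡q9) = dividesˢ (q -ᶻ r) (ℤ.*-cancelˡ-≡ (+ 3) Q _ (begin
        + 3 *ᶻ Q                       ≡⟨ isolate P Q ⟩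
        U P Q 3 -ᶻ D                   ≡⟨ cong₂ _-ᶻ_ U≡q9 D≡r9 ⟩
        q *ᶻ + 9 -ᶻ r *ᶻ + 9           ≡⟨ collect q r ⟩
        + 3 *ᶻ ((q -ᶻ r) *ᶻ + 3)       ∎))
        where
        open ≡-Reasoning
        isolate : ∀ P Q → + 3 *ᶻ Q ≡ P *ᶻ (P *ᶻ 1ℤ -ᶻ Q *ᶻ 0ℤ) -ᶻ Q *ᶻ 1ℤ -ᶻ (P *ᶻ (P *ᶻ 1ℤ) -ᶻ + 4 *ᶻ Q)
        isolate = solve-∀
        collect : ∀ q r → q *ᶻ + 9 -ᶻ r *ᶻ + 9 ≡ + 3 *ᶻ ((q -ᶻ r) *ᶻ + 3)
        collect = solve-∀
    ... | no p≢3 = large (U-mod-D² P Q p) (p²∣U , p∣D)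
      where
      open ≡-Reasoning
      π = + p
      e = P ^ᶻ p
      large : ∃[ k ] + 6 *ᶻ (P *ᶻ P *ᶻ P) *ᶻ ((+ 2) ^ᶻ p *ᶻ U P Q p)
          ≡ + 12 *ᶻ π *ᶻ (P *ᶻ P *ᶻ e) +ᶻ + 2 *ᶻ (π *ᶻ (π -ᶻ 1ℤ) *ᶻ (π -ᶻ + 2)) *ᶻ (D *ᶻ e) +ᶻ D *ᶻ D *ᶻ k →
        ¬ (π *ᶻ π ∣ˢ U P Q p × π ∣ˢ D)
      large (k , eq) (dividesˢ q U≡qπ² , dividesˢ r D≡rπ) = p∤12P²e (dividesˢ s
        (ℤ.*-cancelˡ-≡ π (+ 12 *ᶻ (P *ᶻ P *ᶻ e)) (s *ᶻ π) (begin
          π *ᶻ (+ 12 *ᶻ (P *ᶻ P *ᶻ e))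
            ≡⟨ isolate π (P *ᶻ P *ᶻ e) (D *ᶻ e) (D *ᶻ D *ᶻ k) ⟩
          (+ 12 *ᶻ π *ᶻ (P *ᶻ P *ᶻ e) +ᶻ + 2 *ᶻ (π *ᶻ (π -ᶻ 1ℤ) *ᶻ (π -ᶻ + 2)) *ᶻ (D *ᶻ e) +ᶻ D *ᶻ D *ᶻ k)
            -ᶻ (+ 2 *ᶻ (π *ᶻ (π -ᶻ 1ℤ) *ᶻ (π -ᶻ + 2)) *ᶻ (D *ᶻ e) +ᶻ D *ᶻ D *ᶻ k)
            ≡⟨ cong (_-ᶻ (+ 2 *ᶻ (π *ᶻ (π -ᶻ 1ℤ) *ᶻ (π -ᶻ + 2)) *ᶻ (D *ᶻ e) +ᶻ D *ᶻ D *ᶻ k)) eq ⟨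
          + 6 *ᶻ (P *ᶻ P *ᶻ P) *ᶻ (w *ᶻ U P Q p)
            -ᶻ (+ 2 *ᶻ (π *ᶻ (π -ᶻ 1ℤ) *ᶻ (π -ᶻ + 2)) *ᶻ (D *ᶻ e) +ᶻ D *ᶻ D *ᶻ k)
            ≡⟨ cong₂ (λ u d → + 6 *ᶻ (P *ᶻ P *ᶻ P) *ᶻ (w *ᶻ u)
                 -ᶻ (+ 2 *ᶻ (π *ᶻ (π -ᶻ 1ℤ) *ᶻ (π -ᶻ + 2)) *ᶻ (d *ᶻ e) +ᶻ d *ᶻ d *ᶻ k)) U≡qπ² D≡rπ ⟩
          + 6 *ᶻ (P *ᶻ P *ᶻ P) *ᶻ (w *ᶻ (q *ᶻ (π *ᶻ π)))
            -ᶻ (+ 2 *ᶻ (π *ᶻ (π -ᶻ 1ℤ) *ᶻ (π -ᶻ + 2)) *ᶻ (r *ᶻ π *ᶻ e) +ᶻ r *ᶻ π *ᶻ (r *ᶻ π) *ᶻ k)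
            ≡⟨ collect P π w q r e k ⟩
          π *ᶻ (s *ᶻ π) ∎)))
        where
        w = (+ 2) ^ᶻ p
        -- What is left of the other terms after division by `π²`: one `π` belongs to the term
        -- `12 π P² e`, and the second would have to divide `12 P² e`.
        s = + 6 *ᶻ (P *ᶻ P *ᶻ P) *ᶻ w *ᶻ q -ᶻ (+ 2 *ᶻ (π -ᶻ 1ℤ) *ᶻ (π -ᶻ + 2) *ᶻ (r *ᶻ e) +ᶻ r *ᶻ r *ᶻ k)
        p∤2 = odd⇒∤2 p≢2
        p∤P = odd⇒∤P p≢2
        p∤12P²e : ¬ π ∣ˢ + 12 *ᶻ (P *ᶻ P *ᶻ e)
        p∤12P²e = prime-∤-* {+ 12}
          (prime-∤-* {+ 4} {+ 3} (prime-∤-* {+ 2} {+ 2} p∤2 p∤2) (prime-∤-prime (from-yes (prime? 3)) p≢3))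
          (prime-∤-* {P *ᶻ P} (prime-∤-* p∤P p∤P) (prime-∤-^ p p∤P))
        isolate : ∀ π x y z → π *ᶻ (+ 12 *ᶻ x) ≡
          (+ 12 *ᶻ π *ᶻ x +ᶻ + 2 *ᶻ (π *ᶻ (π -ᶻ 1ℤ) *ᶻ (π -ᶻ + 2)) *ᶻ y +ᶻ z)
            -ᶻ (+ 2 *ᶻ (π *ᶻ (π -ᶻ 1ℤ) *ᶻ (π -ᶻ + 2)) *ᶻ y +ᶻ z)
        isolate = solve-∀
        collect : ∀ P π w q r e k →
          + 6 *ᶻ (P *ᶻ P *ᶻ P) *ᶻ (w *ᶻ (q *ᶻ (π *ᶻ π)))
            -ᶻ (+ 2 *ᶻ (π *ᶻ (π -ᶻ 1ℤ) *ᶻ (π -ᶻ + 2)) *ᶻ (r *ᶻ π *ᶻ e) +ᶻ r *ᶻ π *ᶻ (r *ᶻ π) *ᶻ k)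
          ≡ π *ᶻ ((+ 6 *ᶻ (P *ᶻ P *ᶻ P) *ᶻ w *ᶻ q -ᶻ (+ 2 *ᶻ (π -ᶻ 1ℤ) *ᶻ (π -ᶻ + 2) *ᶻ (r *ᶻ e) +ᶻ r *ᶻ r *ᶻ k)) *ᶻ π)
        collect = solve-∀

    vℤ-U[p]≡1 : (p ≡ 2 → + 8 ∣ˢ D) → (p ≡ 3 → + 9 ∣ˢ D) → vℤ p (U P Q p) ≡ 1
    vℤ-U[p]≡1 8∣D 9∣D = vℤ-exact p∣U[p] (p²∤U[p] 8∣D 9∣D)

module _ {p : ℕ} (p-prime : Prime p) where

  private
    instance
      p≢0 : NonZero p
      p≢0 = prime⇒nonZero p-prime

  1≤p : 1 ≤ p
  1≤p = >-nonZero⁻¹ p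

  vℤ-U-stride : ∀ P Q z m → NonVanishing (U P Q) → 1 ≤ z → 1 ≤ m →
    vℤ p (U P Q (m * z)) ≡ vℤ p (U P Q z) + vℤ p (U (V P Q z) (Q ^ᶻ z) m)
  vℤ-U-stride P Q z m U≢0 1≤z 1≤m = trans (cong (vℤ p) (U-* P Q m z))
    (vℤ-* p-prime (U≢0 z 1≤z) (U-stride-nonVanishing P Q z 1≤z U≢0 m 1≤m))

  -- Each factor `p` of the index is removed by passing to the parameters `V_p`, `Q^p`, at the cost
  -- of `v_p(U_p) = 1`. The hypothesis `p³ ∣ D` survives, as `D` is multiplied by `U_p²`. The
  -- parameters are quantified inside the induction because they change at every step.
  vℤ-U≡v : ∀ m .{{_ : NonZero m}} P Q → + p *ᶻ (+ p *ᶻ + p) ∣ˢ discriminant P Q → ¬ + p ∣ˢ Q →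
    NonVanishing (U P Q) → vℤ p (U P Q m) ≡ v p m
  vℤ-U≡v = <-rec _ step
    where
    step : ∀ m → (∀ {m′} → m′ < m → .{{_ : NonZero m′}} → ∀ P Q → + p *ᶻ (+ p *ᶻ + p) ∣ˢ discriminant P Q →
      ¬ + p ∣ˢ Q → NonVanishing (U P Q) → vℤ p (U P Q m′) ≡ v p m′) →
      .{{_ : NonZero m}} → ∀ P Q → + p *ᶻ (+ p *ᶻ + p) ∣ˢ discriminant P Q → ¬ + p ∣ˢ Q →
      NonVanishing (U P Q) → vℤ p (U P Q m) ≡ v p m
    step m rec P Q p³∣D p∤Q U≢0 with p ∣? m
    ... | no p∤m = trans (vℤ-∤ p-prime (U-∤ p-prime P Q (∣-trans (∣m⇒∣m*n (+ p *ᶻ + p) ∣-refl) p³∣D) p∤Q m p∤m))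
                         (sym (v-∤ p-prime p∤m))
    ... | yes (divides m′ refl) = begin
      vℤ p (U P Q (m′ * p))
        ≡⟨ vℤ-U-stride P Q p m′ U≢0 1≤p (>-nonZero⁻¹ m′) ⟩
      vℤ p (U P Q p) + vℤ p (U (V P Q p) (Q ^ᶻ p) m′)
        ≡⟨ cong₂ _+_
             -- For `p = 2` the cube is 8 itself; for `p = 3` it is 27 = 3 · 9.
             (vℤ-U[p]≡1 p-prime P Q p∣D p∤Q (λ { refl → p³∣D }) (λ { refl → ∣-trans (dividesˢ (+ 3) refl) p³∣D }))
             (rec (ℕ.m<m*n m′ p (1<p p-prime)) (V P Q p) (Q ^ᶻ p)
               (subst (+ p *ᶻ (+ p *ᶻ + p) ∣ˢ_) (sym (discriminant-V P Q p)) (∣m⇒∣m*n _ p³∣D))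
               (prime-∤-^ p-prime p p∤Q) (U-stride-nonVanishing P Q p 1≤p U≢0)) ⟩
      1 + v p m′
        ≡⟨ trans (v-* p-prime m′ p) (trans (cong (λ x → v p m′ + x) (v-p p-prime)) (ℕ.+-comm (v p m′) 1)) ⟨
      v p (m′ * p) ∎
      where
      open ≡-Reasoning
      p∣D : + p ∣ˢ discriminant P Q
      p∣D = ∣-trans (∣m⇒∣m*n (+ p *ᶻ + p) ∣-refl) p³∣D
      instance
        m′≢0 : NonZero m′
        m′≢0 = ℕ.m*n≢0⇒m≢0 m′ {p}

  module _ (P Q : ℤ) (p∣D : + p ∣ˢ discriminant P Q) (p∤Q : ¬ + p ∣ˢ Q) (U≢0 : NonVanishing (U P Q)) where

    vℤ-U-∤ : ∀ m → ¬ p ∣ m → vℤ p (U P Q m) ≡ 0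
    vℤ-U-∤ m p∤m = vℤ-∤ p-prime (U-∤ p-prime P Q p∣D p∤Q m p∤m)

    -- Passing from U to the subsequence U_{pm} / U_p multiplies D by U_p², so p³ ∣ D from there on.
    vℤ-U-∣ : ∀ m → 1 ≤ m → vℤ p (U P Q (m * p)) ≡ vℤ p (U P Q p) + v p m
    vℤ-U-∣ m 1≤m = trans (vℤ-U-stride P Q p m U≢0 1≤p 1≤m) (cong (λ x → vℤ p (U P Q p) + x)
      (vℤ-U≡v m {{>-nonZero 1≤m}} (V P Q p) (Q ^ᶻ p)
        (subst (+ p *ᶻ (+ p *ᶻ + p) ∣ˢ_) (sym (discriminant-V P Q p)) (p³∣ p∣D (p∣U[p] p-prime P Q p∣D p∤Q)))
        (prime-∤-^ p-prime p p∤Q) (U-stride-nonVanishing P Q p 1≤p U≢0)))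
      where
      p³∣ : ∀ {i j} → + p ∣ˢ i → + p ∣ˢ j → + p *ᶻ (+ p *ᶻ + p) ∣ˢ i *ᶻ (j *ᶻ j)
      p³∣ (dividesˢ a refl) (dividesˢ b refl) = dividesˢ (a *ᶻ (b *ᶻ b)) (identity a b (+ p))
        where
        identity : ∀ a b c → a *ᶻ c *ᶻ (b *ᶻ c *ᶻ (b *ᶻ c)) ≡ a *ᶻ (b *ᶻ b) *ᶻ (c *ᶻ (c *ᶻ c))
        identity = solve-∀

  -- The rank of apparition of a prime not dividing `Q`

  module _ (P Q : ℤ) (p∤Q : ¬ + p ∣ˢ Q) where

    private
      cancel : ∀ x y → x -ᶻ (x -ᶻ y) ≡ y
      cancel = solve-∀

    -- As `p ∤ Q`, two consecutive multiples of `p` would make the preceding term one as well, down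
    -- to `U₁ = 1`.
    consecutive-∤ : ∀ n → + p ∣ˢ U P Q n → ¬ + p ∣ˢ U P Q (suc n)
    consecutive-∤ zero    _    = prime-∤1 p-prime
    consecutive-∤ (suc n) p∣U₁ p∣U₂ = case prime-∣-* p-prime Q (U P Q n) (subst (+ p ∣ˢ_)
        (cancel (P *ᶻ U P Q (suc n)) (Q *ᶻ U P Q n)) (∣m∣n⇒∣m-n (∣n⇒∣m*n P p∣U₁) p∣U₂)) of λ where
      (inj₁ p∣Q)  → p∤Q p∣Q
      (inj₂ p∣U₀) → consecutive-∤ n p∣U₀ p∣U₁

    private
      residue : ℕ → Fin p
      residue n = fromℕ< (n%ℕd<d (U P Q n) p)

      residue-≡ : ∀ m n → residue m ≡ residue n → + p ∣ˢ U P Q n -ᶻ U P Q m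
      residue-≡ m n eq = dividesˢ (U P Q n /ℕ p -ᶻ U P Q m /ℕ p) (begin
        U P Q n -ᶻ U P Q m
          ≡⟨ cong₂ _-ᶻ_ (a≡a%ℕn+[a/ℕn]*n (U P Q n) p) (a≡a%ℕn+[a/ℕn]*n (U P Q m) p) ⟩
        + (U P Q n %ℕ p) +ᶻ U P Q n /ℕ p *ᶻ + p -ᶻ (+ (U P Q m %ℕ p) +ᶻ U P Q m /ℕ p *ᶻ + p)
          ≡⟨ cong (λ r → + (U P Q n %ℕ p) +ᶻ U P Q n /ℕ p *ᶻ + p -ᶻ (+ r +ᶻ U P Q m /ℕ p *ᶻ + p))
               (trans (sym (Fin.toℕ-fromℕ< (n%ℕd<d (U P Q m) p))) (trans (cong toℕ eq) (Fin.toℕ-fromℕ< (n%ℕd<d (U P Q n) p)))) ⟩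
        + (U P Q n %ℕ p) +ᶻ U P Q n /ℕ p *ᶻ + p -ᶻ (+ (U P Q n %ℕ p) +ᶻ U P Q m /ℕ p *ᶻ + p)
          ≡⟨ identity (+ (U P Q n %ℕ p)) (U P Q n /ℕ p) (U P Q m /ℕ p) (+ p) ⟩
        (U P Q n /ℕ p -ᶻ U P Q m /ℕ p) *ᶻ + p ∎)
        where
        open ≡-Reasoning
        identity : ∀ r a b c → r +ᶻ a *ᶻ c -ᶻ (r +ᶻ b *ᶻ c) ≡ (a -ᶻ b) *ᶻ c
        identity = solve-∀

      -- Q is invertible modulo p, so the recurrence can be run backwards.
      rewind : ∀ i d → + p ∣ˢ U P Q (i + d) -ᶻ U P Q i → + p ∣ˢ U P Q (suc i + d) -ᶻ U P Q (suc i) → + p ∣ˢ U P Q d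
      rewind zero    d p∣Δ₀ _    = subst (+ p ∣ˢ_) (ℤ.+-identityʳ (U P Q d)) p∣Δ₀
      rewind (suc i) d p∣Δ₁ p∣Δ₂ = rewind i d p∣Δ₀ p∣Δ₁
        where
        identity : ∀ P Q a₀ a₁ b₀ b₁ → P *ᶻ (a₁ -ᶻ b₁) -ᶻ (P *ᶻ a₁ -ᶻ Q *ᶻ a₀ -ᶻ (P *ᶻ b₁ -ᶻ Q *ᶻ b₀)) ≡ Q *ᶻ (a₀ -ᶻ b₀)
        identity = solve-∀
        p∣Δ₀ : + p ∣ˢ U P Q (i + d) -ᶻ U P Q i
        p∣Δ₀ = case prime-∣-* p-prime Q (U P Q (i + d) -ᶻ U P Q i) (subst (+ p ∣ˢ_)
            (identity P Q (U P Q (i + d)) (U P Q (suc i + d)) (U P Q i) (U P Q (suc i)))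
            (∣m∣n⇒∣m-n (∣n⇒∣m*n P p∣Δ₁) p∣Δ₂)) of λ where
          (inj₁ p∣Q) → contradiction p∣Q p∤Q
          (inj₂ d)   → d

    -- Among `p² + 1` pairs of consecutive residues two agree, at `i < j` say. Running the
    -- recurrence back from `i` to 0 gives `U_{j-i} ≡ U_0 = 0` modulo `p`.
    apparition : ∃[ n ] (1 ≤ n × + p ∣ˢ U P Q n)
    apparition with Fin.pigeonhole (ℕ.n<1+n (p * p)) (λ i → combine (residue (toℕ i)) (residue (suc (toℕ i))))
    ... | i , j , i<j , eq with Fin.combine-injective (residue (toℕ i)) (residue (suc (toℕ i))) (residue (toℕ j)) (residue (suc (toℕ j))) eq
    ... | eq₀ , eq₁ = toℕ j ∸ toℕ i , ℕ.m<n⇒0<n∸m i<j , rewind (toℕ i) (toℕ j ∸ toℕ i)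
      (subst (λ k → + p ∣ˢ U P Q k -ᶻ U P Q (toℕ i)) i+d≡j (residue-≡ (toℕ i) (toℕ j) eq₀))
      (subst (λ k → + p ∣ˢ U P Q (suc k) -ᶻ U P Q (suc (toℕ i))) i+d≡j (residue-≡ (suc (toℕ i)) (suc (toℕ j)) eq₁))
      where
      i+d≡j : toℕ j ≡ toℕ i + (toℕ j ∸ toℕ i)
      i+d≡j = sym (ℕ.m+[n∸m]≡n (ℕ.<⇒≤ i<j))

    entryPoint : ∃[ z ] IsEntryPoint P Q p z
    entryPoint with apparition
    ... | n , 1≤n , p∣U with least (λ m → 1 ℕ.≤? m ×-dec + p ∣?ˢ U P Q m) n (1≤n , p∣U)
    ... | z , (1≤z , p∣Uz) , z-least = z , 1≤z , ∣⇒∣ᵤ p∣Uz , λ m 1≤m p∣Um → z-least m (1≤m , ∣ᵤ⇒∣ p∣Um)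

    -- Write `n = r + kz` with `0 < r < z`. Modulo `p` the addition formula reduces to
    -- `U_n ≡ U_r U_{kz+1}`, because `p ∣ U_{kz}`, and `U_{kz+1}` is prime to `p`. So `p ∣ U_n`
    -- would give `p ∣ U_r`, against the minimality of `z`.
    entryPoint-∤ : ∀ {z} → IsEntryPoint P Q p z → ∀ n → ¬ z ∣ n → ¬ + p ∣ˢ U P Q n
    entryPoint-∤ {z} (1≤z , p∣Uz , z-least) n z∤n p∣Un =
      ℕ.<⇒≱ (m%n<n n z) (z-least r 1≤r (∣⇒∣ᵤ p∣Ur))
      where
      instance
        z≢0 : NonZero z
        z≢0 = >-nonZero 1≤z
      r = n % z
      kz = n / z * z
      1≤r : 1 ≤ r
      1≤r = ℕ.n≢0⇒n>0 (λ r≡0 → z∤n (ℕ.m%n≡0⇒n∣m n z r≡0))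
      p∣Ukz : + p ∣ˢ U P Q kz
      p∣Ukz = subst (+ p ∣ˢ_) (sym (U-* P Q (n / z) z)) (∣m⇒∣m*n (U (V P Q z) (Q ^ᶻ z) (n / z)) (∣ᵤ⇒∣ {+ p} {U P Q z} p∣Uz))
      p∣Ur : + p ∣ˢ U P Q r
      p∣Ur = case prime-∣-* p-prime (U P Q r) (U P Q (suc kz) -ᶻ P *ᶻ U P Q kz)
          (∣m+n∣m⇒∣n (subst (+ p ∣ˢ_) (trans (cong (U P Q) (m≡m%n+[m/n]*n n z)) (U-+ P Q r kz)) p∣Un)
            (∣n⇒∣m*n (U P Q (suc r)) p∣Ukz)) of λ where
          (inj₁ p∣Ur) → p∣Ur
          (inj₂ p∣Δ)  → contradiction
            (subst (+ p ∣ˢ_) (restore (U P Q (suc kz)) (P *ᶻ U P Q kz)) (∣m∣n⇒∣m+n p∣Δ (∣n⇒∣m*n P p∣Ukz)))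
            (consecutive-∤ kz p∣Ukz)
        where
        restore : ∀ x y → x -ᶻ y +ᶻ y ≡ x
        restore = solve-∀

  -- Modulo `p` the recurrence is `U_{n+2} ≡ P U_{n+1}`, so the terms are powers of `P`.
  U-∤-of-∣Q : ∀ P Q → + p ∣ˢ Q → ¬ + p ∣ˢ P → ∀ n → ¬ + p ∣ˢ U P Q (suc n)
  U-∤-of-∣Q P Q p∣Q p∤P zero    = prime-∤1 p-prime
  U-∤-of-∣Q P Q p∣Q p∤P (suc n) p∣U = prime-∤-* p-prime p∤P (U-∤-of-∣Q P Q p∣Q p∤P n)
    (subst (+ p ∣ˢ_) (restore (P *ᶻ U P Q (suc n)) (Q *ᶻ U P Q n)) (∣m∣n⇒∣m+n p∣U (∣m⇒∣m*n (U P Q n) p∣Q)))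
    where
    restore : ∀ x y → x -ᶻ y +ᶻ y ≡ x
    restore = solve-∀

-- p ∣ gcd(P, Q)

module _ {p : ℕ} (p-prime : Prime p) where

  private
    instance
      p≢0 : NonZero p
      p≢0 = prime⇒nonZero p-prime

    p^≢0 : ∀ k → + (p ^ k) ≢ 0ℤ
    p^≢0 k = ≢-nonZero⁻¹ (p ^ k) {{ℕ.m^n≢0 p k}} ∘ ℤ.+-injective

  vℤ-p^ : ∀ k → vℤ p (+ (p ^ k)) ≡ k
  vℤ-p^ k = trans (cong (v p) (sym (ℕ.*-identityʳ (p ^ k)))) (v-p^k*m p-prime k 1 (p∤1 p-prime))

  ^-≢0 : ∀ {i} n → i ≢ 0ℤ → i ^ᶻ n ≢ 0ℤ
  ^-≢0 zero    i≢0 = λ ()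
  ^-≢0 (suc n) i≢0 = *-≢0 p-prime i≢0 (^-≢0 n i≢0)

  vℤ-^ : ∀ {i} n → i ≢ 0ℤ → vℤ p (i ^ᶻ n) ≡ n * vℤ p i
  vℤ-^ zero    i≢0 = vℤ-∤ p-prime (prime-∤1 p-prime)
  vℤ-^ {i} (suc n) i≢0 = trans (vℤ-* p-prime i≢0 (^-≢0 n i≢0)) (cong (λ x → vℤ p i + x) (vℤ-^ n i≢0))

  vℤ-p^^-* : ∀ k n {i} → i ≢ 0ℤ → vℤ p ((+ (p ^ k)) ^ᶻ n *ᶻ i) ≡ n * k + vℤ p i
  vℤ-p^^-* k n {i} i≢0 = trans (vℤ-* p-prime (^-≢0 n (p^≢0 k)) i≢0)
    (cong (_+ vℤ p i) (trans (vℤ-^ n (p^≢0 k)) (cong (n *_) (vℤ-p^ k))))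

  -- The division is Euclidean: its remainder is a multiple of `p ^ k` below `p ^ k`, hence 0.
  /^-spec : ∀ k i → p ^ k ∣ ∣ i ∣ → i ≡ + (p ^ k) *ᶻ _/^_ p-prime i k
  /^-spec k i d = begin
    i                              ≡⟨ a≡a%ℕn+[a/ℕn]*n i (p ^ k) ⟩
    + (i %ℕ p ^ k) +ᶻ q *ᶻ + (p ^ k) ≡⟨ cong (λ r → + r +ᶻ q *ᶻ + (p ^ k)) r≡0 ⟩
    0ℤ +ᶻ q *ᶻ + (p ^ k)           ≡⟨ trans (ℤ.+-identityˡ _) (ℤ.*-comm q (+ (p ^ k))) ⟩
    + (p ^ k) *ᶻ q                 ∎
    where
    open ≡-Reasoning
    instance
      p^k≢0 : NonZero (p ^ k)
      p^k≢0 = ℕ.m^n≢0 p k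
    q = i /ℕ p ^ k
    cancel : ∀ x y → x +ᶻ y -ᶻ y ≡ x
    cancel = solve-∀
    p^k∣r : p ^ k ∣ i %ℕ p ^ k
    p^k∣r = ∣⇒∣ᵤ (subst (+ (p ^ k) ∣ˢ_)
      (trans (cong (_-ᶻ q *ᶻ + (p ^ k)) (a≡a%ℕn+[a/ℕn]*n i (p ^ k))) (cancel (+ (i %ℕ p ^ k)) (q *ᶻ + (p ^ k))))
      (∣m∣n⇒∣m-n (∣ᵤ⇒∣ {+ (p ^ k)} {i} d) (∣n⇒∣m*n q ∣-refl)))
    r≡0 : i %ℕ p ^ k ≡ 0
    r≡0 with i %ℕ p ^ k | n%ℕd<d i (p ^ k) | p^k∣r
    ... | zero  | _   | _ = refl
    ... | suc r | r<d | d = contradiction d (ℕ.>⇒∤ r<d)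

  ∂-spec : ∀ {i} → i ≢ 0ℤ → i ≡ + (p ^ vℤ p i) *ᶻ ∂ p-prime i × ¬ + p ∣ˢ ∂ p-prime i
  ∂-spec {i} i≢0 with v-spec p-prime ∣ i ∣ {{∣∣-nonZero p-prime i≢0}}
  ... | m , ∣i∣≡p^v*m , p∤m = i≡p^v*∂ , λ p∣∂ → p∤m (subst (p ∣_) ∣∂∣≡m (∣⇒∣ᵤ p∣∂))
    where
    i≡p^v*∂ : i ≡ + (p ^ vℤ p i) *ᶻ ∂ p-prime i
    i≡p^v*∂ = /^-spec (vℤ p i) i (divides m (trans ∣i∣≡p^v*m (ℕ.*-comm (p ^ vℤ p i) m)))
    ∣∂∣≡m : ∣ ∂ p-prime i ∣ ≡ m
    ∣∂∣≡m = ℕ.*-cancelˡ-≡ ∣ ∂ p-prime i ∣ m (p ^ vℤ p i) {{ℕ.m^n≢0 p (vℤ p i)}}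
      (trans (sym (ℤ.abs-* (+ (p ^ vℤ p i)) (∂ p-prime i))) (trans (cong ∣_∣ (sym i≡p^v*∂)) ∣i∣≡p^v*m))

  +p^-+ : ∀ j k → + (p ^ (j + k)) ≡ + (p ^ j) *ᶻ + (p ^ k)
  +p^-+ j k = trans (cong +_ (ℕ.^-distribˡ-+-* p j k)) (ℤ.pos-* (p ^ j) (p ^ k))

  -- The case `2 v_p(P) ≤ v_p(Q)`

  module LargeQ (P Q : ℤ) (P≢0 : P ≢ 0ℤ) (Q≢0 : Q ≢ 0ℤ) (U≢0 : NonVanishing (U P Q)) (2a≤b : 2 * vℤ p P ≤ vℤ p Q) where

    private
      a = vℤ p P

    U≡p^*U⁽ᵖ⁾ : ∀ n → U P Q (suc n) ≡ (+ (p ^ a)) ^ᶻ n *ᶻ U⁽ᵖ⁾ p-prime P Q (suc n)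
    U≡p^*U⁽ᵖ⁾ n = trans (cong₂ (λ x y → U x y (suc n)) (proj₁ (∂-spec P≢0)) Q≡) (U-scale (+ (p ^ a)) (∂ p-prime P) Q₁ n)
      where
      Q₁ = _/^_ p-prime Q (2 * a)
      p^2a∣Q : p ^ (2 * a) ∣ ∣ Q ∣
      p^2a∣Q = case v-spec p-prime ∣ Q ∣ {{∣∣-nonZero p-prime Q≢0}} of λ where
        (m , ∣Q∣≡ , _) → subst (p ^ (2 * a) ∣_) (sym ∣Q∣≡) (p^∣⇐≤ p-prime m 2a≤b)
      Q≡ : Q ≡ + (p ^ a) *ᶻ + (p ^ a) *ᶻ Q₁
      Q≡ = trans (/^-spec (2 * a) Q p^2a∣Q) (cong (_*ᶻ Q₁)
        (trans (cong (λ k → + (p ^ (a + k))) (ℕ.+-identityʳ a)) (+p^-+ a a)))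

    U⁽ᵖ⁾-nonVanishing : NonVanishing (U⁽ᵖ⁾ p-prime P Q)
    U⁽ᵖ⁾-nonVanishing (suc n) 1≤n eq = U≢0 (suc n) 1≤n
      (trans (U≡p^*U⁽ᵖ⁾ n) (trans (cong ((+ (p ^ a)) ^ᶻ n *ᶻ_) eq) (ℤ.*-zeroʳ ((+ (p ^ a)) ^ᶻ n))))

    -- The exponent `n - 1` is spelled as a combination of `n` and the constant 1, ready for the
    -- linearity of the transform. The constant produces the `⟦ n ≟ 1 ⟧` that sets `n = 1` apart.
    vℤ-U : ∀ n → 1 ≤ n → + vℤ p (U P Q n) ≡ + a *ᶻ (+ n +ᶻ -1ℤ *ᶻ 1ℤ) +ᶻ + vℤ p (U⁽ᵖ⁾ p-prime P Q n)
    vℤ-U (suc n) 1≤n = begin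
      + vℤ p (U P Q (suc n))
        ≡⟨ cong (λ x → + vℤ p x) (U≡p^*U⁽ᵖ⁾ n) ⟩
      + vℤ p ((+ (p ^ a)) ^ᶻ n *ᶻ U⁽ᵖ⁾ p-prime P Q (suc n))
        ≡⟨ cong +_ (vℤ-p^^-* a n (U⁽ᵖ⁾-nonVanishing (suc n) 1≤n)) ⟩
      + (n * a) +ᶻ + w
        ≡⟨ cong (_+ᶻ + w) (trans (ℤ.pos-* n a) (identity (+ n) (+ a))) ⟩
      + a *ᶻ (+ suc n +ᶻ -1ℤ *ᶻ 1ℤ) +ᶻ + w ∎
      where
      open ≡-Reasoning
      w = vℤ p (U⁽ᵖ⁾ p-prime P Q (suc n))
      identity : ∀ n a → n *ᶻ a ≡ a *ᶻ ((1ℤ +ᶻ n) +ᶻ -1ℤ *ᶻ 1ℤ)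
      identity = solve-∀

    möbiusSum-vℤ-U : ∀ n .{{_ : NonZero n}} → möbiusSum (λ d → + vℤ p (U P Q d)) n
      ≡ + a *ᶻ (+ φ n +ᶻ -1ℤ *ᶻ ⟦ n ℕ.≟ 1 ⟧) +ᶻ möbiusSum (λ d → + vℤ p (U⁽ᵖ⁾ p-prime P Q d)) n
    möbiusSum-vℤ-U n = begin
      möbiusSum (λ d → + vℤ p (U P Q d)) n
        ≡⟨ möbiusSum-cong n (λ d 1≤d _ → vℤ-U d 1≤d) ⟩
      möbiusSum (λ d → + a *ᶻ (+ d +ᶻ -1ℤ *ᶻ 1ℤ) +ᶻ w d) n
        ≡⟨ möbiusSum-+ n (λ d → + a *ᶻ (+ d +ᶻ -1ℤ *ᶻ 1ℤ)) w ⟩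
      möbiusSum (λ d → + a *ᶻ (+ d +ᶻ -1ℤ *ᶻ 1ℤ)) n +ᶻ möbiusSum w n
        ≡⟨ cong (_+ᶻ möbiusSum w n) (trans (möbiusSum-*ˡ n (+ a) (λ d → + d +ᶻ -1ℤ *ᶻ 1ℤ)) (cong (+ a *ᶻ_)
             (trans (möbiusSum-+ n (λ d → + d) (λ _ → -1ℤ *ᶻ 1ℤ))
               (cong₂ _+ᶻ_ (möbiusSum-id n) (trans (möbiusSum-*ˡ n -1ℤ (λ _ → 1ℤ)) (cong (-1ℤ *ᶻ_) (möbiusSum-one n))))))) ⟩
      + a *ᶻ (+ φ n +ᶻ -1ℤ *ᶻ ⟦ n ℕ.≟ 1 ⟧) +ᶻ möbiusSum w n ∎
      where
      open ≡-Reasoning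
      w : ℕ → ℤ
      w d = + vℤ p (U⁽ᵖ⁾ p-prime P Q d)

-- With 2 v(P) > v(Q) = b, the terms of odd index are dominated by their last
-- summand ± Q^((n-1)/2). Those of even index come from U(V₂, Q²), which after
-- division by powers of p^b becomes a sequence whose discriminant p divides.
module SmallQ {p : ℕ} (p-prime : Prime p) (P Q : ℤ) (P≢0 : P ≢ 0ℤ) (Q≢0 : Q ≢ 0ℤ)
  (U≢0 : NonVanishing (U P Q)) (b<2a : vℤ p Q < 2 * vℤ p P) where

  private
    instance
      p≢0 : NonZero p
      p≢0 = prime⇒nonZero p-prime
    a = vℤ p P
    b = vℤ p Q
    π = + p
    q = + (p ^ b)
    -- The subtraction is exact because `b < 2a`. It leaves one explicit `π` in `P² = q π X`, and
    -- `c = 0` means `2a = b + 1`.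
    c = 2 * a ∸ suc b
    P° = ∂ p-prime P
    Q° = ∂ p-prime Q
    p∤P° = proj₂ (∂-spec p-prime P≢0)
    p∤Q° = proj₂ (∂-spec p-prime Q≢0)
    X = + (p ^ c) *ᶻ (P° *ᶻ P°)
    -- The parameters `V₂ = P² - 2Q` and `Q²` of the even-indexed subsequence, divided by `q` and
    -- `q²`.
    P″ = π *ᶻ X -ᶻ + 2 *ᶻ Q°
    Q″ = Q° *ᶻ Q°
    D″ = discriminant P″ Q″

    Q≡qQ° : Q ≡ q *ᶻ Q°
    Q≡qQ° = proj₁ (∂-spec p-prime Q≢0)

    P²≡qπX : P *ᶻ P ≡ q *ᶻ (π *ᶻ X)
    P²≡qπX = begin
      P *ᶻ P                          ≡⟨ cong₂ _*ᶻ_ (proj₁ (∂-spec p-prime P≢0)) (proj₁ (∂-spec p-prime P≢0)) ⟩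
      r *ᶻ P° *ᶻ (r *ᶻ P°)            ≡⟨ square r P° ⟩
      r *ᶻ r *ᶻ (P° *ᶻ P°)            ≡⟨ cong (_*ᶻ (P° *ᶻ P°)) (+p^-+ p-prime a a) ⟨
      + (p ^ (a + a)) *ᶻ (P° *ᶻ P°)   ≡⟨ cong (λ k → + (p ^ k) *ᶻ (P° *ᶻ P°)) a+a≡b+[1+c] ⟩
      + (p ^ (b + suc c)) *ᶻ (P° *ᶻ P°)
        ≡⟨ cong (_*ᶻ (P° *ᶻ P°)) (trans (+p^-+ p-prime b (suc c)) (cong (q *ᶻ_) (ℤ.pos-* p (p ^ c)))) ⟩
      q *ᶻ (π *ᶻ + (p ^ c)) *ᶻ (P° *ᶻ P°) ≡⟨ assoc q π (+ (p ^ c)) (P° *ᶻ P°) ⟩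
      q *ᶻ (π *ᶻ X)                   ∎
      where
      open ≡-Reasoning
      r = + (p ^ a)
      a+a≡b+[1+c] : a + a ≡ b + suc c
      a+a≡b+[1+c] = trans (cong (λ k → a + k) (sym (ℕ.+-identityʳ a)))
        (trans (sym (ℕ.m+[n∸m]≡n b<2a)) (sym (ℕ.+-suc b c)))
      square : ∀ r x → r *ᶻ x *ᶻ (r *ᶻ x) ≡ r *ᶻ r *ᶻ (x *ᶻ x)
      square = solve-∀
      assoc : ∀ q π r x → q *ᶻ (π *ᶻ r) *ᶻ x ≡ q *ᶻ (π *ᶻ (r *ᶻ x))
      assoc = solve-∀

    V₂≡qP″ : V P Q 2 ≡ q *ᶻ P″
    V₂≡qP″ = trans (cong₂ (λ x y → x -ᶻ y *ᶻ + 2) P²≡qπX Q≡qQ°) (factor q (π *ᶻ X) Q°)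
      where
      factor : ∀ q x y → q *ᶻ x -ᶻ q *ᶻ y *ᶻ + 2 ≡ q *ᶻ (x -ᶻ + 2 *ᶻ y)
      factor = solve-∀

    Q²≡q²Q″ : Q ^ᶻ 2 ≡ q *ᶻ q *ᶻ Q″
    Q²≡q²Q″ = trans (cong (_^ᶻ 2) Q≡qQ°) (square q Q°)
      where
      square : ∀ q y → q *ᶻ y *ᶻ (q *ᶻ y *ᶻ 1ℤ) ≡ q *ᶻ q *ᶻ (y *ᶻ y)
      square = solve-∀

    U-even : ∀ k → U P Q (suc k * 2) ≡ P *ᶻ (q ^ᶻ k *ᶻ U P″ Q″ (suc k))
    U-even k = trans (U-* P Q (suc k) 2) (cong₂ _*ᶻ_ (base P Q)
      (trans (cong₂ (λ x y → U x y (suc k)) V₂≡qP″ Q²≡q²Q″) (U-scale q P″ Q″ k)))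
      where
      base : ∀ P Q → P *ᶻ 1ℤ -ᶻ Q *ᶻ 0ℤ ≡ P
      base = solve-∀

    U″≢0 : NonVanishing (U P″ Q″)
    U″≢0 (suc k) _ eq = U≢0 (suc k * 2) (s≤s z≤n)
      (trans (U-even k) (trans (cong (λ x → P *ᶻ (q ^ᶻ k *ᶻ x)) eq)
        (trans (cong (P *ᶻ_) (ℤ.*-zeroʳ (q ^ᶻ k))) (ℤ.*-zeroʳ P))))

    q^≢0 : ∀ k → q ^ᶻ k ≢ 0ℤ
    q^≢0 k = ^-≢0 p-prime k (≢-nonZero⁻¹ (p ^ b) {{ℕ.m^n≢0 p b}} ∘ ℤ.+-injective)

    vℤ-U-even : ∀ k → vℤ p (U P Q (suc k * 2)) ≡ a + (k * b + vℤ p (U P″ Q″ (suc k)))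
    vℤ-U-even k = trans (cong (vℤ p) (U-even k))
      (trans (vℤ-* p-prime P≢0 (*-≢0 p-prime (q^≢0 k) (U″≢0 (suc k) (s≤s z≤n))))
        (cong (λ x → a + x) (vℤ-p^^-* p-prime b k (U″≢0 (suc k) (s≤s z≤n)))))

    -- The even terms are carried along multiplied by `P`: then only `P²` occurs, which contains
    -- `q π`. Modulo `p` the cofactor obeys `y′ ≡ -Q° y`, so it stays prime to `p`.
    U-odd : ∀ k → ∃[ y ] ∃[ t ] (U P Q (suc (k * 2)) ≡ q ^ᶻ k *ᶻ y × P *ᶻ U P Q (k * 2) ≡ q ^ᶻ k *ᶻ (π *ᶻ t) × ¬ π ∣ˢ y)
    U-odd zero = 1ℤ , 0ℤ , refl , trans (ℤ.*-zeroʳ P) (base π) , prime-∤1 p-prime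
      where
      base : ∀ π → 0ℤ ≡ 1ℤ *ᶻ (π *ᶻ 0ℤ)
      base = solve-∀
    U-odd (suc k) with U-odd k
    ... | y , t , odd , even , p∤y = π *ᶻ t′ -ᶻ Q° *ᶻ y , t′ , odd′ , even′ , p∤y′
      where
      open ≡-Reasoning
      t′ = X *ᶻ y -ᶻ Q° *ᶻ t
      e = q ^ᶻ k
      u₀ = U P Q (k * 2)
      u₁ = U P Q (suc (k * 2))
      even′ : P *ᶻ (P *ᶻ u₁ -ᶻ Q *ᶻ u₀) ≡ q *ᶻ e *ᶻ (π *ᶻ t′)
      even′ = begin
        P *ᶻ (P *ᶻ u₁ -ᶻ Q *ᶻ u₀)                       ≡⟨ expand P Q u₀ u₁ ⟩
        P *ᶻ P *ᶻ u₁ -ᶻ Q *ᶻ (P *ᶻ u₀)                  ≡⟨ cong₂ _-ᶻ_ (cong₂ _*ᶻ_ P²≡qπX odd) (cong₂ _*ᶻ_ Q≡qQ° even) ⟩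
        q *ᶻ (π *ᶻ X) *ᶻ (e *ᶻ y) -ᶻ q *ᶻ Q° *ᶻ (e *ᶻ (π *ᶻ t)) ≡⟨ collect q π X e y Q° t ⟩
        q *ᶻ e *ᶻ (π *ᶻ t′)                             ∎
        where
        expand : ∀ P Q u₀ u₁ → P *ᶻ (P *ᶻ u₁ -ᶻ Q *ᶻ u₀) ≡ P *ᶻ P *ᶻ u₁ -ᶻ Q *ᶻ (P *ᶻ u₀)
        expand = solve-∀
        collect : ∀ q π X e y z t → q *ᶻ (π *ᶻ X) *ᶻ (e *ᶻ y) -ᶻ q *ᶻ z *ᶻ (e *ᶻ (π *ᶻ t)) ≡ q *ᶻ e *ᶻ (π *ᶻ (X *ᶻ y -ᶻ z *ᶻ t))
        collect = solve-∀
      odd′ : P *ᶻ (P *ᶻ u₁ -ᶻ Q *ᶻ u₀) -ᶻ Q *ᶻ u₁ ≡ q *ᶻ e *ᶻ (π *ᶻ t′ -ᶻ Q° *ᶻ y)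
      odd′ = trans (cong₂ (λ x z → x -ᶻ z) even′ (cong₂ _*ᶻ_ Q≡qQ° odd)) (collect q e (π *ᶻ t′) Q° y)
        where
        collect : ∀ q e x z y → q *ᶻ e *ᶻ x -ᶻ q *ᶻ z *ᶻ (e *ᶻ y) ≡ q *ᶻ e *ᶻ (x -ᶻ z *ᶻ y)
        collect = solve-∀
      p∤y′ : ¬ π ∣ˢ π *ᶻ t′ -ᶻ Q° *ᶻ y
      p∤y′ d = prime-∤-* p-prime p∤Q° p∤y (subst (π ∣ˢ_) (cancel (π *ᶻ t′) (Q° *ᶻ y)) (∣m∣n⇒∣m-n (∣m⇒∣m*n t′ ∣-refl) d))
        where
        cancel : ∀ x y → x -ᶻ (x -ᶻ y) ≡ y
        cancel = solve-∀

    vℤ-U-odd : ∀ k → vℤ p (U P Q (suc (k * 2))) ≡ k * b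
    vℤ-U-odd k with U-odd k
    ... | y , t , odd , _ , p∤y = trans (cong (vℤ p) odd)
      (trans (vℤ-p^^-* p-prime b k (λ { refl → p∤y (dividesˢ 0ℤ refl) }))
        (trans (cong (λ x → k * b + x) (vℤ-∤ p-prime p∤y)) (ℕ.+-identityʳ (k * b))))

    D″≡ : D″ ≡ π *ᶻ (X *ᶻ (π *ᶻ X -ᶻ + 4 *ᶻ Q°))
    D″≡ = identity π X Q°
      where
      identity : ∀ π X y → (π *ᶻ X -ᶻ + 2 *ᶻ y) *ᶻ ((π *ᶻ X -ᶻ + 2 *ᶻ y) *ᶻ 1ℤ) -ᶻ + 4 *ᶻ (y *ᶻ y) ≡ π *ᶻ (X *ᶻ (π *ᶻ X -ᶻ + 4 *ᶻ y))
      identity = solve-∀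

    p∣D″ : π ∣ˢ D″
    p∣D″ = subst (π ∣ˢ_) (sym D″≡) (∣m⇒∣m*n (X *ᶻ (π *ᶻ X -ᶻ + 4 *ᶻ Q°)) ∣-refl)

    p∤Q″ : ¬ π ∣ˢ Q″
    p∤Q″ = prime-∤-* p-prime p∤Q° p∤Q°

    e = vℤ p (U P″ Q″ p)

    p∣X : 2 * a ≢ b + 1 → π ∣ˢ X
    p∣X 2a≢b+1 = ∣m⇒∣m*n (P° *ᶻ P°) (∣ᵤ⇒∣ {π} {+ (p ^ c)} (positive c refl))
      where
      positive : ∀ k → c ≡ k → p ∣ p ^ k
      positive zero    c≡0 = contradiction (trans (ℕ.≤-antisym (ℕ.m∸n≡0⇒m≤n c≡0) b<2a) (ℕ.+-comm 1 b)) 2a≢b+1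
      positive (suc k) _   = ℕ.m∣m*n (p ^ k)

    -- If `p` is 2 or 3, then `c > 0` and so `p ∣ X`. In `D″ = π X (π X - 4Q°)` all three factors
    -- are then even for `p = 2`, and the first two are divisible by 3 for `p = 3`, which gives the
    -- required 8 and 9.
    e≡1 : ¬ (2 * a ≡ b + 1 × (p ≡ 2 ⊎ p ≡ 3)) → e ≡ 1
    e≡1 ¬exc = vℤ-U[p]≡1 p-prime P″ Q″ p∣D″ p∤Q″
      (λ p≡2 → subst (+ 8 ∣ˢ_) (sym D″≡) (two p≡2 (p∣X (λ eq → ¬exc (eq , inj₁ p≡2)))))
      (λ p≡3 → subst (+ 9 ∣ˢ_) (sym D″≡) (three p≡3 (p∣X (λ eq → ¬exc (eq , inj₂ p≡3)))))
      where
      two : p ≡ 2 → π ∣ˢ X → + 8 ∣ˢ π *ᶻ (X *ᶻ (π *ᶻ X -ᶻ + 4 *ᶻ Q°))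
      two p≡2 (dividesˢ x X≡xπ) = dividesˢ (+ 2 *ᶻ (x *ᶻ (x -ᶻ Q°))) (trans
        (cong₂ (λ π′ X′ → π′ *ᶻ (X′ *ᶻ (π′ *ᶻ X′ -ᶻ + 4 *ᶻ Q°))) (cong +_ p≡2) (trans X≡xπ (cong (λ k → x *ᶻ + k) p≡2)))
        (identity x Q°))
        where
        identity : ∀ x y → + 2 *ᶻ (x *ᶻ + 2 *ᶻ (+ 2 *ᶻ (x *ᶻ + 2) -ᶻ + 4 *ᶻ y)) ≡ + 2 *ᶻ (x *ᶻ (x -ᶻ y)) *ᶻ + 8
        identity = solve-∀
      three : p ≡ 3 → π ∣ˢ X → + 9 ∣ˢ π *ᶻ (X *ᶻ (π *ᶻ X -ᶻ + 4 *ᶻ Q°))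
      three p≡3 (dividesˢ x X≡xπ) = dividesˢ (x *ᶻ (+ 9 *ᶻ x -ᶻ + 4 *ᶻ Q°)) (trans
        (cong₂ (λ π′ X′ → π′ *ᶻ (X′ *ᶻ (π′ *ᶻ X′ -ᶻ + 4 *ᶻ Q°))) (cong +_ p≡3) (trans X≡xπ (cong (λ k → x *ᶻ + k) p≡3)))
        (identity x Q°))
        where
        identity : ∀ x y → + 3 *ᶻ (x *ᶻ + 3 *ᶻ (+ 3 *ᶻ (x *ᶻ + 3) -ᶻ + 4 *ᶻ y)) ≡ (x *ᶻ (+ 9 *ᶻ x -ᶻ + 4 *ᶻ y)) *ᶻ + 9
        identity = solve-∀

    w = P° ^ᶻ 2 -ᶻ Q°

    -- Now `c = 0` and `P″ = p P°² - 2Q°`. For `p = 2` the term is `P″ = 2w`. For `p = 3` it is `P″²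
    -- - Q°² = (P″ - Q°)(P″ + Q°) = 3w (3P°² - Q°)`, whose last factor is prime to 3.
    e-exceptional : 2 * a ≡ b + 1 → p ≡ 2 ⊎ p ≡ 3 → e ≡ 1 + vℤ p w
    e-exceptional 2a≡b+1 p≡2⊎3 = [ two , three ]′ p≡2⊎3
      where
      c≡0 : c ≡ 0
      c≡0 = trans (cong (_∸ suc b) (trans 2a≡b+1 (ℕ.+-comm b 1))) (ℕ.n∸n≡0 b)
      X≡P°² : X ≡ P° *ᶻ P°
      X≡P°² = trans (cong (λ k → + (p ^ k) *ᶻ (P° *ᶻ P°)) c≡0) (ℤ.*-identityˡ (P° *ᶻ P°))
      finish : ∀ y → U P″ Q″ p ≡ π *ᶻ y *ᶻ w → ¬ π ∣ˢ y → e ≡ 1 + vℤ p w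
      finish y eq p∤y = begin
        e                                 ≡⟨ cong (vℤ p) eq ⟩
        vℤ p (π *ᶻ y *ᶻ w)                ≡⟨ vℤ-* p-prime πy≢0 w≢0 ⟩
        vℤ p (π *ᶻ y) + vℤ p w            ≡⟨ cong (_+ vℤ p w) (vℤ-* p-prime π≢0 y≢0) ⟩
        v p p + vℤ p y + vℤ p w           ≡⟨ cong₂ (λ i j → i + j + vℤ p w) (v-p p-prime) (vℤ-∤ p-prime p∤y) ⟩
        1 + vℤ p w                        ∎
        where
        open ≡-Reasoning
        π≢0 : π ≢ 0ℤ
        π≢0 = ≢-nonZero⁻¹ p ∘ ℤ.+-injective
        y≢0 : y ≢ 0ℤ
        y≢0 y≡0 = p∤y (subst (π ∣ˢ_) (sym y≡0) (dividesˢ 0ℤ refl))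
        πy≢0 : π *ᶻ y ≢ 0ℤ
        πy≢0 = *-≢0 p-prime π≢0 y≢0
        w≢0 : w ≢ 0ℤ
        w≢0 w≡0 = U″≢0 p (>-nonZero⁻¹ p) (trans eq (trans (cong (π *ᶻ y *ᶻ_) w≡0) (ℤ.*-zeroʳ (π *ᶻ y))))
      two : p ≡ 2 → e ≡ 1 + vℤ p w
      two p≡2 = finish 1ℤ (trans (cong (U P″ Q″) p≡2) (trans
        (cong₂ (λ k x → (+ k *ᶻ x -ᶻ + 2 *ᶻ Q°) *ᶻ 1ℤ -ᶻ Q″ *ᶻ 0ℤ) p≡2 X≡P°²)
        (trans (identity P° Q°) (cong (λ k → + k *ᶻ 1ℤ *ᶻ w) (sym p≡2))))) (prime-∤1 p-prime)
        where
        identity : ∀ x y → (+ 2 *ᶻ (x *ᶻ x) -ᶻ + 2 *ᶻ y) *ᶻ 1ℤ -ᶻ y *ᶻ y *ᶻ 0ℤ ≡ + 2 *ᶻ 1ℤ *ᶻ (x *ᶻ (x *ᶻ 1ℤ) -ᶻ y)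
        identity = solve-∀
      three : p ≡ 3 → e ≡ 1 + vℤ p w
      three p≡3 = finish (+ 3 *ᶻ (P° *ᶻ P°) -ᶻ Q°) (trans (cong (U P″ Q″) p≡3) (trans
        (cong₂ (λ k x → let P₃ = + k *ᶻ x -ᶻ + 2 *ᶻ Q° in P₃ *ᶻ (P₃ *ᶻ 1ℤ -ᶻ Q″ *ᶻ 0ℤ) -ᶻ Q″ *ᶻ 1ℤ) p≡3 X≡P°²)
        (trans (identity P° Q°) (cong (λ k → + k *ᶻ (+ 3 *ᶻ (P° *ᶻ P°) -ᶻ Q°) *ᶻ w) (sym p≡3)))))
        (λ d → p∤Q° (subst (π ∣ˢ_) (cancel (+ 3 *ᶻ (P° *ᶻ P°)) Q°)
          (∣m∣n⇒∣m-n (∣m⇒∣m*n (P° *ᶻ P°) (subst (λ k → π ∣ˢ + k) p≡3 ∣-refl)) d)))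
        where
        cancel : ∀ x y → x -ᶻ (x -ᶻ y) ≡ y
        cancel = solve-∀
        identity : ∀ x y → (+ 3 *ᶻ (x *ᶻ x) -ᶻ + 2 *ᶻ y) *ᶻ ((+ 3 *ᶻ (x *ᶻ x) -ᶻ + 2 *ᶻ y) *ᶻ 1ℤ -ᶻ y *ᶻ y *ᶻ 0ℤ) -ᶻ y *ᶻ y *ᶻ 1ℤ
          ≡ + 3 *ᶻ (+ 3 *ᶻ (x *ᶻ x) -ᶻ y) *ᶻ (x *ᶻ (x *ᶻ 1ℤ) -ᶻ y)
        identity = solve-∀

    half : ℕ → ℕ
    half d = (d ∸ 1) / 2

    -- Subtracting `b ⌊(d - 1) / 2⌋`, the power of `q` common to both parities, leaves a function
    -- that vanishes at odd `d`, hence one that fits `Tower` with `z = 2`.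
    excess : ℕ → ℤ
    excess d = + vℤ p (U P Q d) -ᶻ + b *ᶻ + half d

    half-even : ∀ k → half (suc k * 2) ≡ k
    half-even k = trans (cong (_/ 2) (trans (ℕ.+-comm 1 (k * 2)) (cong (_+ 1) (ℕ.*-comm k 2)))) ([2x+r]/2≡x k 1 ℕ.≤-refl)

    excess-even : ∀ m → 1 ≤ m → excess (m * 2) ≡ + (a + vℤ p (U P″ Q″ m))
    excess-even (suc k) _ = begin
      + vℤ p (U P Q (suc k * 2)) -ᶻ + b *ᶻ + half (suc k * 2)
        ≡⟨ cong₂ (λ x y → + x -ᶻ + b *ᶻ + y) (vℤ-U-even k) (half-even k) ⟩
      + a +ᶻ (+ (k * b) +ᶻ + u) -ᶻ + b *ᶻ + k
        ≡⟨ cong (λ x → + a +ᶻ (x +ᶻ + u) -ᶻ + b *ᶻ + k) (ℤ.pos-* k b) ⟩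
      + a +ᶻ (+ k *ᶻ + b +ᶻ + u) -ᶻ + b *ᶻ + k
        ≡⟨ identity (+ a) (+ b) (+ k) (+ u) ⟩
      + a +ᶻ + u ∎
      where
      open ≡-Reasoning
      u = vℤ p (U P″ Q″ (suc k))
      identity : ∀ a b k u → a +ᶻ (k *ᶻ b +ᶻ u) -ᶻ b *ᶻ k ≡ a +ᶻ u
      identity = solve-∀

    excess-odd : ∀ d → 1 ≤ d → ¬ 2 ∣ d → excess d ≡ 0ℤ
    excess-odd d _ 2∤d = odd (d % 2) (m%n<n d 2) (m≡m%n+[m/n]*n d 2)
      where
      k = d / 2
      odd : ∀ r → r < 2 → d ≡ r + k * 2 → excess d ≡ 0ℤ
      odd zero          _              eq = contradiction (divides k eq) 2∤d
      odd (suc zero)    _              eq = trans (cong₂ (λ x y → + x -ᶻ + b *ᶻ + y)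
          (trans (cong (λ i → vℤ p (U P Q i)) eq) (vℤ-U-odd k))
          (trans (cong half eq) (m*n/n≡m k 2)))
        (trans (cong (λ x → x -ᶻ + b *ᶻ + k) (ℤ.pos-* k b)) (identity (+ b) (+ k)))
        where
        identity : ∀ b k → k *ᶻ b -ᶻ b *ᶻ k ≡ 0ℤ
        identity = solve-∀
      odd (suc (suc _)) (s≤s (s≤s ())) _

    -- At `d = 2m` the excess is `a` plus the valuation of the `m`-th term of the reduced sequence,
    -- which is 0 for `p ∤ m` and `e + v_p(m / p)` otherwise. The increments are thus `a`, `e`, 1,
    -- 1, ....
    module T = Tower p-prime 2 excess (+ a) (+ (a + e)) excess-odd
      (λ m p∤m → trans (excess-even m (>-nonZero⁻¹ m {{∤⇒nonZero p-prime p∤m}}))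
        (cong +_ (trans (cong (λ x → a + x) (vℤ-U-∤ p-prime P″ Q″ p∣D″ p∤Q″ U″≢0 m p∤m)) (ℕ.+-identityʳ a))))
      (λ m 1≤m → trans (excess-even (m * p) (ℕ.*-mono-≤ 1≤m (>-nonZero⁻¹ p)))
        (cong +_ (trans (cong (λ x → a + x) (vℤ-U-∣ p-prime P″ Q″ p∣D″ p∤Q″ U″≢0 m 1≤m)) (sym (ℕ.+-assoc a e (v p m))))))

    möbiusSum-U : ∀ n .{{_ : NonZero n}} →
      möbiusSum (λ d → + vℤ p (U P Q d)) n ≡ + (φ n / 2 * b) +ᶻ möbiusSum excess n
    möbiusSum-U n = begin
      möbiusSum (λ d → + vℤ p (U P Q d)) n
        ≡⟨ möbiusSum-cong n (λ d _ _ → identity (+ vℤ p (U P Q d)) (+ b *ᶻ + half d)) ⟩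
      möbiusSum (λ d → + b *ᶻ + half d +ᶻ excess d) n
        ≡⟨ möbiusSum-+ n (λ d → + b *ᶻ + half d) excess ⟩
      möbiusSum (λ d → + b *ᶻ + half d) n +ᶻ möbiusSum excess n
        ≡⟨ cong (_+ᶻ möbiusSum excess n) (trans (möbiusSum-*ˡ n (+ b) (λ d → + half d))
             (trans (cong (+ b *ᶻ_) (möbiusSum-⌊[d∸1]/2⌋ n)) (trans (ℤ.*-comm (+ b) (+ (φ n / 2))) (sym (ℤ.pos-* (φ n / 2) b))))) ⟩
      + (φ n / 2 * b) +ᶻ möbiusSum excess n ∎
      where
      open ≡-Reasoning
      identity : ∀ x y → x ≡ y +ᶻ (x -ᶻ y)
      identity = solve-∀

  at-2 : möbiusSum (λ d → + vℤ p (U P Q d)) 2 ≡ + a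
  -- `φ 2 / 2` computes to 0, so only the excess remains.
  at-2 = trans (möbiusSum-U 2) (trans (cong (+ (φ 2 / 2 * b) +ᶻ_) (T.möbiusSum-at 2 0 refl)) (ℤ.+-identityˡ (+ a)))

  -- Only level `k = 1` sees `e`, so the exceptional case has to be excluded at `n = 2p` alone; from
  -- `k = 2` on the increment is 1 by definition.
  at-2p^ : ∀ n .{{_ : NonZero n}} k → 1 ≤ k → n ≡ 2 * p ^ k →
    (n ≡ 2 * p → ¬ (2 * a ≡ b + 1 × (p ≡ 2 ⊎ p ≡ 3))) →
    möbiusSum (λ d → + vℤ p (U P Q d)) n ≡ + (φ n / 2 * b + 1)
  at-2p^ n k 1≤k n≡2p^k ¬exc = trans (möbiusSum-U n) (cong (+ (φ n / 2 * b) +ᶻ_) (excess-at k 1≤k n≡2p^k))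
    where
    excess-at : ∀ k → 1 ≤ k → n ≡ 2 * p ^ k → möbiusSum excess n ≡ 1ℤ
    excess-at (suc zero) _ eq = trans (T.möbiusSum-at n 1 (trans eq (ℕ.*-comm 2 (p ^ 1))))
      (trans (cancel (+ a) (+ e)) (cong +_ (e≡1 (¬exc (trans eq (cong (2 *_) (ℕ.*-identityʳ p)))))))
      where
      cancel : ∀ x y → x +ᶻ y -ᶻ x ≡ y
      cancel = solve-∀
    excess-at k@(suc (suc _)) _ eq = T.möbiusSum-at n k (trans eq (ℕ.*-comm 2 (p ^ k)))

  off-2p^ : ∀ n .{{_ : NonZero n}} → n ≢ 2 → (∀ k → 1 ≤ k → n ≢ 2 * p ^ k) →
    möbiusSum (λ d → + vℤ p (U P Q d)) n ≡ + (φ n / 2 * b)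
  off-2p^ n n≢2 n≢2p^k = trans (möbiusSum-U n)
    (trans (cong (+ (φ n / 2 * b) +ᶻ_) (T.möbiusSum-off n off)) (ℤ.+-identityʳ (+ (φ n / 2 * b))))
    where
    off : ∀ k → n ≢ p ^ k * 2
    off zero    eq = n≢2 eq
    off (suc k) eq = n≢2p^k (suc k) (s≤s z≤n) (trans eq (ℕ.*-comm (p ^ suc k) 2))

  at-exceptional : ∀ n .{{_ : NonZero n}} → 2 * a ≡ b + 1 → p ≡ 2 ⊎ p ≡ 3 → n ≡ 2 * p →
    möbiusSum (λ d → + vℤ p (U P Q d)) n ≡ + (b + 1 + vℤ p (∂ p-prime P ^ᶻ 2 -ᶻ ∂ p-prime Q))
  at-exceptional n 2a≡b+1 p≡2⊎3 n≡2p = begin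
    möbiusSum (λ d → + vℤ p (U P Q d)) n
      ≡⟨ möbiusSum-U n ⟩
    + (φ n / 2 * b) +ᶻ möbiusSum excess n
      -- `φ 4 / 2` and `φ 6 / 2` both compute to 1, whence the single `b`.
      ≡⟨ cong₂ (λ x y → + (x * b) +ᶻ y) ([ (λ p≡2 → cong (λ k → φ k / 2) (trans n≡2p (cong (2 *_) p≡2)))
                                         , (λ p≡3 → cong (λ k → φ k / 2) (trans n≡2p (cong (2 *_) p≡3))) ]′ p≡2⊎3)
           (T.möbiusSum-at n 1 (trans n≡2p (trans (cong (2 *_) (sym (ℕ.*-identityʳ p))) (ℕ.*-comm 2 (p ^ 1))))) ⟩
    + (1 * b) +ᶻ (+ a +ᶻ + e -ᶻ + a)
      ≡⟨ cong₂ (λ x y → + x +ᶻ y) (ℕ.*-identityˡ b) (trans (cancel (+ a) (+ e)) (cong +_ (e-exceptional 2a≡b+1 p≡2⊎3))) ⟩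
    + (b + (1 + vℤ p w))
      ≡⟨ cong +_ (ℕ.+-assoc b 1 (vℤ p w)) ⟨
    + (b + 1 + vℤ p w) ∎
    where
    open ≡-Reasoning
    cancel : ∀ x y → x +ᶻ y -ᶻ x ≡ y
    cancel = solve-∀

-- Towers for the primes that do not divide `Q`

module RankOfApparition {p : ℕ} (p-prime : Prime p) (P Q : ℤ) (U≢0 : NonVanishing (U P Q)) (p∤Q : ¬ + p ∣ˢ Q)
  {z : ℕ} (z-entry : IsEntryPoint P Q p z) where

  private
    instance
      z≢0 : NonZero z
      z≢0 = >-nonZero (proj₁ z-entry)
    1≤z = proj₁ z-entry
    P′ = V P Q z
    Q′ = Q ^ᶻ z
    p∤Q′ = prime-∤-^ p-prime z p∤Q
    U′≢0 = U-stride-nonVanishing P Q z 1≤z U≢0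
    stride = vℤ-U-stride p-prime P Q z

    -- Whatever `D` is, the factor `U_z²` makes the subsequence `U_{mz} / U_z` one whose
    -- discriminant is divisible by `p`, so the ramified valuations apply to it.
    p∣D′ : + p ∣ˢ discriminant P′ Q′
    p∣D′ = subst (+ p ∣ˢ_) (sym (discriminant-V P Q z))
      (∣n⇒∣m*n (discriminant P Q) (∣m⇒∣m*n (U P Q z) (∣ᵤ⇒∣ {+ p} {U P Q z} (proj₁ (proj₂ z-entry)))))

    at-z : ∀ m → ¬ p ∣ m → vℤ p (U P Q (m * z)) ≡ vℤ p (U P Q z)
    at-z m p∤m = trans (stride m U≢0 1≤z (>-nonZero⁻¹ m {{∤⇒nonZero p-prime p∤m}}))
      (trans (cong (λ x → vℤ p (U P Q z) + x) (vℤ-U-∤ p-prime P′ Q′ p∣D′ p∤Q′ U′≢0 m p∤m)) (ℕ.+-identityʳ _))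

    at-pz : ∀ m → 1 ≤ m → vℤ p (U P Q (m * p * z)) ≡ vℤ p (U P Q (p * z)) + v p m
    at-pz m 1≤m = begin
      vℤ p (U P Q (m * p * z))
        ≡⟨ stride (m * p) U≢0 1≤z (ℕ.*-mono-≤ 1≤m (1≤p p-prime)) ⟩
      vℤ p (U P Q z) + vℤ p (U P′ Q′ (m * p))
        ≡⟨ cong (λ x → vℤ p (U P Q z) + x) (vℤ-U-∣ p-prime P′ Q′ p∣D′ p∤Q′ U′≢0 m 1≤m) ⟩
      vℤ p (U P Q z) + (vℤ p (U P′ Q′ p) + v p m)
        ≡⟨ ℕ.+-assoc (vℤ p (U P Q z)) (vℤ p (U P′ Q′ p)) (v p m) ⟨
      vℤ p (U P Q z) + vℤ p (U P′ Q′ p) + v p m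
        ≡⟨ cong (_+ v p m) (stride p U≢0 1≤z (1≤p p-prime)) ⟨
      vℤ p (U P Q (p * z)) + v p m ∎
      where open ≡-Reasoning

  open Tower p-prime z (λ d → + vℤ p (U P Q d)) (+ vℤ p (U P Q z)) (+ vℤ p (U P Q (p * z)))
    (λ d _ z∤d → cong +_ (vℤ-∤ p-prime (entryPoint-∤ p-prime P Q p∤Q z-entry d z∤d)))
    (λ m p∤m → cong +_ (at-z m p∤m))
    (λ m 1≤m → cong +_ (at-pz m 1≤m))
    public

module RamifiedPrime {p : ℕ} (p-prime : Prime p) (P Q : ℤ) (U≢0 : NonVanishing (U P Q)) (p∤Q : ¬ + p ∣ˢ Q)
  (p∣D : + p ∣ˢ discriminant P Q) where

  -- The tower stands on 1 with value 0 there, although `p` first divides `U_p`: this makes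
  -- `v_p(U_p)` the increment at level 1 and leaves 1 for every `p ^ k` with `k > 1`.
  open Tower p-prime 1 (λ d → + vℤ p (U P Q d)) 0ℤ (+ vℤ p (U P Q p))
    (λ d _ 1∤d → contradiction (ℕ.1∣ d) 1∤d)
    (λ m p∤m → cong +_ (trans (cong (λ i → vℤ p (U P Q i)) (ℕ.*-identityʳ m)) (vℤ-U-∤ p-prime P Q p∣D p∤Q U≢0 m p∤m)))
    (λ m 1≤m → cong +_ (trans (cong (λ i → vℤ p (U P Q i)) (ℕ.*-identityʳ (m * p))) (vℤ-U-∣ p-prime P Q p∣D p∤Q U≢0 m 1≤m)))
    public

-- The cases, read off from the transforms of `v_p(U_d)`

theorem2p2 :
  ∀ (P Q : ℤ) → P ≢ 0ℤ → Q ≢ 0ℤ → discriminant P Q ≢ 0ℤ → Nondegenerate P Q →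
  ∀ (p : ℕ) (p-prime : Prime p) (n : ℕ) → 1 ≤ n →
  let D  = discriminant P Q
      Uₙ = U P Q
      vM = vℚ p (möbiusDual (U P Q) n)
      a  = vℤ p P
      b  = vℤ p Q
      exceptional = 2 * a ≡ b + 1 × (p ≡ 2 ⊎ p ≡ 3) × n ≡ 2 * p
  in
  (¬ (+ p ∣ᶻ gcdᶻ P Q) →
    (+ p ∣ᶻ Q → vM ≡ 0ℤ)
    × (+ p ∣ᶻ D →
        (n ≡ p → vM ≡ + vℤ p (Uₙ p))
        × (∀ k → 1 < k → n ≡ p ^ k → vM ≡ 1ℤ)
        × (n ≢ p → (∀ k → 1 < k → n ≢ p ^ k) → vM ≡ 0ℤ))
    × (¬ (+ p ∣ᶻ Q *ᶻ D) →
        ∃[ z ] (IsEntryPoint P Q p z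
          × (n ≡ z → vM ≡ + vℤ p (Uₙ z))
          × (n ≡ p * z → vM ≡ + vℤ p (Uₙ (p * z)) -ᶻ + vℤ p (Uₙ z))
          × (∀ k → 1 < k → n ≡ p ^ k * z → vM ≡ 1ℤ)
          × (n ≢ z → n ≢ p * z → (∀ k → 1 < k → n ≢ p ^ k * z) → vM ≡ 0ℤ))))
  × (+ p ∣ᶻ gcdᶻ P Q →
    (2 * a ≤ b →
        (n ≡ 1 → vM ≡ 0ℤ)
        × (1 < n → vM ≡ + (φ n * a) +ᶻ vℚ p (möbiusDual (U⁽ᵖ⁾ p-prime P Q) n)))
    × (b < 2 * a →
        (exceptional → vM ≡ + (b + 1 + vℤ p (∂ p-prime P ^ᶻ 2 -ᶻ ∂ p-prime Q)))
        × (¬ exceptional →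
            (n ≡ 2 → vM ≡ + a)
            × (∀ k → 1 ≤ k → n ≡ 2 * p ^ k → vM ≡ + (φ n / 2 * b + 1))
            × (n ≢ 2 → (∀ k → 1 ≤ k → n ≢ 2 * p ^ k) → vM ≡ + (φ n / 2 * b)))))
theorem2p2 P Q P≢0 Q≢0 D≢0 nondegenerate p p-prime n 1≤n = coprime , common
  where
  open ≡-Reasoning
  instance
    n≢0 : NonZero n
    n≢0 = >-nonZero 1≤n

  D = discriminant P Q
  vM = vℚ p (möbiusDual (U P Q) n)
  a = vℤ p P
  b = vℤ p Q

  U≢0 : NonVanishing (U P Q)
  U≢0 m 1≤m = proj₁ (nondegenerate m 1≤m)

  vM≡ : vM ≡ möbiusSum (λ d → + vℤ p (U P Q d)) n
  vM≡ = vℚ-möbiusDual p-prime (U P Q) n U≢0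

  coprime : ¬ (+ p ∣ᶻ gcdᶻ P Q) → _
  coprime p∤gcd = divides-Q , ramified , unramified
    where
    ¬both : + p ∣ˢ P → ¬ + p ∣ˢ Q
    ¬both p∣P p∣Q = p∤gcd (ℤ.gcd-greatest {P} {Q} {+ p} (∣⇒∣ᵤ p∣P) (∣⇒∣ᵤ p∣Q))

    divides-Q : + p ∣ᶻ Q → vM ≡ 0ℤ
    divides-Q p∣Q = trans vM≡ (trans (möbiusSum-cong n vanish) (möbiusSum-zero n))
      where
      p∣ˢQ : + p ∣ˢ Q
      p∣ˢQ = ∣ᵤ⇒∣ p∣Q
      vanish : ∀ d → 1 ≤ d → d ≤ n → + vℤ p (U P Q d) ≡ 0ℤ
      vanish (suc d) _ _ = cong +_ (vℤ-∤ p-prime (U-∤-of-∣Q p-prime P Q p∣ˢQ (λ p∣P → ¬both p∣P p∣ˢQ) d))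

    ramified : + p ∣ᶻ D → (n ≡ p → vM ≡ + vℤ p (U P Q p)) × (∀ k → 1 < k → n ≡ p ^ k → vM ≡ 1ℤ)
      × (n ≢ p → (∀ k → 1 < k → n ≢ p ^ k) → vM ≡ 0ℤ)
    ramified p∣D = at-p , at-p^ , off
      where
      p∣ˢD : + p ∣ˢ D
      p∣ˢD = ∣ᵤ⇒∣ p∣D
      identity : ∀ P Q → P *ᶻ P ≡ (P *ᶻ (P *ᶻ 1ℤ) -ᶻ + 4 *ᶻ Q) +ᶻ + 4 *ᶻ Q
      identity = solve-∀
      p∤Q : ¬ + p ∣ˢ Q
      -- With `p ∣ D` and `p ∣ Q` also `P² = D + 4Q` would be divisible by `p`, and then so would
      -- `gcd(P, Q)`.
      p∤Q p∣Q = [ (λ p∣P → ¬both p∣P p∣Q) , (λ p∣P → ¬both p∣P p∣Q) ]′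
        (prime-∣-* p-prime P P (subst (+ p ∣ˢ_) (sym (identity P Q)) (∣m∣n⇒∣m+n p∣ˢD (∣n⇒∣m*n (+ 4) p∣Q))))
      module R = RamifiedPrime p-prime P Q U≢0 p∤Q p∣ˢD
      at-p : n ≡ p → vM ≡ + vℤ p (U P Q p)
      at-p n≡p = trans vM≡ (trans (R.möbiusSum-at n 1 (trans n≡p (sym (trans (ℕ.*-identityʳ _) (ℕ.*-identityʳ p)))))
        (ℤ.+-identityʳ _))
      at-p^ : ∀ k → 1 < k → n ≡ p ^ k → vM ≡ 1ℤ
      at-p^ (suc zero) (s≤s ())
      at-p^ k@(suc (suc _)) _ n≡p^k = trans vM≡ (R.möbiusSum-at n k (trans n≡p^k (sym (ℕ.*-identityʳ (p ^ k)))))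
      off : n ≢ p → (∀ k → 1 < k → n ≢ p ^ k) → vM ≡ 0ℤ
      off n≢p n≢p^k = trans vM≡ (case n ℕ.≟ 1 of λ where
        -- `n = 1` lies on the tower, at its foot, but the increment there is 0.
        (yes n≡1) → R.möbiusSum-at n 0 n≡1
        (no n≢1)  → R.möbiusSum-off n (λ where
          zero            eq → n≢1 eq
          (suc zero)      eq → n≢p (trans eq (trans (ℕ.*-identityʳ _) (ℕ.*-identityʳ p)))
          k@(suc (suc _)) eq → n≢p^k k (s≤s (s≤s z≤n)) (trans eq (ℕ.*-identityʳ (p ^ k)))))

    unramified : ¬ (+ p ∣ᶻ Q *ᶻ D) → ∃[ z ] (IsEntryPoint P Q p z
      × (n ≡ z → vM ≡ + vℤ p (U P Q z))
      × (n ≡ p * z → vM ≡ + vℤ p (U P Q (p * z)) -ᶻ + vℤ p (U P Q z))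
      × (∀ k → 1 < k → n ≡ p ^ k * z → vM ≡ 1ℤ)
      × (n ≢ z → n ≢ p * z → (∀ k → 1 < k → n ≢ p ^ k * z) → vM ≡ 0ℤ))
    unramified p∤QD = z , z-entry , at-z , at-pz , at-p^z , off
      where
      p∤Q : ¬ + p ∣ˢ Q
      p∤Q p∣Q = p∤QD (∣⇒∣ᵤ (∣m⇒∣m*n D p∣Q))
      z = proj₁ (entryPoint p-prime P Q p∤Q)
      z-entry = proj₂ (entryPoint p-prime P Q p∤Q)
      module R = RankOfApparition p-prime P Q U≢0 p∤Q z-entry
      at-z : n ≡ z → vM ≡ + vℤ p (U P Q z)
      at-z n≡z = trans vM≡ (R.möbiusSum-at n 0 (trans n≡z (sym (ℕ.*-identityˡ z))))
      at-pz : n ≡ p * z → vM ≡ + vℤ p (U P Q (p * z)) -ᶻ + vℤ p (U P Q z)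
      at-pz n≡pz = trans vM≡ (R.möbiusSum-at n 1 (trans n≡pz (cong (_* z) (sym (ℕ.*-identityʳ p)))))
      at-p^z : ∀ k → 1 < k → n ≡ p ^ k * z → vM ≡ 1ℤ
      at-p^z (suc zero) (s≤s ())
      at-p^z k@(suc (suc _)) _ n≡p^kz = trans vM≡ (R.möbiusSum-at n k n≡p^kz)
      off : n ≢ z → n ≢ p * z → (∀ k → 1 < k → n ≢ p ^ k * z) → vM ≡ 0ℤ
      off n≢z n≢pz n≢p^kz = trans vM≡ (R.möbiusSum-off n (λ where
        zero            eq → n≢z (trans eq (ℕ.*-identityˡ z))
        (suc zero)      eq → n≢pz (trans eq (cong (_* z) (ℕ.*-identityʳ p)))
        k@(suc (suc _)) eq → n≢p^kz k (s≤s (s≤s z≤n)) eq))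

  common : + p ∣ᶻ gcdᶻ P Q → _
  common _ = largeQ , smallQ
    where
    largeQ : 2 * a ≤ b → (n ≡ 1 → vM ≡ 0ℤ)
      × (1 < n → vM ≡ + (φ n * a) +ᶻ vℚ p (möbiusDual (U⁽ᵖ⁾ p-prime P Q) n))
    largeQ 2a≤b = at-1 , above
      where
      module L = LargeQ p-prime P Q P≢0 Q≢0 U≢0 2a≤b
      at-1 : n ≡ 1 → vM ≡ 0ℤ
      at-1 refl = trans vM≡ (trans (möbiusSum-cong 1 vanish) (möbiusSum-zero 1))
        where
        vanish : ∀ d → 1 ≤ d → d ≤ 1 → + vℤ p (U P Q d) ≡ 0ℤ
        vanish 1 _ _ = cong +_ (vℤ-∤ p-prime (prime-∤1 p-prime))
        vanish (suc (suc _)) _ (s≤s ())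
      above : 1 < n → vM ≡ + (φ n * a) +ᶻ vℚ p (möbiusDual (U⁽ᵖ⁾ p-prime P Q) n)
      above 1<n = begin
        vM
          ≡⟨ vM≡ ⟩
        möbiusSum (λ d → + vℤ p (U P Q d)) n
          ≡⟨ L.möbiusSum-vℤ-U n ⟩
        + a *ᶻ (+ φ n +ᶻ -1ℤ *ᶻ ⟦ n ℕ.≟ 1 ⟧) +ᶻ möbiusSum (λ d → + vℤ p (U⁽ᵖ⁾ p-prime P Q d)) n
          ≡⟨ cong₂ _+ᶻ_
               (trans (cong (λ x → + a *ᶻ (+ φ n +ᶻ -1ℤ *ᶻ x)) (⟦⟧-no (n ℕ.≟ 1) (ℕ.<⇒≢ 1<n ∘ sym)))
                 (trans (identity (+ a) (+ φ n)) (sym (ℤ.pos-* (φ n) a))))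
               (sym (vℚ-möbiusDual p-prime (U⁽ᵖ⁾ p-prime P Q) n L.U⁽ᵖ⁾-nonVanishing)) ⟩
        + (φ n * a) +ᶻ vℚ p (möbiusDual (U⁽ᵖ⁾ p-prime P Q) n) ∎
        where
        identity : ∀ x y → x *ᶻ (y +ᶻ -1ℤ *ᶻ 0ℤ) ≡ y *ᶻ x
        identity = solve-∀

    exceptional = 2 * a ≡ b + 1 × (p ≡ 2 ⊎ p ≡ 3) × n ≡ 2 * p

    smallQ : b < 2 * a →
      (exceptional → vM ≡ + (b + 1 + vℤ p (∂ p-prime P ^ᶻ 2 -ᶻ ∂ p-prime Q)))
      × (¬ exceptional →
          (n ≡ 2 → vM ≡ + a)
          × (∀ k → 1 ≤ k → n ≡ 2 * p ^ k → vM ≡ + (φ n / 2 * b + 1))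
          × (n ≢ 2 → (∀ k → 1 ≤ k → n ≢ 2 * p ^ k) → vM ≡ + (φ n / 2 * b)))
    smallQ b<2a =
        (λ { (2a≡b+1 , p≡2⊎3 , n≡2p) → trans vM≡ (S.at-exceptional n 2a≡b+1 p≡2⊎3 n≡2p) })
      , λ ¬exceptional →
          (λ n≡2 → trans vM≡ (trans (cong (möbiusSum (λ d → + vℤ p (U P Q d))) n≡2) S.at-2))
        , (λ k 1≤k n≡2p^k → trans vM≡ (S.at-2p^ n k 1≤k n≡2p^k
            (λ { n≡2p (2a≡b+1 , p≡2⊎3) → ¬exceptional (2a≡b+1 , p≡2⊎3 , n≡2p) })))
        , (λ n≢2 n≢2p^k → trans vM≡ (S.off-2p^ n n≢2 n≢2p^k))
      where
      module S = SmallQ p-prime P Q P≢0 Q≢0 U≢0 b<2a
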